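{- Let $(\mathcal{A},\varphi,\varphi^\prime)$ be an infinitesimal non-commutative probability space and let $\tilde r_n=r_n+\hbar r^\prime_n$, $\tilde b_n=b_n+\hbar b^\prime_n$, $\tilde h_n=h_n+\hbar h^\prime_n$ be its $\mathbb{G}$-valued free, Boolean and monotone cumulants. Then for every $n$ and $a_1,\dots,a_n\in\mathcal{A}$: \begin{align*} \tilde b_n(a_1,\dots,a_n)&=\sum_{\pi\in\mathcal{NC}_{irr}(n)}\tilde r_\pi(a_1,\dots,a_n),\\ \tilde r_n(a_1,\dots,a_n)&=\sum_{\pi\in\mathcal{NC}_{irr}(n)}(-1)^{|\pi|-1}\tilde b_\pi(a_1,\dots,a_n),\\ \tilde b_n(a_1,\dots,a_n)&=\sum_{\pi\in\mathcal{NC}_{irr}(n)}\frac{1}{\tau(\pi)!}\tilde h_\pi(a_1,\dots,a_n),\\ \tilde r_n(a_1,\dots,a_n)&=\sum_{\pi\in\mathcal{NC}_{irr}(n)}\frac{(-1)^{|\pi|-1}}{\tau(\pi)!}\tilde h_\pi(a_1,\dots,a_n). \end{align*}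
   Context: An infinitesimal non-commutative probability space is $(\mathcal{A},\varphi,\varphi^\prime)$ with $\mathcal{A}$ a unital complex algebra, $\varphi,\varphi^\prime:\mathcal{A}\to\mathbb{C}$ linear, $\varphi(1)=1$, $\varphi^\prime(1)=0$; $\varphi_n(a_1,\dots,a_n)=\varphi(a_1\cdots a_n)$, $\varphi^\prime_n$ similarly. $\mathbb{G}=\{z+\hbar w:z,w\in\mathbb{C}\}$ is the commutative algebra with $\hbar^2=0$. $\mathcal{NC}(n)$, $\mathcal{I}(n)$ are the non-crossing and interval partitions of $[n]$; $\mathcal{NC}_{irr}(n)$ the non-crossing partitions with $1,n$ in the same block; $|\pi|$ the number of blocks; $\tau(\pi)!=\prod_{V\in\pi}N(V)$ with $N(V)$ the number of blocks $W\subseteq\{\min V,\dots,\max V\}$. For maps $f_m$, $f_\pi(a_1,\dots,a_n)=\prod_{V\in\pi}f_{|V|}(a_V)$ ($a_V$ = entries indexed by $V$ in increasing order) and $\partial f_\pi=\sum_{V\in\pi}f^\prime_{|V|}(a_V)\prod_{W\ne V}f_{|W|}(a_W)$. Cumulants: $\varphi_n=\sum_{\mathcal{NC}(n)}r_\pi=\sum_{\mathcal{I}(n)}b_\pi=\sum_{\mathcal{NC}(n)}\frac1{\tau(\pi)!}h_\pi$ and $\varphi^\prime_n=\sum_{\mathcal{NC}(n)}\partial r_\pi=\sum_{\mathcal{I}(n)}\partial b_\pi=\sum_{\mathcal{NC}(n)}\frac1{\tau(\pi)!}\partial h_\pi$ (recursive definitions of $r_n,b_n,h_n,r^\prime_n,b^\prime_n,h^\prime_n$).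 For $\mathbb{G}$-valued $\tilde f_m$, $\tilde f_\pi(a_1,\dots,a_n)=\prod_{V\in\pi}\tilde f_{|V|}(a_V)$, product in $\mathbb{G}$. -}

module Defs where

open import Level using (Level; _⊔_) renaming (suc to lsuc)
open import Data.Nat as ℕ using (ℕ; zero; suc; _∸_; _≡ᵇ_; _<ᵇ_; _≤ᵇ_) renaming (_⊔_ to _⊔ℕ_; _⊓_ to _⊓ℕ_)
open import Data.Bool using (Bool; true; false; _∧_; not; if_then_else_)
open import Data.List using (List; []; _∷_; map; concatMap; upTo; filterᵇ; foldr; length; zip)
open import Data.Bool.ListAction using (any; all)
open import Data.Product using (_×_; _,_; proj₁; proj₂)
open import Algebra.Bundles using (CommutativeRing)
open import Algebra.Module.Bundles using (Module)
open import Relation.Binary.Core using (Rel)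

-- Set partitions of [n] = {0,…,n-1}, encoded by restricted growth
-- strings: a list ℓ of length n with ℓ₀ = 0 and ℓ_{i+1} ≤ max(ℓ₀..ℓᵢ)+1.
-- Positions i, j lie in the same block iff ℓᵢ = ℓⱼ.  This is a bijective
-- encoding of set partitions of [n]; the block with label k is the k-th
-- block in order of smallest elements.

Partition : Set
Partition = List ℕ

-- ext k m : all continuations of length m when k blocks are already open
ext : ℕ → ℕ → List Partition
ext k zero    = [] ∷ []
ext k (suc m) = concatMap (λ c → map (c ∷_) (ext (if c ≡ᵇ k then suc k else k) m)) (upTo (suc k))

allPartitions : ℕ → List Partition
allPartitions n = ext 0 n

-- label of position i (default 0 out of range)
lab : Partition → ℕ → ℕ
lab []      i       = 0
lab (x ∷ π) zero    = x
lab (x ∷ π) (suc i) = lab π i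

positions : Partition → List ℕ
positions π = upTo (length π)

nBlocks : Partition → ℕ
nBlocks π = foldr (λ x m → suc x ⊔ℕ m) 0 π

blockLabels : Partition → List ℕ
blockLabels π = upTo (nBlocks π)

block : Partition → ℕ → List ℕ
block π k = filterᵇ (λ i → lab π i ≡ᵇ k) (positions π)

crossing : Partition → Bool
crossing π = any (λ a → any (λ b → any (λ c → any (λ d →
  (a <ᵇ b) ∧ (b <ᵇ c) ∧ (c <ᵇ d) ∧ (lab π a ≡ᵇ lab π c) ∧ (lab π b ≡ᵇ lab π d)
  ∧ not (lab π a ≡ᵇ lab π b)) ps) ps) ps) ps
  where ps = positions π

isNC : Partition → Bool
isNC π = not (crossing π)

isInterval : Partition → Bool
isInterval π = not (any (λ a → any (λ b → any (λ c →
  (a <ᵇ b) ∧ (b <ᵇ c) ∧ (lab π a ≡ᵇ lab π c) ∧ not (lab π a ≡ᵇ lab π b)) ps) ps) ps)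
  where ps = positions π

isIrr : Partition → Bool
isIrr π = lab π 0 ≡ᵇ lab π (length π ∸ 1)

NC : ℕ → List Partition
NC n = filterᵇ isNC (allPartitions n)

Int : ℕ → List Partition
Int n = filterᵇ isInterval (allPartitions n)

NCirr : ℕ → List Partition
NCirr n = filterᵇ (λ π → isNC π ∧ isIrr π) (allPartitions n)

maxL : List ℕ → ℕ
maxL = foldr _⊔ℕ_ 0

-- minimum of a nonempty list (the default is irrelevant for blocks)
minL : ℕ → List ℕ → ℕ
minL d = foldr _⊓ℕ_ d

Nblock : Partition → ℕ → ℕ
Nblock π k = length (filterᵇ (λ j → all (λ i → (m ≤ᵇ i) ∧ (i ≤ᵇ M)) (block π j)) (blockLabels π))
  where
  V = block π k
  m = minL (length π) V
  M = maxL V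

tauFact : Partition → ℕ
tauFact π = foldr (λ k acc → Nblock π k ℕ.* acc) 1 (blockLabels π)

restrict : ∀ {a} {X : Set a} → Partition → ℕ → List X → List X
restrict π k xs = map proj₂ (filterᵇ (λ p → lab π (proj₁ p) ≡ᵇ k) (zip (upTo (length xs)) xs))

module _ {c ℓ : Level} (R : CommutativeRing c ℓ) where
  open CommutativeRing R

  fromℕ : ℕ → Carrier
  fromℕ zero    = 0#
  fromℕ (suc n) = 1# + fromℕ n

  signPow : ℕ → Carrier
  signPow zero    = 1#
  signPow (suc k) = - signPow k

  Σ[_]_ : ∀ {a} {X : Set a} → List X → (X → Carrier) → Carrier
  Σ[ xs ] g = foldr (λ x acc → g x + acc) 0# xs

  Π[_]_ : ∀ {a} {X : Set a} → List X → (X → Carrier) → Carrier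
  Π[ xs ] g = foldr (λ x acc → g x * acc) 1# xs

  fπ : ∀ {a} {X : Set a} → (List X → Carrier) → Partition → List X → Carrier
  fπ f π xs = Π[ blockLabels π ] (λ k → f (restrict π k xs))

  ∂fπ : ∀ {a} {X : Set a} → (List X → Carrier) → (List X → Carrier) → Partition → List X → Carrier
  ∂fπ f f' π xs = Σ[ blockLabels π ] (λ k →
    f' (restrict π k xs) * Π[ filterᵇ (λ j → not (j ≡ᵇ k)) (blockLabels π) ] (λ j → f (restrict π j xs)))

  -- The Grassmann algebra 𝔾 = {z + ħ w}, ħ² = 0, over the scalars

  𝔾 : Set c
  𝔾 = Carrier × Carrier

  _≈𝔾_ : Rel 𝔾 ℓ
  (z , w) ≈𝔾 (z' , w') = (z ≈ z') × (w ≈ w')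

  _+𝔾_ : 𝔾 → 𝔾 → 𝔾
  (z , w) +𝔾 (z' , w') = (z + z' , w + w')

  _*𝔾_ : 𝔾 → 𝔾 → 𝔾
  (z , w) *𝔾 (z' , w') = (z * z' , (z * w') + (w * z'))

  0𝔾 1𝔾 : 𝔾
  0𝔾 = (0# , 0#)
  1𝔾 = (1# , 0#)

  ι : Carrier → 𝔾
  ι z = (z , 0#)

  Σ𝔾[_]_ : ∀ {a} {X : Set a} → List X → (X → 𝔾) → 𝔾
  Σ𝔾[ xs ] g = foldr (λ x acc → g x +𝔾 acc) 0𝔾 xs

  f̃π : ∀ {a} {X : Set a} → (List X → 𝔾) → Partition → List X → 𝔾
  f̃π f π xs = foldr (λ k acc → f (restrict π k xs) *𝔾 acc) 1𝔾 (blockLabels π)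

  tilde : ∀ {a} {X : Set a} → (List X → Carrier) → (List X → Carrier) → List X → 𝔾
  tilde f f' xs = (f xs , f' xs)

  record InfNCPS (m ℓm : Level) : Set (c ⊔ ℓ ⊔ lsuc (m ⊔ ℓm)) where
    field
      module𝒜 : Module R m ℓm
    open Module module𝒜
    field
      _·_ : Carrierᴹ → Carrierᴹ → Carrierᴹ
      1ᴬ  : Carrierᴹ
      ·-cong      : ∀ {x x' y y'} → x ≈ᴹ x' → y ≈ᴹ y' → (x · y) ≈ᴹ (x' · y')
      ·-assoc     : ∀ x y z → ((x · y) · z) ≈ᴹ (x · (y · z))
      ·-identityˡ : ∀ x → (1ᴬ · x) ≈ᴹ x
      ·-identityʳ : ∀ x → (x · 1ᴬ) ≈ᴹ x
      ·-distribˡ  : ∀ x y z → (x · (y +ᴹ z)) ≈ᴹ ((x · y) +ᴹ (x · z))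
      ·-distribʳ  : ∀ x y z → ((y +ᴹ z) · x) ≈ᴹ ((y · x) +ᴹ (z · x))
      ·-scalarˡ   : ∀ (s : Carrier) x y → ((s *ₗ x) · y) ≈ᴹ (s *ₗ (x · y))
      ·-scalarʳ   : ∀ (s : Carrier) x y → (x · (s *ₗ y)) ≈ᴹ (s *ₗ (x · y))
      φ φ′ : Carrierᴹ → Carrier
      φ-cong  : ∀ {x y} → x ≈ᴹ y → φ x ≈ φ y
      φ′-cong : ∀ {x y} → x ≈ᴹ y → φ′ x ≈ φ′ y
      φ-+  : ∀ x y → φ (x +ᴹ y) ≈ (φ x + φ y)
      φ′-+ : ∀ x y → φ′ (x +ᴹ y) ≈ (φ′ x + φ′ y)
      φ-*  : ∀ (s : Carrier) x → φ (s *ₗ x) ≈ (s * φ x)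
      φ′-* : ∀ (s : Carrier) x → φ′ (s *ₗ x) ≈ (s * φ′ x)
      φ-1  : φ 1ᴬ ≈ 1#
      φ′-1 : φ′ 1ᴬ ≈ 0#

    𝒜 : Set m
    𝒜 = Carrierᴹ

    prod : List 𝒜 → 𝒜
    prod = foldr _·_ 1ᴬ

    φₙ φ′ₙ : List 𝒜 → Carrier
    φₙ as = φ (prod as)
    φ′ₙ as = φ′ (prod as)

  open InfNCPS public using (𝒜; φₙ; φ′ₙ)

  -- recip n = 1/n in R (only used for n = τ(π)! ≥ 1)
  -- The (free / Boolean / monotone) cumulant families: for every n ≥ 1 and
  -- a₁,…,aₙ the moment–cumulant relations hold (these determine the
  -- cumulants recursively, the term of 1ₙ having coefficient 1).
  module _ {m ℓm : Level} (P : InfNCPS m ℓm) where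

    IsFreeCumulants : (r r′ : List (𝒜 P) → Carrier) → Set (m ⊔ ℓ)
    IsFreeCumulants r r′ = ∀ (as : List (𝒜 P)) → 1 ℕ.≤ length as →
      (φₙ P as ≈ Σ[ NC (length as) ] (λ π → fπ r π as)) ×
      (φ′ₙ P as ≈ Σ[ NC (length as) ] (λ π → ∂fπ r r′ π as))

    IsBooleanCumulants : (b b′ : List (𝒜 P) → Carrier) → Set (m ⊔ ℓ)
    IsBooleanCumulants b b′ = ∀ (as : List (𝒜 P)) → 1 ℕ.≤ length as →
      (φₙ P as ≈ Σ[ Int (length as) ] (λ π → fπ b π as)) ×
      (φ′ₙ P as ≈ Σ[ Int (length as) ] (λ π → ∂fπ b b′ π as))

    IsMonotoneCumulants : (recip : ℕ → Carrier) → (h h′ : List (𝒜 P) → Carrier) → Set (m ⊔ ℓ)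
    IsMonotoneCumulants recip h h′ = ∀ (as : List (𝒜 P)) → 1 ℕ.≤ length as →
      (φₙ P as ≈ Σ[ NC (length as) ] (λ π → recip (tauFact π) * fπ h π as)) ×
      (φ′ₙ P as ≈ Σ[ NC (length as) ] (λ π → recip (tauFact π) * ∂fπ h h′ π as))

{-# OPTIONS --safe #-}
module Submission where

-- Work with non-commutative power series, f ↦ Σ f(a₁…aₙ) a₁⋯aₙ, over 𝔾. If σ G substitutes a G for
-- every letter a, then M = 1 + B M characterises the Boolean cumulants B of the moments M and
-- M = σ M (1 + r) the free ones. As b is the sum over irreducible partitions of the free (or monotone)
-- cumulant products, the first and third formulas are the factorisation M = 1 + B M of the sum over
-- all non-crossing partitions. For the other two let N be the inverse of M for the composition
-- (G, F) ↦ G · σ G F. Then N (1 + r) = 1, that is, N has Boolean cumulants − r; and N is the series with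
-- free cumulants − b, and also the series with monotone cumulants − h. The last claim
-- is exp(− h) exp(h) = 1: with a formal time t, M solves the differential equation D M = M ∘ h.

open import Defs
open import Level using (Level)
open import Algebra.Bundles using (CommutativeRing)
open import Data.Bool using (Bool; true; false; T; T?; not; _∧_; if_then_else_)
open import Data.Bool.ListAction using (all)
open import Data.List using (List; []; _∷_; _++_; length; map; filterᵇ; upTo; concatMap; foldr; reverse; _∷ʳ_; _ʳ++_)
open import Data.List.Membership.Propositional using (_∈_)
open import Data.List.Membership.Propositional.Properties using (∈-upTo⁺; ∈-upTo⁻; ∈-++⁺ʳ; ∈-filter⁺; ∈-length)
open import Data.List.Properties using (length-map; length-++; ++-assoc; ++-identityʳ; upTo-∷ʳ; length-upTo)
open import Data.List.Relation.Binary.Permutation.Propositional as Perm using (_↭_; ↭-sym; ↭-trans; ↭-reflexive; ↭⇒↭ₛ)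
import Data.List.Relation.Binary.Permutation.Propositional.Properties as Permₚ
open import Data.List.Relation.Binary.Sublist.Propositional using (_∷_; from∈) renaming (_∷ʳ_ to skip; lookup to ⊆-lookup)
open import Data.List.Relation.Unary.All as All using (All; []; _∷_)
import Data.List.Relation.Unary.All.Properties as Allₚ
open import Data.List.Relation.Unary.AllPairs using ([]; _∷_)
open import Data.List.Relation.Unary.Any using (here; there)
open import Data.List.Relation.Unary.Any.Properties using (reverse⁻; reverse⁺)
open import Data.List.Relation.Unary.Unique.Propositional using (Unique)
open import Data.List.Relation.Unary.Unique.Propositional.Properties using (upTo⁺)
open import Data.Empty using (⊥-elim)
open import Data.Nat as ℕ using (ℕ; zero; suc; z≤n; s≤s; _∸_; _≡ᵇ_; _≤_; _<_)
import Data.Nat.Properties as ℕₚ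
open import Data.Product using (_×_; _,_; proj₁; proj₂)
open import Data.Sum using (inj₁; inj₂)
open import Data.Unit using (⊤; tt)
open import Function using (_∘_)
open import Relation.Binary.PropositionalEquality as ≡ using (_≡_; _≢_)
open import Relation.Nullary using (¬_; yes; no; contradiction)
open import Data.List.Relation.Binary.Permutation.Setoid.Properties (≡.setoid ℕ) using (Unique-resp-↭)

-- The ħ-component of a product over 𝔾 is the Leibniz sum `∂fπ`, so the relations for φ and φ′ are
-- one relation over the ring 𝔾, and the cumulant calculus can be done over any commutative ring
-- with inverses of the positive integers. Partitions meet series in a scan of growth strings:
-- blocks are numbered by their minima, so in a non-crossing partition the hull of a block consists
-- of consecutive labels, and N(V) is a difference of two numbers known during the scan. The
-- equation D M = M ∘ h comes from the weights t^|π| / τ(π)!. For irreducible π the hull of the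
-- outer block contains all |π| blocks, so this block contributes 1/|π|, and d/dt turns t^|π| / |π|
-- into t^(|π| - 1), the power left for the other blocks. The obstacle is that composition is not
-- linear in its left argument. The equation puts h to the right of M, while the cancellation in D
-- (N ∘ M) needs it on the left, next to N. Hence the infinitesimal step has to be commuted past M,
-- as M ∘ (1 + ħ h) = (1 + ħ h) ∘ M. The time t is formal so that D and integration exist; all
-- coefficients are polynomials in t, which makes t = 1 meaningful.

module Series {c ℓ} (S : CommutativeRing c ℓ) {x} (X : Set x) where
  open CommutativeRing S
  open import Algebra.Properties.Ring ring using (-‿distribˡ-*; -‿+-comm; +-cancelˡ)
  open import Algebra.Solver.Ring.NaturalCoefficients.Default commutativeSemiring
    using (solve; _:+_; _:*_; _:=_)
  open import Relation.Binary.Reasoning.Setoid setoid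

  -- Non-commutative power series: product, substitution and composition.

  Ser : Set _
  Ser = List X → Carrier

  infix 4 _≋_
  infixl 7 _⋆_

  _≋_ : Ser → Ser → Set _
  f ≋ g = ∀ w → f w ≈ g w

  ∂ : X → Ser → Ser
  ∂ a f w = f (a ∷ w)

  ε : Ser
  ε []      = 1#
  ε (_ ∷ _) = 0#

  reduced unital : Ser → Ser
  reduced f []      = 0#
  reduced f (a ∷ w) = f (a ∷ w)
  unital f []       = 1#
  unital f (a ∷ w)  = f (a ∷ w)

  _⋆_ : Ser → Ser → Ser
  (f ⋆ g) []      = f [] * g []
  (f ⋆ g) (a ∷ w) = f [] * g (a ∷ w) + (∂ a f ⋆ g) w

  ⋆-cong : ∀ {f f′ g g′} → f ≋ f′ → g ≋ g′ → f ⋆ g ≋ f′ ⋆ g′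
  ⋆-cong p q []      = *-cong (p []) (q [])
  ⋆-cong p q (a ∷ w) = +-cong (*-cong (p []) (q (a ∷ w))) (⋆-cong (λ v → p (a ∷ v)) q w)

  ⋆-zeroˡ : ∀ {f} g → (∀ w → f w ≈ 0#) → ∀ w → (f ⋆ g) w ≈ 0#
  ⋆-zeroˡ g p []      = trans (*-congʳ (p [])) (zeroˡ _)
  ⋆-zeroˡ g p (a ∷ w) = trans (+-cong (trans (*-congʳ (p [])) (zeroˡ _)) (⋆-zeroˡ g (λ v → p (a ∷ v)) w)) (+-identityˡ 0#)

  ⋆-identityˡ : ∀ f → ε ⋆ f ≋ f
  ⋆-identityˡ f []      = *-identityˡ _
  ⋆-identityˡ f (a ∷ w) = trans (+-cong (*-identityˡ _) (⋆-zeroˡ f (λ _ → refl) w)) (+-identityʳ _)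

  ⋆-identityʳ : ∀ f → f ⋆ ε ≋ f
  ⋆-identityʳ f []      = *-identityʳ _
  ⋆-identityʳ f (a ∷ w) = trans (+-cong (zeroʳ _) (⋆-identityʳ (∂ a f) w)) (+-identityˡ _)

  -- Removing the first letter of a product gives `f [] * ∂ a g + ∂ a f ⋆ g`, so inductions on words
  -- meet linearity in exactly this combined form.
  ⋆-linearˡ : ∀ k f f′ g w → ((λ v → k * f v + f′ v) ⋆ g) w ≈ k * (f ⋆ g) w + (f′ ⋆ g) w
  ⋆-linearˡ k f f′ g []      = solve 4 (λ k f f′ g → (k :* f :+ f′) :* g := k :* (f :* g) :+ f′ :* g) refl k (f []) (f′ []) (g [])
  ⋆-linearˡ k f f′ g (a ∷ w) = begin
    (k * f [] + f′ []) * g (a ∷ w) + ((λ v → k * f (a ∷ v) + f′ (a ∷ v)) ⋆ g) w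
      ≈⟨ +-congˡ (⋆-linearˡ k (∂ a f) (∂ a f′) g w) ⟩
    (k * f [] + f′ []) * g (a ∷ w) + (k * (∂ a f ⋆ g) w + (∂ a f′ ⋆ g) w)
      ≈⟨ solve 6 (λ k f f′ g x y → (k :* f :+ f′) :* g :+ (k :* x :+ y) := k :* (f :* g :+ x) :+ (f′ :* g :+ y)) refl k (f []) (f′ []) (g (a ∷ w)) _ _ ⟩
    k * (f [] * g (a ∷ w) + (∂ a f ⋆ g) w) + (f′ [] * g (a ∷ w) + (∂ a f′ ⋆ g) w) ∎

  ⋆-assoc : ∀ f g h → (f ⋆ g) ⋆ h ≋ f ⋆ (g ⋆ h)
  ⋆-assoc f g h []      = *-assoc _ _ _
  ⋆-assoc f g h (a ∷ w) = begin
    f [] * g [] * h (a ∷ w) + ((λ v → f [] * ∂ a g v + (∂ a f ⋆ g) v) ⋆ h) w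
      ≈⟨ +-congˡ (⋆-linearˡ (f []) (∂ a g) (∂ a f ⋆ g) h w) ⟩
    f [] * g [] * h (a ∷ w) + (f [] * (∂ a g ⋆ h) w + ((∂ a f ⋆ g) ⋆ h) w)
      ≈⟨ +-congˡ (+-congˡ (⋆-assoc (∂ a f) g h w)) ⟩
    f [] * g [] * h (a ∷ w) + (f [] * (∂ a g ⋆ h) w + (∂ a f ⋆ (g ⋆ h)) w)
      ≈⟨ solve 5 (λ f g h x y → f :* g :* h :+ (f :* x :+ y) := f :* (g :* h :+ x) :+ y) refl (f []) (g []) (h (a ∷ w)) _ _ ⟩
    f [] * (g [] * h (a ∷ w) + (∂ a g ⋆ h) w) + (∂ a f ⋆ (g ⋆ h)) w ∎

  -- The constant term of `g` is 1, so `f []` can be read off and its contribution subtracted; what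
  -- remains is the same identity for `∂ a f`.
  ⋆-cancelʳ : ∀ {f f′} g → g [] ≈ 1# → f ⋆ g ≋ f′ ⋆ g → f ≋ f′
  ⋆-cancelʳ {f} {f′} g g₁ p [] = begin
    f []          ≈⟨ *-identityʳ _ ⟨
    f [] * 1#     ≈⟨ *-congˡ g₁ ⟨
    f [] * g []   ≈⟨ p [] ⟩
    f′ [] * g []  ≈⟨ *-congˡ g₁ ⟩
    f′ [] * 1#    ≈⟨ *-identityʳ _ ⟩
    f′ []         ∎
  ⋆-cancelʳ {f} {f′} g g₁ p (a ∷ w) =
    ⋆-cancelʳ g g₁
      (λ v → +-cancelˡ (f [] * g (a ∷ v)) _ _
        (trans (p (a ∷ v)) (+-congʳ (*-congʳ (sym (⋆-cancelʳ {f} {f′} g g₁ p []))))))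
      w

  -- mix H G f is H ⋆ σ G f, where σ G f arises from f by the substitution
  -- of a G(a…) for every letter a; it is primitive so that σ is structurally recursive.
  mix : Ser → Ser → Ser → Ser
  mix H G f []      = H [] * f []
  mix H G f (a ∷ w) = H [] * mix G G (∂ a f) w + mix (∂ a H) G f w

  σ : Ser → Ser → Ser
  σ G f []      = f []
  σ G f (a ∷ w) = mix G G (∂ a f) w

  compose : Ser → Ser → Ser
  compose G = mix G G

  mix≋⋆σ : ∀ H G f → mix H G f ≋ H ⋆ σ G f
  mix≋⋆σ H G f []      = refl
  mix≋⋆σ H G f (a ∷ w) = +-congˡ (mix≋⋆σ (∂ a H) G f w)

  mix-cong : ∀ {H H′ G G′ f f′} → H ≋ H′ → G ≋ G′ → f ≋ f′ → mix H G f ≋ mix H′ G′ f′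
  mix-cong p q r []      = *-cong (p []) (r [])
  mix-cong p q r (a ∷ w) =
    +-cong (*-cong (p []) (mix-cong q q (λ v → r (a ∷ v)) w)) (mix-cong (λ v → p (a ∷ v)) q r w)

  σ-cong : ∀ {G G′ f f′} → G ≋ G′ → f ≋ f′ → σ G f ≋ σ G′ f′
  σ-cong q r []      = r []
  σ-cong q r (a ∷ w) = mix-cong q q (λ v → r (a ∷ v)) w

  mix-linearˡ : ∀ k H H′ G f w → mix (λ v → k * H v + H′ v) G f w ≈ k * mix H G f w + mix H′ G f w
  mix-linearˡ k H H′ G f w = begin
    mix (λ v → k * H v + H′ v) G f w         ≈⟨ mix≋⋆σ _ G f w ⟩
    ((λ v → k * H v + H′ v) ⋆ σ G f) w       ≈⟨ ⋆-linearˡ k H H′ (σ G f) w ⟩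
    k * (H ⋆ σ G f) w + (H′ ⋆ σ G f) w       ≈⟨ +-cong (*-congˡ (mix≋⋆σ H G f w)) (mix≋⋆σ H′ G f w) ⟨
    k * mix H G f w + mix H′ G f w           ∎

  mix-linearʳ : ∀ k H G f f′ w → mix H G (λ v → k * f v + f′ v) w ≈ k * mix H G f w + mix H G f′ w
  mix-linearʳ k H G f f′ []      = solve 4 (λ k h f f′ → h :* (k :* f :+ f′) := k :* (h :* f) :+ h :* f′) refl k (H []) (f []) (f′ [])
  mix-linearʳ k H G f f′ (a ∷ w) = begin
    H [] * mix G G (λ v → k * ∂ a f v + ∂ a f′ v) w + mix (∂ a H) G (λ v → k * f v + f′ v) w
      ≈⟨ +-cong (*-congˡ (mix-linearʳ k G G (∂ a f) (∂ a f′) w)) (mix-linearʳ k (∂ a H) G f f′ w) ⟩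
    H [] * (k * mix G G (∂ a f) w + mix G G (∂ a f′) w) + (k * mix (∂ a H) G f w + mix (∂ a H) G f′ w)
      ≈⟨ solve 6 (λ k h x y z u → h :* (k :* x :+ y) :+ (k :* z :+ u) := k :* (h :* x :+ z) :+ (h :* y :+ u)) refl k (H []) _ _ _ _ ⟩
    k * (H [] * mix G G (∂ a f) w + mix (∂ a H) G f w) + (H [] * mix G G (∂ a f′) w + mix (∂ a H) G f′ w) ∎

  -- For `H = ε` this is multiplicativity of `σ G`. The general first factor is forced by the
  -- induction, which passes from `H` to `∂ a H`.
  mix-⋆ : ∀ H G f g → mix H G (f ⋆ g) ≋ mix H G f ⋆ σ G g
  mix-⋆ H G f g []      = sym (*-assoc _ _ _)
  mix-⋆ H G f g (a ∷ w) = begin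
    H [] * mix G G (λ v → f [] * ∂ a g v + (∂ a f ⋆ g) v) w + mix (∂ a H) G (f ⋆ g) w
      ≈⟨ +-cong (*-congˡ (mix-linearʳ (f []) G G (∂ a g) (∂ a f ⋆ g) w)) (mix-⋆ (∂ a H) G f g w) ⟩
    H [] * (f [] * mix G G (∂ a g) w + mix G G (∂ a f ⋆ g) w) + (mix (∂ a H) G f ⋆ σ G g) w
      ≈⟨ +-congʳ (*-congˡ (+-congˡ (mix-⋆ G G (∂ a f) g w))) ⟩
    H [] * (f [] * mix G G (∂ a g) w + (mix G G (∂ a f) ⋆ σ G g) w) + (mix (∂ a H) G f ⋆ σ G g) w
      ≈⟨ solve 5 (λ h f x y z → h :* (f :* x :+ y) :+ z := h :* f :* x :+ (h :* y :+ z)) refl (H []) (f []) _ _ _ ⟩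
    H [] * f [] * mix G G (∂ a g) w + (H [] * (mix G G (∂ a f) ⋆ σ G g) w + (mix (∂ a H) G f ⋆ σ G g) w)
      ≈⟨ +-congˡ (⋆-linearˡ (H []) (mix G G (∂ a f)) (mix (∂ a H) G f) (σ G g) w) ⟨
    H [] * f [] * mix G G (∂ a g) w + ((λ v → H [] * mix G G (∂ a f) v + mix (∂ a H) G f v) ⋆ σ G g) w ∎

  -- A gap of `f` filled with `F` turns into `compose G F` under the outer substitution, while the
  -- first gap, `K` behind `H`, turns into `mix H G K`. The case `H = G`, `K = F` is associativity
  -- of composition.
  mix-mix : ∀ H G K F f → mix H G (mix K F f) ≋ mix (mix H G K) (compose G F) f
  mix-mix H G K F f []      = sym (*-assoc _ _ _)
  mix-mix H G K F f (a ∷ w) = begin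
    H [] * mix G G (λ v → K [] * mix F F (∂ a f) v + mix (∂ a K) F f v) w + mix (∂ a H) G (mix K F f) w
      ≈⟨ +-congʳ (*-congˡ (mix-linearʳ (K []) G G (mix F F (∂ a f)) (mix (∂ a K) F f) w)) ⟩
    H [] * (K [] * mix G G (mix F F (∂ a f)) w + mix G G (mix (∂ a K) F f) w) + mix (∂ a H) G (mix K F f) w
      ≈⟨ +-cong (*-congˡ (+-cong (*-congˡ (mix-mix G G F F (∂ a f) w)) (mix-mix G G (∂ a K) F f w))) (mix-mix (∂ a H) G K F f w) ⟩
    H [] * (K [] * compose (compose G F) (∂ a f) w + mix (mix G G (∂ a K)) (compose G F) f w) + mix (mix (∂ a H) G K) (compose G F) f w
      ≈⟨ solve 5 (λ h k x y z → h :* (k :* x :+ y) :+ z := h :* k :* x :+ (h :* y :+ z)) refl (H []) (K []) _ _ _ ⟩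
    H [] * K [] * compose (compose G F) (∂ a f) w + (H [] * mix (mix G G (∂ a K)) (compose G F) f w + mix (mix (∂ a H) G K) (compose G F) f w)
      ≈⟨ +-congˡ (mix-linearˡ (H []) (mix G G (∂ a K)) (mix (∂ a H) G K) (compose G F) f w) ⟨
    H [] * K [] * compose (compose G F) (∂ a f) w + mix (∂ a (mix H G K)) (compose G F) f w ∎

  compose-compose : ∀ G F f → compose G (compose F f) ≋ compose (compose G F) f
  compose-compose G F f = mix-mix G G F F f

  σ-σ : ∀ G F f → σ G (σ F f) ≋ σ (compose G F) f
  σ-σ G F f []      = refl
  σ-σ G F f (a ∷ w) = compose-compose G F (∂ a f) w

  mix-zeroˡ : ∀ {H} G f → (∀ w → H w ≈ 0#) → ∀ w → mix H G f w ≈ 0#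
  mix-zeroˡ G f p w = trans (mix≋⋆σ _ G f w) (⋆-zeroˡ (σ G f) p w)

  compose-ε : ∀ f → compose ε f ≋ f
  compose-ε f []      = *-identityˡ _
  compose-ε f (a ∷ w) = begin
    1# * compose ε (∂ a f) w + mix (∂ a ε) ε f w  ≈⟨ +-cong (*-identityˡ _) (mix-zeroˡ ε f (λ _ → refl) w) ⟩
    compose ε (∂ a f) w + 0#                      ≈⟨ +-identityʳ _ ⟩
    compose ε (∂ a f) w                           ≈⟨ compose-ε (∂ a f) w ⟩
    f (a ∷ w)                               ∎

  σ-ε : ∀ f → σ ε f ≋ f
  σ-ε f []      = refl
  σ-ε f (a ∷ w) = compose-ε (∂ a f) w

  mix-zeroʳ : ∀ H G {f} → (∀ w → f w ≈ 0#) → ∀ w → mix H G f w ≈ 0#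
  mix-zeroʳ H G p []      = trans (*-congˡ (p [])) (zeroʳ _)
  mix-zeroʳ H G p (a ∷ w) =
    trans (+-cong (trans (*-congˡ (mix-zeroʳ G G (λ v → p (a ∷ v)) w)) (zeroʳ _)) (mix-zeroʳ (∂ a H) G p w)) (+-identityˡ 0#)

  σ-unit : ∀ G → σ G ε ≋ ε
  σ-unit G []      = refl
  σ-unit G (a ∷ w) = mix-zeroʳ G G (λ _ → refl) w

  compose-unit : ∀ G → compose G ε ≋ G
  compose-unit G w = begin
    compose G ε w        ≈⟨ mix≋⋆σ G G ε w ⟩
    (G ⋆ σ G ε) w  ≈⟨ ⋆-cong (λ _ → refl) (σ-unit G) w ⟩
    (G ⋆ ε) w      ≈⟨ ⋆-identityʳ G w ⟩
    G w            ∎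

  -- Locality of substitution, for the induction on length that determines a flow.
  mix-cong-≤ : ∀ n {H H′ G G′ f f′} → (∀ v → length v ℕ.≤ n → H v ≈ H′ v) → (∀ v → length v ℕ.≤ n → G v ≈ G′ v) →
    f ≋ f′ → ∀ w → length w ℕ.≤ n → mix H G f w ≈ mix H′ G′ f′ w
  mix-cong-≤ n       p q r []      l       = *-cong (p [] z≤n) (r [])
  mix-cong-≤ (suc n) p q r (a ∷ w) (s≤s l) =
    +-cong (*-cong (p [] z≤n) (mix-cong-≤ n q′ q′ (λ v → r (a ∷ v)) w l))
           (mix-cong-≤ n (λ v l → p (a ∷ v) (s≤s l)) q′ r w l)
    where q′ = λ v l → q v (ℕₚ.m≤n⇒m≤1+n l)

  -- A letter consumed by f shortens what is left for G.
  mix-cong-< : ∀ n {H H′ G G′ f f′} → (∀ v → length v ℕ.< n → H v ≈ H′ v) → (∀ v → length v ℕ.< n → G v ≈ G′ v) →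
    f ≋ f′ → f [] ≈ 0# → ∀ w → length w ℕ.≤ n → mix H G f w ≈ mix H′ G′ f′ w
  mix-cong-< n p q r z []      l       =
    trans (trans (*-congˡ z) (zeroʳ _)) (sym (trans (*-congˡ (trans (sym (r [])) z)) (zeroʳ _)))
  mix-cong-< (suc n) p q r z (a ∷ w) (s≤s l) =
    +-cong (*-cong (p [] (s≤s z≤n)) (mix-cong-≤ n q′ q′ (λ v → r (a ∷ v)) w l))
           (mix-cong-< n (λ v l → p (a ∷ v) (s≤s l)) (λ v l → q v (ℕₚ.m≤n⇒m≤1+n l)) r z w l)
    where q′ = λ v l → q v (s≤s l)

  -- The equations of Boolean and free cumulants.

  infixl 6 _⊕_
  _⊕_ : Ser → Ser → Ser
  (f ⊕ g) w = f w + g w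

  ⊖_ : Ser → Ser
  (⊖ f) w = - f w

  ⋆-negˡ : ∀ f g → (⊖ f) ⋆ g ≋ ⊖ (f ⋆ g)
  ⋆-negˡ f g []      = sym (-‿distribˡ-* _ _)
  ⋆-negˡ f g (a ∷ w) = trans (+-cong (sym (-‿distribˡ-* _ _)) (⋆-negˡ (∂ a f) g w)) (-‿+-comm _ _)

  ⋆-addˡ : ∀ f f′ g → (f ⊕ f′) ⋆ g ≋ f ⋆ g ⊕ f′ ⋆ g
  ⋆-addˡ f f′ g w = begin
    ((f ⊕ f′) ⋆ g) w                ≈⟨ ⋆-cong (λ v → +-congʳ (sym (*-identityˡ _))) (λ _ → refl) w ⟩
    ((λ v → 1# * f v + f′ v) ⋆ g) w ≈⟨ ⋆-linearˡ 1# f f′ g w ⟩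
    1# * (f ⋆ g) w + (f′ ⋆ g) w     ≈⟨ +-congʳ (*-identityˡ _) ⟩
    (f ⋆ g) w + (f′ ⋆ g) w          ∎

  boolean-inverse : ∀ {B M} → M ≋ ε ⊕ B ⋆ M → (ε ⊕ ⊖ B) ⋆ M ≋ ε
  boolean-inverse {B} {M} p w = begin
    ((ε ⊕ ⊖ B) ⋆ M) w                        ≈⟨ ⋆-addˡ ε (⊖ B) M w ⟩
    (ε ⋆ M) w + ((⊖ B) ⋆ M) w                ≈⟨ +-cong (trans (⋆-identityˡ M w) (p w)) (⋆-negˡ B M w) ⟩
    ε w + (B ⋆ M) w + - (B ⋆ M) w            ≈⟨ +-assoc _ _ _ ⟩
    ε w + ((B ⋆ M) w + - (B ⋆ M) w)          ≈⟨ +-congˡ (-‿inverseʳ _) ⟩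
    ε w + 0#                                 ≈⟨ +-identityʳ _ ⟩
    ε w                                      ∎

  boolean-unique : ∀ {B B′ M} → M [] ≈ 1# → M ≋ ε ⊕ B ⋆ M → M ≋ ε ⊕ B′ ⋆ M → B ≋ B′
  boolean-unique {B} {B′} {M} M₁ p q =
    ⋆-cancelʳ M M₁ (λ w → +-cancelˡ (ε w) _ _ (trans (sym (p w)) (q w)))

  -- If N is inverse to M for compose, then the Boolean cumulants of N
  -- are the negatives of the free cumulants of M.
  free-of-inverse : ∀ {M N r B} → compose N M ≋ ε → M ≋ σ M (unital r) → N ≋ ε ⊕ B ⋆ N → ε ⊕ ⊖ B ≋ unital r
  free-of-inverse {M} {N} {r} {B} inv free bool w = begin
    (ε ⊕ ⊖ B) w                           ≈⟨ ⋆-identityʳ _ w ⟨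
    ((ε ⊕ ⊖ B) ⋆ ε) w                     ≈⟨ ⋆-cong (λ _ → refl) N⋆r w ⟨
    ((ε ⊕ ⊖ B) ⋆ (N ⋆ unital r)) w        ≈⟨ ⋆-assoc _ N _ w ⟨
    (((ε ⊕ ⊖ B) ⋆ N) ⋆ unital r) w        ≈⟨ ⋆-cong (boolean-inverse bool) (λ _ → refl) w ⟩
    (ε ⋆ unital r) w                      ≈⟨ ⋆-identityˡ _ w ⟩
    unital r w                            ∎
    where
    -- Applying `σ N` to the free equation composes two substitutions; as `N` inverts `M`, the
    -- composite substitution is the identity.
    σM : σ N M ≋ unital r
    σM w = begin
      σ N M w                   ≈⟨ σ-cong (λ _ → refl) free w ⟩
      σ N (σ M (unital r)) w    ≈⟨ σ-σ N M _ w ⟩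
      σ (compose N M) (unital r) w    ≈⟨ σ-cong inv (λ _ → refl) w ⟩
      σ ε (unital r) w          ≈⟨ σ-ε _ w ⟩
      unital r w                ∎
    N⋆r : N ⋆ unital r ≋ ε
    N⋆r w = begin
      (N ⋆ unital r) w  ≈⟨ ⋆-cong (λ _ → refl) σM w ⟨
      (N ⋆ σ N M) w     ≈⟨ mix≋⋆σ N N M w ⟨
      compose N M w           ≈⟨ inv w ⟩
      ε w               ∎

  -- By the free equation of `N` and multiplicativity of `σ N`, the product of `N` and `σ N M` is
  -- `σ N` applied to (1 - b) M, which is 1 by the Boolean equation. The detour through `mix ε N` is
  -- there because multiplicativity is stated for `mix`.
  free-of-neg-boolean : ∀ {M N b} → M ≋ ε ⊕ b ⋆ M → N ≋ σ N (ε ⊕ ⊖ b) → compose N M ≋ ε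
  free-of-neg-boolean {M} {N} {b} bool free w = begin
    compose N M w                          ≈⟨ mix≋⋆σ N N M w ⟩
    (N ⋆ σ N M) w                    ≈⟨ ⋆-cong free (λ _ → refl) w ⟩
    (σ N (ε ⊕ ⊖ b) ⋆ σ N M) w        ≈⟨ ⋆-cong (λ v → sym (mix-ε (ε ⊕ ⊖ b) v)) (λ _ → refl) w ⟩
    (mix ε N (ε ⊕ ⊖ b) ⋆ σ N M) w    ≈⟨ mix-⋆ ε N (ε ⊕ ⊖ b) M w ⟨
    mix ε N ((ε ⊕ ⊖ b) ⋆ M) w        ≈⟨ mix-cong (λ _ → refl) (λ _ → refl) (boolean-inverse bool) w ⟩
    mix ε N ε w                      ≈⟨ mix-ε ε w ⟩
    σ N ε w                          ≈⟨ σ-unit N w ⟩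
    ε w                              ∎
    where
    mix-ε : ∀ f → mix ε N f ≋ σ N f
    mix-ε f v = trans (mix≋⋆σ ε N f v) (⋆-identityˡ _ v)

-- Sums over non-crossing partitions as a left-to-right scan.

module Automaton {c ℓ} (S : CommutativeRing c ℓ) {x} {X : Set x}
  (g : ℕ → List X → CommutativeRing.Carrier S) where
  open CommutativeRing S
  open Series S X
  open import Algebra.Solver.Ring.NaturalCoefficients.Default commutativeSemiring
    using (solve; _:+_; _:*_; _:=_; con)
  open import Relation.Binary.Reasoning.Setoid setoid

  -- The sum over all factorisations w = v a z at a letter; it expresses the cut of a scan at the
  -- letter that returns to a given block.
  split : (List X → X → List X → Carrier) → Ser
  split K []      = 0#
  split K (a ∷ w) = K [] a w + split (λ v → K (a ∷ v)) w

  split-cong : ∀ {K L} w → (∀ v a z → length z ℕ.< length w → K v a z ≈ L v a z) → split K w ≈ split L w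
  split-cong []      p = refl
  split-cong (a ∷ w) p = +-cong (p [] a w ℕₚ.≤-refl) (split-cong w (λ v b z l → p (a ∷ v) b z (ℕₚ.m≤n⇒m≤1+n l)))

  split-linear : ∀ k K L w → split (λ v a z → k * K v a z + L v a z) w ≈ k * split K w + split L w
  split-linear k K L []      = solve 1 (λ k → con 0 := k :* con 0 :+ con 0) refl k
  split-linear k K L (a ∷ w) = trans (+-congˡ (split-linear k _ _ w))
    (solve 5 (λ k x y z u → k :* x :+ y :+ (k :* z :+ u) := k :* (x :+ z) :+ (y :+ u)) refl k _ _ _ _)

  split-zero : ∀ w → split (λ _ _ _ → 0#) w ≈ 0#
  split-zero []      = refl
  split-zero (a ∷ w) = trans (+-identityˡ _) (split-zero w)

  mix-split : ∀ H G f w → mix H G f w ≈ H w * f [] + split (λ v a z → H v * compose G (∂ a f) z) w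
  mix-split H G f []      = sym (+-identityʳ _)
  mix-split H G f (a ∷ w) = trans (+-congˡ (mix-split (∂ a H) G f w))
    (solve 3 (λ x y z → x :+ (y :+ z) := y :+ (x :+ z)) refl _ _ _)

  ⋆-head : ∀ f g w → (f ⋆ g) w ≈ f [] * g w + (reduced f ⋆ g) w
  ⋆-head f g []      = sym (trans (+-congˡ (zeroˡ _)) (+-identityʳ _))
  ⋆-head f g (a ∷ w) = +-congˡ (sym (trans (+-congʳ (zeroˡ _)) (+-identityˡ _)))

  -- A scan of a non-crossing partition from left to right keeps a stack of the blocks that
  -- can still be extended: label, number of blocks in the hull so far, letters so far.
  -- ω weights the final state by the number of blocks and the height of the stack.
  Entry : Set x
  Entry = ℕ × ℕ × List X

  weight : Entry → Carrier
  weight (_ , N , u) = g N u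

  weights : List Entry → Carrier
  weights = foldr (λ e acc → weight e * acc) 1#

  -- The blocks opened since block `c`, labelled c + 1 to k - 1, can no longer be extended once `c`
  -- is, so they lie between the first letter of `c` and the new one. With `c` itself the hull has
  -- `k ∸ c` blocks.
  extend : ℕ → X → Entry → Entry
  extend k a (c , N , u) = c , k ∸ c , u ∷ʳ a

  mutual
    scan : (ℕ → ℕ → Carrier) → ℕ → List Entry → Ser
    scan ω k st []      = ω k (length st) * weights st
    scan ω k st (a ∷ w) = scan ω (suc k) ((k , 1 , a ∷ []) ∷ st) w + scanOld ω k st a w

    -- Extending a block closes all younger blocks on the stack, whose weights are then final and
    -- come out as factors.
    scanOld : (ℕ → ℕ → Carrier) → ℕ → List Entry → X → Ser
    scanOld ω k []       a w = 0#
    scanOld ω k (e ∷ st) a w = scan ω k (extend k a e ∷ st) w + weight e * scanOld ω k st a w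

  mutual
    scan-cong : ∀ {ω ω′} → (∀ k l → ω k l ≈ ω′ k l) → ∀ k st w → scan ω k st w ≈ scan ω′ k st w
    scan-cong p k st []      = *-congʳ (p _ _)
    scan-cong p k st (a ∷ w) = +-cong (scan-cong p _ _ w) (scanOld-cong p k st a w)

    scanOld-cong : ∀ {ω ω′} → (∀ k l → ω k l ≈ ω′ k l) → ∀ k st a w → scanOld ω k st a w ≈ scanOld ω′ k st a w
    scanOld-cong p k []       a w = refl
    scanOld-cong p k (e ∷ st) a w = +-cong (scan-cong p _ _ w) (*-congˡ (scanOld-cong p k st a w))

  mutual
    scan-scale : ∀ y ω k st w → scan (λ k l → y * ω k l) k st w ≈ y * scan ω k st w
    scan-scale y ω k st []      = *-assoc _ _ _
    scan-scale y ω k st (a ∷ w) = trans (+-cong (scan-scale y ω _ _ w) (scanOld-scale y ω k st a w)) (sym (distribˡ _ _ _))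

    scanOld-scale : ∀ y ω k st a w → scanOld (λ k l → y * ω k l) k st a w ≈ y * scanOld ω k st a w
    scanOld-scale y ω k []       a w = sym (zeroʳ _)
    scanOld-scale y ω k (e ∷ st) a w = trans (+-cong (scan-scale y ω _ _ w) (*-congˡ (scanOld-scale y ω k st a w)))
      (solve 4 (λ y e p q → y :* p :+ e :* (y :* q) := y :* (p :+ e :* q)) refl y (weight e) _ _)

  relabel : Entry → Entry
  relabel (c , Nu) = suc c , Nu

  weights-relabel : ∀ st → weights (map relabel st) ≈ weights st
  weights-relabel []       = refl
  weights-relabel (e ∷ st) = *-congˡ (weights-relabel st)

  mutual
    -- Labels enter the weights only through the differences `k ∸ c`, which a common shift
    -- preserves.
    scan-shift : ∀ ω k st w → scan ω (suc k) (map relabel st) w ≈ scan (λ k → ω (suc k)) k st w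
    scan-shift ω k st []      =
      *-cong (reflexive (≡.cong (ω (suc k)) (length-map relabel st))) (weights-relabel st)
    scan-shift ω k st (a ∷ w) = +-cong (scan-shift ω (suc k) (_ ∷ st) w) (scanOld-shift ω k st a w)

    scanOld-shift : ∀ ω k st a w → scanOld ω (suc k) (map relabel st) a w ≈ scanOld (λ k → ω (suc k)) k st a w
    scanOld-shift ω k []       a w = refl
    scanOld-shift ω k (e ∷ st) a w =
      +-cong (scan-shift ω k (extend k a e ∷ st) w) (*-congˡ (scanOld-shift ω k st a w))

  -- In a scan from the start, block 0 is at the bottom of the stack and the block of the last
  -- letter on top, so height 1 means that the first and last letters share a block. Height 0, the
  -- empty word, gets weight 0, which makes `B []` vanish.
  unweighted irreducible : ℕ → ℕ → Carrier
  unweighted _ _ = 1#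
  irreducible _ 1 = 1#
  irreducible _ _ = 0#

  M B : Ser
  M = scan unweighted 0 []
  B = scan irreducible 0 []

  scan-M : ∀ k w → scan unweighted k [] w ≈ M w
  scan-M zero    w = refl
  scan-M (suc k) w = trans (scan-shift unweighted k [] w) (scan-M k w)

  scan-constant : ∀ y k w → scan (λ _ _ → y) k [] w ≈ y * M w
  scan-constant y k w = trans (scan-cong (λ _ _ → sym (*-identityʳ y)) k [] w)
    (trans (scan-scale y unweighted k [] w) (*-congˡ (scan-M k w)))

  weights-∷ʳ : ∀ st e → weights (st ∷ʳ e) ≈ weight e * weights st
  weights-∷ʳ []       e = refl
  weights-∷ʳ (d ∷ st) e = trans (*-congˡ (weights-∷ʳ st e)) (solve 3 (λ x y z → x :* (y :* z) := y :* (x :* z)) refl _ _ _)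

  length-∷ʳ : ∀ {a} {A : Set a} (st : List A) e → length (st ∷ʳ e) ≡ suc (length st)
  length-∷ʳ st e = ≡.trans (length-++ st) (ℕₚ.+-comm (length st) 1)

  M-[] : M [] ≈ 1#
  M-[] = *-identityˡ 1#

  -- The scan is cut at the last letter of the bottom block e.
  mutual
    last-return : ∀ k st e w →
      scan unweighted k (st ∷ʳ e) w ≈
        weight e * scan unweighted k st w + (reduced (scan irreducible k (st ∷ʳ e)) ⋆ M) w
    last-return k st e [] = begin
      1# * weights (st ∷ʳ e)                      ≈⟨ *-congˡ (weights-∷ʳ st e) ⟩
      1# * (weight e * weights st)                ≈⟨ solve 3 (λ e s m → con 1 :* (e :* s) := e :* (con 1 :* s) :+ con 0 :* m) refl (weight e) (weights st) (M []) ⟩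
      weight e * (1# * weights st) + 0# * M []    ∎
    last-return k st e (a ∷ w) = begin
      scan unweighted (suc k) ((k , 1 , a ∷ []) ∷ st ∷ʳ e) w + scanOld unweighted k (st ∷ʳ e) a w
        ≈⟨ +-cong (last-return′ (suc k) (k , 1 , a ∷ []) st e w) (last-returnOld k st e a w) ⟩
      (weight e * scan unweighted (suc k) ((k , 1 , a ∷ []) ∷ st) w + (scan irreducible (suc k) ((k , 1 , a ∷ []) ∷ st ∷ʳ e) ⋆ M) w)
        + (weight e * scanOld unweighted k st a w + (scanOld irreducible k (st ∷ʳ e) a ⋆ M) w)
        ≈⟨ solve 6 (λ e s x t y m → (e :* s :+ x) :+ (e :* t :+ y) := e :* (s :+ t) :+ (con 0 :* m :+ (x :+ y))) refl (weight e) _ _ _ _ (M (a ∷ w)) ⟩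
      weight e * scan unweighted k st (a ∷ w) + (0# * M (a ∷ w) + ((scan irreducible (suc k) ((k , 1 , a ∷ []) ∷ st ∷ʳ e) ⋆ M) w + (scanOld irreducible k (st ∷ʳ e) a ⋆ M) w))
        ≈⟨ +-congˡ (+-congˡ (⋆-addˡ _ _ M w)) ⟨
      weight e * scan unweighted k st (a ∷ w) + (reduced (scan irreducible k (st ∷ʳ e)) ⋆ M) (a ∷ w) ∎

    -- With a block above `e`, the empty prefix has height at least 2 and irreducible weight 0, so
    -- `reduced` changes nothing.
    last-return′ : ∀ k d st e w →
      scan unweighted k (d ∷ st ∷ʳ e) w ≈
        weight e * scan unweighted k (d ∷ st) w + (scan irreducible k (d ∷ st ∷ʳ e) ⋆ M) w
    last-return′ k d st e w = trans (last-return k (d ∷ st) e w) (+-congˡ (⋆-cong p (λ _ → refl) w))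
      where
      p : reduced (scan irreducible k (d ∷ st ∷ʳ e)) ≋ scan irreducible k (d ∷ st ∷ʳ e)
      p (_ ∷ _) = refl
      p []      = sym (trans (*-congʳ (reflexive (≡.cong (λ l → irreducible k (suc l)) (length-∷ʳ st e)))) (zeroˡ _))

    -- With nothing above `e`, the term in which `e` is never extended again is the constant term
    -- that `reduced` had removed; the two terms of `last-return` merge into one product.
    return : ∀ k e w → scan unweighted k (e ∷ []) w ≈ (scan irreducible k (e ∷ []) ⋆ M) w
    return k e w = begin
      scan unweighted k (e ∷ []) w
        ≈⟨ last-return k [] e w ⟩
      weight e * scan unweighted k [] w + (reduced (scan irreducible k (e ∷ [])) ⋆ M) w
        ≈⟨ +-congʳ (*-cong (solve 1 (λ e → e := con 1 :* (e :* con 1)) refl (weight e)) (scan-M k w)) ⟩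
      scan irreducible k (e ∷ []) [] * M w + (reduced (scan irreducible k (e ∷ [])) ⋆ M) w
        ≈⟨ ⋆-head (scan irreducible k (e ∷ [])) M w ⟨
      (scan irreducible k (e ∷ []) ⋆ M) w ∎

    last-returnOld : ∀ k st e a w →
      scanOld unweighted k (st ∷ʳ e) a w ≈
        weight e * scanOld unweighted k st a w + (scanOld irreducible k (st ∷ʳ e) a ⋆ M) w
    last-returnOld k [] e a w = begin
      scan unweighted k (extend k a e ∷ []) w + weight e * 0#
        ≈⟨ trans (+-comm _ _) (+-congˡ (return k (extend k a e) w)) ⟩
      weight e * 0# + (scan irreducible k (extend k a e ∷ []) ⋆ M) w
        ≈⟨ +-congˡ (⋆-cong (λ v → trans (sym (+-identityʳ _)) (+-congˡ (sym (zeroʳ _)))) (λ _ → refl) w) ⟩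
      weight e * 0# + (scanOld irreducible k (e ∷ []) a ⋆ M) w ∎
    last-returnOld k (d ∷ st) e a w = begin
      scan unweighted k (extend k a d ∷ st ∷ʳ e) w + weight d * scanOld unweighted k (st ∷ʳ e) a w
        ≈⟨ +-cong (last-return′ k (extend k a d) st e w) (*-congˡ (last-returnOld k st e a w)) ⟩
      weight e * scan unweighted k (extend k a d ∷ st) w + (scan irreducible k (extend k a d ∷ st ∷ʳ e) ⋆ M) w
        + weight d * (weight e * scanOld unweighted k st a w + (scanOld irreducible k (st ∷ʳ e) a ⋆ M) w)
        ≈⟨ solve 6 (λ e d s x t y → e :* s :+ x :+ d :* (e :* t :+ y) := e :* (s :+ d :* t) :+ (d :* y :+ x)) refl (weight e) (weight d) _ _ _ _ ⟩
      weight e * scanOld unweighted k (d ∷ st) a w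
        + (weight d * (scanOld irreducible k (st ∷ʳ e) a ⋆ M) w + (scan irreducible k (extend k a d ∷ st ∷ʳ e) ⋆ M) w)
        ≈⟨ +-congˡ (trans (⋆-cong (λ v → +-comm _ _) (λ _ → refl) w) (⋆-linearˡ (weight d) _ _ M w)) ⟨
      weight e * scanOld unweighted k (d ∷ st) a w + (scanOld irreducible k (d ∷ st ∷ʳ e) a ⋆ M) w ∎

  -- The first letter opens block 0. The cut after the last letter of this block leaves an
  -- irreducible partition followed by an arbitrary one.
  boolean-equation : M ≋ ε ⊕ B ⋆ M
  boolean-equation [] = solve 1 (λ m → con 1 :* con 1 := con 1 :+ con 0 :* con 1 :* (con 1 :* con 1)) refl 1#
  boolean-equation (a ∷ w) = begin
    scan unweighted 1 ((0 , 1 , a ∷ []) ∷ []) w + 0#  ≈⟨ +-identityʳ _ ⟩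
    scan unweighted 1 ((0 , 1 , a ∷ []) ∷ []) w       ≈⟨ return 1 _ w ⟩
    (scan irreducible 1 ((0 , 1 , a ∷ []) ∷ []) ⋆ M) w ≈⟨ ⋆-cong (λ v → sym (+-identityʳ _)) (λ _ → refl) w ⟩
    (∂ a B ⋆ M) w                                      ≈⟨ solve 2 (λ m x → x := con 0 :+ (con 0 :* con 1 :* m :+ x)) refl (M (a ∷ w)) _ ⟩
    0# + (B [] * M (a ∷ w) + (∂ a B ⋆ M) w)            ∎

  -- The scan is cut at the first letter that extends the bottom block e.
  mutual
    first-return : ∀ ω k st e w →
      scan ω k (st ∷ʳ e) w ≈
        weight e * scan (λ k l → ω k (suc l)) k st w
        + split (λ v a z → scan (λ k _ → scan ω k (extend k a e ∷ []) z) k st v) w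
    first-return ω k st e [] = begin
      ω k (length (st ∷ʳ e)) * weights (st ∷ʳ e)
        ≈⟨ *-cong (reflexive (≡.cong (ω k) (length-∷ʳ st e))) (weights-∷ʳ st e) ⟩
      ω k (suc (length st)) * (weight e * weights st)
        ≈⟨ solve 3 (λ o e s → o :* (e :* s) := e :* (o :* s) :+ con 0) refl _ _ _ ⟩
      weight e * (ω k (suc (length st)) * weights st) + 0# ∎
    first-return ω k st e (a ∷ w) = begin
      scan ω (suc k) ((k , 1 , a ∷ []) ∷ st ∷ʳ e) w + scanOld ω k (st ∷ʳ e) a w
        ≈⟨ +-cong (first-return ω (suc k) (_ ∷ st) e w) (first-returnOld ω k st e a w) ⟩
      (weight e * scan ω′ (suc k) ((k , 1 , a ∷ []) ∷ st) w + split (λ v b z → scan (ω″ b z) (suc k) ((k , 1 , a ∷ []) ∷ st) v) w)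
        + (weight e * scanOld ω′ k st a w + (scan ω k (extend k a e ∷ []) w * weights st + split (λ v b z → scanOld (ω″ b z) k st a v) w))
        ≈⟨ solve 6 (λ e p q r s t → (e :* p :+ q) :+ (e :* r :+ (s :+ t)) := e :* (p :+ r) :+ (s :+ (con 1 :* q :+ t))) refl (weight e) _ _ _ _ _ ⟩
      weight e * scan ω′ k st (a ∷ w)
        + (scan ω k (extend k a e ∷ []) w * weights st
           + (1# * split (λ v b z → scan (ω″ b z) (suc k) ((k , 1 , a ∷ []) ∷ st) v) w + split (λ v b z → scanOld (ω″ b z) k st a v) w))
        ≈⟨ +-congˡ (+-congˡ (split-linear 1# _ _ w)) ⟨
      weight e * scan ω′ k st (a ∷ w)
        + (scan ω k (extend k a e ∷ []) w * weights st
           + split (λ v b z → 1# * scan (ω″ b z) (suc k) ((k , 1 , a ∷ []) ∷ st) v + scanOld (ω″ b z) k st a v) w)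
        ≈⟨ +-congˡ (+-congˡ (split-cong w (λ _ _ _ _ → +-congʳ (*-identityˡ _)))) ⟩
      weight e * scan ω′ k st (a ∷ w) + split (λ v b z → scan (ω″ b z) k st v) (a ∷ w) ∎
      where
      ω′ = λ k l → ω k (suc l)
      -- The rest of the scan serves as final weight of the part before the cut, because the
      -- extended entry depends on the number of blocks `k` which that part leaves behind.
      ω″ = λ b z k (_ : ℕ) → scan ω k (extend k b e ∷ []) z

    first-returnOld : ∀ ω k st e a w →
      scanOld ω k (st ∷ʳ e) a w ≈
        weight e * scanOld (λ k l → ω k (suc l)) k st a w
        + (scan ω k (extend k a e ∷ []) w * weights st
           + split (λ v b z → scanOld (λ k _ → scan ω k (extend k b e ∷ []) z) k st a v) w)
    first-returnOld ω k [] e a w = begin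
      scan ω k (extend k a e ∷ []) w + weight e * 0#
        ≈⟨ solve 2 (λ s e → s :+ e :* con 0 := e :* con 0 :+ (s :* con 1 :+ con 0)) refl _ _ ⟩
      weight e * 0# + (scan ω k (extend k a e ∷ []) w * 1# + 0#)
        ≈⟨ +-congˡ (+-congˡ (split-zero w)) ⟨
      weight e * 0# + (scan ω k (extend k a e ∷ []) w * 1# + split (λ _ _ _ → 0#) w) ∎
    first-returnOld ω k (d ∷ st) e a w = begin
      scan ω k (extend k a d ∷ st ∷ʳ e) w + weight d * scanOld ω k (st ∷ʳ e) a w
        ≈⟨ +-cong (first-return ω k (extend k a d ∷ st) e w) (*-congˡ (first-returnOld ω k st e a w)) ⟩
      (weight e * scan ω′ k (extend k a d ∷ st) w + split (λ v b z → scan (ω″ b z) k (extend k a d ∷ st) v) w)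
        + weight d * (weight e * scanOld ω′ k st a w + (scan ω k (extend k a e ∷ []) w * weights st + split (λ v b z → scanOld (ω″ b z) k st a v) w))
        ≈⟨ solve 8 (λ e d p q r s t u → (e :* p :+ q) :+ d :* (e :* r :+ (s :* t :+ u)) := e :* (p :+ d :* r) :+ (s :* (d :* t) :+ (d :* u :+ q))) refl (weight e) (weight d) _ _ _ _ _ _ ⟩
      weight e * scanOld ω′ k (d ∷ st) a w + (scan ω k (extend k a e ∷ []) w * weights (d ∷ st)
        + (weight d * split (λ v b z → scanOld (ω″ b z) k st a v) w + split (λ v b z → scan (ω″ b z) k (extend k a d ∷ st) v) w))
        ≈⟨ +-congˡ (+-congˡ (trans (split-cong w (λ _ _ _ _ → +-comm _ _)) (split-linear (weight d) _ _ w))) ⟨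
      weight e * scanOld ω′ k (d ∷ st) a w + (scan ω k (extend k a e ∷ []) w * weights (d ∷ st)
        + split (λ v b z → scanOld (ω″ b z) k (d ∷ st) a v) w) ∎
      where
      ω′ = λ k l → ω k (suc l)
      ω″ = λ b z k (_ : ℕ) → scan ω k (extend k b e ∷ []) z

  module Free (f : Ser) (g≈f : ∀ N u → g N u ≈ f u) where

    -- As the weights ignore hulls, the gaps between letters of the open block are independent, and
    -- each contributes a factor `M`. The first-return cut then has the shape of `mix-split`; `n`
    -- bounds the length of `w` for termination.
    scan-free : ∀ n k c N u w → length w ℕ.≤ n → scan unweighted k ((c , N , u) ∷ []) w ≈ compose M (λ v → f (u ++ v)) w
    scan-free n k c N u w l = begin
      scan unweighted k ((c , N , u) ∷ []) w
        ≈⟨ first-return unweighted k [] (c , N , u) w ⟩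
      g N u * scan unweighted k [] w + split (λ v a z → scan (λ k _ → scan unweighted k ((c , k ∸ c , u ∷ʳ a) ∷ []) z) k [] v) w
        ≈⟨ +-cong (trans (*-cong (trans (g≈f N u) (reflexive (≡.cong f (≡.sym (++-[] u))))) (scan-M k w)) (*-comm _ _))
                  (split-cong w (λ v a z l′ → step n l v a z l′)) ⟩
      M w * f (u ++ []) + split (λ v a z → M v * compose M (λ y → f (u ++ a ∷ y)) z) w
        ≈⟨ mix-split M M (λ v → f (u ++ v)) w ⟨
      compose M (λ v → f (u ++ v)) w ∎
      where
      ++-[] : ∀ (u : List X) → u ++ [] ≡ u
      ++-[] []      = ≡.refl
      ++-[] (a ∷ u) = ≡.cong (a ∷_) (++-[] u)
      step : ∀ n → length w ℕ.≤ n → ∀ v a z → length z ℕ.< length w →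
        scan (λ k _ → scan unweighted k ((c , k ∸ c , u ∷ʳ a) ∷ []) z) k [] v ≈ M v * compose M (λ y → f (u ++ a ∷ y)) z
      step zero    l v a z l′ with () ← ℕₚ.≤-trans l′ l
      step (suc n) l v a z l′ = begin
        scan (λ k _ → scan unweighted k ((c , k ∸ c , u ∷ʳ a) ∷ []) z) k [] v
          ≈⟨ scan-cong (λ k _ → scan-free n k c (k ∸ c) (u ∷ʳ a) z (ℕₚ.≤-pred (ℕₚ.≤-trans l′ l))) k [] v ⟩
        scan (λ _ _ → compose M (λ y → f ((u ∷ʳ a) ++ y)) z) k [] v
          ≈⟨ scan-constant _ k v ⟩
        compose M (λ y → f ((u ∷ʳ a) ++ y)) z * M v
          ≈⟨ *-comm _ _ ⟩
        M v * compose M (λ y → f ((u ∷ʳ a) ++ y)) z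
          ≈⟨ *-congˡ (mix-cong (λ _ → refl) (λ _ → refl) (λ y → reflexive (≡.cong f (++-assoc u (a ∷ []) y))) z) ⟩
        M v * compose M (λ y → f (u ++ a ∷ y)) z ∎

    free-equation : M ≋ σ M (unital f)
    free-equation []      = *-identityˡ 1#
    free-equation (a ∷ w) = trans (+-identityʳ _) (scan-free (length w) 1 0 1 (a ∷ []) w ℕₚ.≤-refl)

-- The Grassmann algebra over a commutative ring.

dual : ∀ {c ℓ} → CommutativeRing c ℓ → CommutativeRing c ℓ
dual R = record
  { Carrier = 𝔾 R ; _≈_ = _≈𝔾_ R ; _+_ = _+𝔾_ R ; _*_ = _*𝔾_ R
  ; -_ = λ (z , w) → - z , - w ; 0# = 0𝔾 R ; 1# = 1𝔾 R
  ; isCommutativeRing = record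
    { isRing = record
      { +-isAbelianGroup = record
        { isGroup = record
          { isMonoid = record
            { isSemigroup = record
              { isMagma = record
                { isEquivalence = record
                  { refl = refl , refl
                  ; sym = λ (p , q) → sym p , sym q
                  ; trans = λ (p , q) (p′ , q′) → trans p p′ , trans q q′ }
                ; ∙-cong = λ (p , q) (p′ , q′) → +-cong p p′ , +-cong q q′ }
              ; assoc = λ _ _ _ → +-assoc _ _ _ , +-assoc _ _ _ }
            ; identity = (λ _ → +-identityˡ _ , +-identityˡ _) , (λ _ → +-identityʳ _ , +-identityʳ _) }
          ; inverse = (λ _ → -‿inverseˡ _ , -‿inverseˡ _) , (λ _ → -‿inverseʳ _ , -‿inverseʳ _)
          ; ⁻¹-cong = λ (p , q) → -‿cong p , -‿cong q }
        ; comm = λ _ _ → +-comm _ _ , +-comm _ _ }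
      ; *-cong = λ (p , q) (p′ , q′) → *-cong p p′ , +-cong (*-cong p q′) (*-cong q p′)
      ; *-assoc = λ (a , a′) (b , b′) (d , d′) → *-assoc _ _ _ ,
          solve 6 (λ a a′ b b′ d d′ → a :* b :* d′ :+ (a :* b′ :+ a′ :* b) :* d := a :* (b :* d′ :+ b′ :* d) :+ a′ :* (b :* d)) refl a a′ b b′ d d′
      ; *-identity = (λ _ → *-identityˡ _ , trans (+-cong (*-identityˡ _) (zeroˡ _)) (+-identityʳ _))
                   , (λ _ → *-identityʳ _ , trans (+-cong (zeroʳ _) (*-identityʳ _)) (+-identityˡ _))
      ; distrib = (λ (a , a′) (b , b′) (d , d′) → distribˡ _ _ _ ,
                    solve 6 (λ a a′ b b′ d d′ → a :* (b′ :+ d′) :+ a′ :* (b :+ d) := a :* b′ :+ a′ :* b :+ (a :* d′ :+ a′ :* d)) refl a a′ b b′ d d′)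
                , (λ (a , a′) (b , b′) (d , d′) → distribʳ _ _ _ ,
                    solve 6 (λ a a′ b b′ d d′ → (b :+ d) :* a′ :+ (b′ :+ d′) :* a := b :* a′ :+ b′ :* a :+ (d :* a′ :+ d′ :* a)) refl a a′ b b′ d d′) }
    ; *-comm = λ _ _ → *-comm _ _ , trans (+-comm _ _) (+-cong (*-comm _ _) (*-comm _ _)) } }
  where
  open CommutativeRing R
  open import Algebra.Solver.Ring.NaturalCoefficients.Default commutativeSemiring
    using (solve; _:+_; _:*_; _:=_)

-- Additive maps applied to substitutions.

module Naturality {c₁ ℓ₁ c₂ ℓ₂} (R₁ : CommutativeRing c₁ ℓ₁) (R₂ : CommutativeRing c₂ ℓ₂) {x} (X : Set x)
  (L : CommutativeRing.Carrier R₁ → CommutativeRing.Carrier R₂) where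
  private
    module R₁ = CommutativeRing R₁
    module R₂ = CommutativeRing R₂
    module S₁ = Series R₁ X
    module S₂ = Series R₂ X

  module _ (L-+ : ∀ p q → L (p R₁.+ q) R₂.≈ L p R₂.+ L q) where

    -- Every product in `mix` has a value of `H` or `G` on its left. Asking `L` to respect just
    -- these left multiplications makes the lemma cover negation, the projections of 𝔾, derivations
    -- on constants and p ↦ p + ħ D p alike.
    mix-natural : ∀ {H₁ G₁ H₂ G₂} →
      (∀ v p → L (H₁ v R₁.* p) R₂.≈ H₂ v R₂.* L p) → (∀ v p → L (G₁ v R₁.* p) R₂.≈ G₂ v R₂.* L p) →
      ∀ f w → L (S₁.mix H₁ G₁ f w) R₂.≈ S₂.mix H₂ G₂ (λ v → L (f v)) w
    mix-natural p q f []      = p [] (f [])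
    mix-natural p q f (a ∷ w) = R₂.trans (L-+ _ _)
      (R₂.+-cong (R₂.trans (p [] _) (R₂.*-congˡ (mix-natural q q _ w))) (mix-natural (λ v → p (a ∷ v)) q f w))

-- Differential rings and flows in a formal time.

record Differential {c ℓ} (R : CommutativeRing c ℓ) : Set (c Level.⊔ ℓ) where
  open CommutativeRing R
  field
    -- `D` models d/dt and `z` the value at time 0; by `integrate` the two together determine an
    -- element.
    D z       : Carrier → Carrier
    D-cong    : ∀ {p q} → p ≈ q → D p ≈ D q
    D-+       : ∀ p q → D (p + q) ≈ D p + D q
    D-*       : ∀ p q → D (p * q) ≈ p * D q + D p * q
    D-0       : D 0# ≈ 0#
    D-1       : D 1# ≈ 0#
    z-cong    : ∀ {p q} → p ≈ q → z p ≈ z q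
    z-+       : ∀ p q → z (p + q) ≈ z p + z q
    z-*       : ∀ p q → z (p * q) ≈ z p * z q
    z-0       : z 0# ≈ 0#
    z-1       : z 1# ≈ 1#
    integrate : ∀ {p q} → D p ≈ D q → z p ≈ z q → p ≈ q

-- A derivation D is a ring homomorphism p ↦ p + ħ D p, and perturbing G to G + ħ compose G h is
-- composition of G with ε + ħ h.
module Flow {c ℓ} (R : CommutativeRing c ℓ) (𝒟 : Differential R) {x} (X : Set x) where
  open CommutativeRing R
  open Differential 𝒟
  open Series R X
  open import Algebra.Properties.Ring ring using (-‿distribʳ-*; -‿+-comm)
  open import Relation.Binary.Reasoning.Setoid setoid
  private
    module 𝔾 = CommutativeRing (dual R)
    module S𝔾 = Series (dual R) X

  ιs : Ser → S𝔾.Ser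
  ιs f w = f w , 0#

  constant : ∀ {y} → D y ≈ 0# → ∀ p → D (y * p) ≈ y * D p
  constant Dy p = trans (D-* _ p) (trans (+-congˡ (trans (*-congʳ Dy) (zeroˡ p))) (+-identityʳ _))

  module _ (h M N : Ser) (h-[] : h [] ≈ 0#)
    (Dh : ∀ w → D (h w) ≈ 0#) (zh : ∀ w → z (h w) ≈ h w)
    (DM : ∀ w → D (M w) ≈ compose M h w) (DN : ∀ w → D (N w) ≈ - compose N h w)
    (zM : ∀ w → z (M w) ≈ ε w) (zN : ∀ w → z (N w) ≈ ε w) where

    -- `E₊` and `E₋` are 1 ± ħ h. `Z` is `M` composed with `E₊` on the right and `Y` on the left.
    -- The equation for `M` gives `eM = Z`, whereas cancellation against the `E₋` in `eN` needs
    -- `eM = Y`.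
    E₊ E₋ eM eN Y Z : S𝔾.Ser
    E₊ w = ε w , h w
    E₋ w = ε w , - h w
    eM w = M w , D (M w)
    eN w = N w , D (N w)
    Z w  = M w , compose M h w
    Y    = S𝔾.compose E₊ (ιs M)

    Dε : ∀ w → D (ε w) ≈ 0#
    Dε []      = D-1
    Dε (_ ∷ _) = D-0

    zε : ∀ w → z (ε w) ≈ ε w
    zε []      = z-1
    zε (_ ∷ _) = z-0

    proj₁-compose : ∀ G f w → proj₁ (S𝔾.compose G f w) ≈ compose (λ v → proj₁ (G v)) (λ v → proj₁ (f v)) w
    proj₁-compose G = mix-natural (λ _ _ → refl) (λ _ _ → refl) (λ _ _ → refl)
      where open Naturality (dual R) R X proj₁

    proj₂-compose : ∀ G f w → proj₂ (S𝔾.compose (ιs G) f w) ≈ compose G (λ v → proj₂ (f v)) w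
    proj₂-compose G = mix-natural (λ _ _ → refl) p p
      where
      open Naturality (dual R) R X proj₂
      p : ∀ v q → G v * proj₂ q + 0# * proj₁ q ≈ G v * proj₂ q
      p v q = trans (+-congˡ (zeroˡ _)) (+-identityʳ _)

    e-compose : ∀ G f w → (compose G f w , D (compose G f w)) 𝔾.≈ S𝔾.compose (λ v → G v , D (G v)) (λ v → f v , D (f v)) w
    e-compose G = mix-natural (λ p q → refl , D-+ p q) (λ _ p → refl , D-* _ p) (λ _ p → refl , D-* _ p)
      where open Naturality R (dual R) X (λ p → p , D p)

    z-compose : ∀ G f w → z (compose G f w) ≈ compose (λ v → z (G v)) (λ v → z (f v)) w
    z-compose G = mix-natural z-+ (λ _ → z-* _) (λ _ → z-* _)
      where open Naturality R R X z

    neg-compose : ∀ G f w → - compose G f w ≈ compose G (⊖ f) w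
    neg-compose G = mix-natural (λ p q → sym (-‿+-comm p q)) (λ _ p → -‿distribʳ-* _ p) (λ _ p → -‿distribʳ-* _ p)
      where open Naturality R R X -_

    eM≈Z : eM S𝔾.≋ Z
    eM≈Z w = refl , DM w

    eN≈compose : eN S𝔾.≋ S𝔾.compose (ιs N) E₋
    eN≈compose w = sym (trans (proj₁-compose (ιs N) E₋ w) (compose-unit N w))
           , trans (DN w) (trans (neg-compose N h w) (sym (proj₂-compose N E₋ w)))

    proj₁-Y : ∀ w → proj₁ (Y w) ≈ M w
    proj₁-Y w = trans (proj₁-compose E₊ (ιs M) w) (compose-ε M w)

    ιh≈eh : ∀ w → ιs h w 𝔾.≈ (h w , D (h w))
    ιh≈eh w = refl , sym (Dh w)

    -- Since `h` is constant in time, differentiating `compose M h` perturbs only `M`, and the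
    -- perturbed series is `Z`.
    D-proj₂-Z : ∀ w → D (compose M h w) ≈ proj₂ (S𝔾.compose Z (ιs h) w)
    D-proj₂-Z w = trans (proj₂ (e-compose M h w)) (proj₂ (S𝔾.mix-cong eM≈Z eM≈Z (λ v → 𝔾.sym (ιh≈eh v)) w))

    -- `E₊` is constant in time, so `D` passes through to `M` and produces `compose M h`;
    -- associativity then leaves the new `h` on the right of `Y`.
    D-proj₂-Y : ∀ w → D (proj₂ (Y w)) ≈ proj₂ (S𝔾.compose Y (ιs h) w)
    D-proj₂-Y w = begin
      D (proj₂ (Y w))                            ≈⟨ proj₂ (mix-natural (λ _ _ → D-+ _ _ , D-+ _ _) p p (ιs M) w) ⟩
      proj₂ (S𝔾.compose E₊ (λ v → D (M v) , D 0#) w)   ≈⟨ proj₂ (S𝔾.mix-cong (λ _ → 𝔾.refl) (λ _ → 𝔾.refl) q w) ⟩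
      proj₂ (S𝔾.compose E₊ (S𝔾.compose (ιs M) (ιs h)) w)     ≈⟨ proj₂ (S𝔾.compose-compose E₊ (ιs M) (ιs h) w) ⟩
      proj₂ (S𝔾.compose Y (ιs h) w)                    ∎
      where
      open Naturality (dual R) (dual R) X (λ (p , q) → D p , D q)
      p : ∀ v q → (D (ε v * proj₁ q) , D (ε v * proj₂ q + h v * proj₁ q)) 𝔾.≈ (E₊ v 𝔾.* (D (proj₁ q) , D (proj₂ q)))
      p v q = constant (Dε v) _ , trans (D-+ _ _) (+-cong (constant (Dε v) _) (constant (Dh v) _))
      q : ∀ v → (D (M v) , D 0#) 𝔾.≈ S𝔾.compose (ιs M) (ιs h) v
      q v = trans (DM v) (sym (proj₁-compose (ιs M) (ιs h) v))
          , trans D-0 (sym (trans (proj₂-compose M (ιs h) v) (mix-zeroʳ M M (λ _ → refl) v)))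

    z-proj₂-Z : ∀ w → z (compose M h w) ≈ h w
    z-proj₂-Z w = trans (z-compose M h w) (trans (mix-cong zM zM zh w) (compose-ε h w))

    z-proj₂-Y : ∀ w → z (proj₂ (Y w)) ≈ h w
    z-proj₂-Y w = begin
      z (proj₂ (Y w))                            ≈⟨ proj₂ (mix-natural (λ _ _ → z-+ _ _ , z-+ _ _) p p (ιs M) w) ⟩
      proj₂ (S𝔾.compose E₊ (λ v → z (M v) , z 0#) w)   ≈⟨ proj₂ (S𝔾.mix-cong (λ _ → 𝔾.refl) (λ _ → 𝔾.refl) q w) ⟩
      proj₂ (S𝔾.compose E₊ S𝔾.ε w)                     ≈⟨ proj₂ (S𝔾.compose-unit E₊ w) ⟩
      h w                                        ∎
      where
      open Naturality (dual R) (dual R) X (λ (p , q) → z p , z q)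
      p : ∀ v q → (z (ε v * proj₁ q) , z (ε v * proj₂ q + h v * proj₁ q)) 𝔾.≈ (E₊ v 𝔾.* (z (proj₁ q) , z (proj₂ q)))
      p v q = trans (z-* _ _) (*-congʳ (zε v))
            , trans (z-+ _ _) (+-cong (trans (z-* _ _) (*-congʳ (zε v))) (trans (z-* _ _) (*-congʳ (zh v))))
      q : ∀ v → (z (M v) , z 0#) 𝔾.≈ S𝔾.ε v
      q []      = zM [] , z-0
      q (a ∷ v) = zM (a ∷ v) , z-0

    -- The ħ-parts of `Y` and `Z` both solve the equation that equates D y with the ħ-part of
    -- `compose (M + ħ y) h`, with value `h` at time 0. Because `h [] = 0`, the right side at `w`
    -- sees y on shorter words only, so induction on length and `integrate` identify them.
    Y≈Z-< : ∀ n w → length w ℕ.< n → Y w 𝔾.≈ Z w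
    Y≈Z-< (suc n) w (s≤s l) = proj₁-Y w , integrate
      (trans (D-proj₂-Y w)
        (trans (proj₂ (S𝔾.mix-cong-< n (Y≈Z-< n) (Y≈Z-< n) (λ _ → 𝔾.refl) (h-[] , refl) w l)) (sym (D-proj₂-Z w))))
      (trans (z-proj₂-Y w) (sym (z-proj₂-Z w)))

    eM≈Y : eM S𝔾.≋ Y
    eM≈Y w = 𝔾.trans (eM≈Z w) (𝔾.sym (Y≈Z-< _ w ℕₚ.≤-refl))

    -- Composition is linear on the right, so the value is `E₋` plus the composition of `E₋` with ħ
    -- h. In the latter ħ² = 0 replaces `E₋` by `ε`, and the two terms ħ h cancel.
    E₋∘E₊ : S𝔾.compose E₋ E₊ S𝔾.≋ S𝔾.ε
    E₋∘E₊ w = 𝔾.trans (S𝔾.mix-cong (λ _ → 𝔾.refl) (λ _ → 𝔾.refl) E₊-sum w)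
      (𝔾.trans (S𝔾.mix-linearʳ 𝔾.1# E₋ E₋ S𝔾.ε (λ v → 0# , h v) w)
      (𝔾.trans (𝔾.+-cong (𝔾.trans (𝔾.*-identityˡ _) (S𝔾.compose-unit E₋ w)) (𝔾.trans (𝔾.sym (mix-natural (λ _ _ → sym (+-identityˡ _) , refl) p p h w)) (refl , compose-ε h w)))
      (cancel w)))
      where
      open Naturality R (dual R) X (λ q → 0# , q)
      p : ∀ v q → (0# , ε v * q) 𝔾.≈ (E₋ v 𝔾.* (0# , q))
      p v q = sym (zeroʳ _) , sym (trans (+-congˡ (zeroʳ _)) (+-identityʳ _))
      E₊-sum : ∀ v → E₊ v 𝔾.≈ (𝔾.1# 𝔾.* S𝔾.ε v) 𝔾.+ (0# , h v)
      E₊-sum v = 𝔾.trans (ε-sum v) (𝔾.+-congʳ (𝔾.sym (𝔾.*-identityˡ (S𝔾.ε v))))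
        where
        ε-sum : ∀ v → E₊ v 𝔾.≈ S𝔾.ε v 𝔾.+ (0# , h v)
        ε-sum []      = sym (+-identityʳ _) , sym (+-identityˡ _)
        ε-sum (_ ∷ _) = sym (+-identityʳ _) , sym (+-identityˡ _)
      cancel : ∀ v → E₋ v 𝔾.+ (0# , h v) 𝔾.≈ S𝔾.ε v
      cancel []      = +-identityʳ _ , -‿inverseˡ _
      cancel (_ ∷ _) = +-identityʳ _ , -‿inverseˡ _

    -- The derivative of N ∘ M is the ħ-part of N ∘ E₋ ∘ E₊ ∘ M = N ∘ M, which is 0, and at time 0
    -- the composite is `ε`.
    flow-inverse : compose N M ≋ ε
    flow-inverse w = integrate (trans stationary (sym (Dε w)))
      (trans (z-compose N M w) (trans (mix-cong zN zN zM w) (trans (compose-ε ε w) (sym (zε w)))))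
      where
      pull : S𝔾.compose (S𝔾.compose (ιs N) E₋) Y S𝔾.≋ S𝔾.compose (ιs N) (ιs M)
      pull v = 𝔾.trans (𝔾.sym (S𝔾.compose-compose (ιs N) E₋ Y v)) (S𝔾.mix-cong (λ _ → 𝔾.refl) (λ _ → 𝔾.refl)
        (λ y → 𝔾.trans (S𝔾.compose-compose E₋ E₊ (ιs M) y) (𝔾.trans (S𝔾.mix-cong E₋∘E₊ E₋∘E₊ (λ _ → 𝔾.refl) y) (S𝔾.compose-ε (ιs M) y))) v)
      stationary : D (compose N M w) ≈ 0#
      stationary = begin
        D (compose N M w)                                ≈⟨ proj₂ (e-compose N M w) ⟩
        proj₂ (S𝔾.compose eN eM w)                       ≈⟨ proj₂ (S𝔾.mix-cong eN≈compose eN≈compose eM≈Y w) ⟩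
        proj₂ (S𝔾.compose (S𝔾.compose (ιs N) E₋) Y w)          ≈⟨ proj₂ (pull w) ⟩
        proj₂ (S𝔾.compose (ιs N) (ιs M) w)               ≈⟨ proj₂-compose N (ιs M) w ⟩
        compose N (λ _ → 0#) w                           ≈⟨ mix-zeroʳ N N (λ _ → refl) w ⟩
        0#                                         ∎

-- Composition with its last gap split off.

module Primitive {c ℓ} (S : CommutativeRing c ℓ) {x} (X : Set x) where
  open CommutativeRing S
  open Series S X
  open import Algebra.Solver.Ring.NaturalCoefficients.Default commutativeSemiring
    using (solve; _:+_; _:*_; _:=_; con)
  open import Relation.Binary.Reasoning.Setoid setoid

  mutual
    -- `compose G f` sums f(a₁...aₙ) G a₁ G ⋯ G aₙ G; `κ` leaves off the final G. In `κ⁺` a gap is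
    -- in progress, `H` is what remains of it, and a letter of `f` must still follow.
    κ : Ser → Ser → Ser
    κ G f []      = f []
    κ G f (a ∷ w) = G [] * κ G (∂ a f) w + κ⁺ (∂ a G) G f w

    κ⁺ : Ser → Ser → Ser → Ser
    κ⁺ H G f []      = 0#
    κ⁺ H G f (a ∷ w) = H [] * κ G (∂ a f) w + κ⁺ (∂ a H) G f w

  mutual
    κ-⋆ : ∀ G f → compose G f ≋ κ G f ⋆ G
    κ-⋆ G f w = begin
      mix G G f w                     ≈⟨ κ⁺-⋆ G G f w ⟩
      G w * f [] + (κ⁺ G G f ⋆ G) w   ≈⟨ head w ⟩
      (κ G f ⋆ G) w                   ∎
      where
      head : ∀ w → G w * f [] + (κ⁺ G G f ⋆ G) w ≈ (κ G f ⋆ G) w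
      head []      = solve 2 (λ g f → g :* f :+ con 0 :* g := f :* g) refl (G []) (f [])
      head (a ∷ w) = solve 3 (λ g f y → g :* f :+ (con 0 :* g :+ y) := f :* g :+ y) refl (G (a ∷ w)) (f []) _

    κ⁺-⋆ : ∀ H G f w → mix H G f w ≈ H w * f [] + (κ⁺ H G f ⋆ G) w
    κ⁺-⋆ H G f []      = sym (trans (+-congˡ (zeroˡ _)) (+-identityʳ _))
    κ⁺-⋆ H G f (a ∷ w) = begin
      H [] * mix G G (∂ a f) w + mix (∂ a H) G f w
        ≈⟨ +-cong (*-congˡ (κ-⋆ G (∂ a f) w)) (κ⁺-⋆ (∂ a H) G f w) ⟩
      H [] * (κ G (∂ a f) ⋆ G) w + (H (a ∷ w) * f [] + (κ⁺ (∂ a H) G f ⋆ G) w)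
        ≈⟨ solve 5 (λ h k x y g → h :* k :+ (x :+ y) := x :+ (con 0 :* g :+ (h :* k :+ y))) refl (H []) _ _ _ (G (a ∷ w)) ⟩
      H (a ∷ w) * f [] + (0# * G (a ∷ w) + (H [] * (κ G (∂ a f) ⋆ G) w + (κ⁺ (∂ a H) G f ⋆ G) w))
        ≈⟨ +-congˡ (+-congˡ (⋆-linearˡ (H []) (κ G (∂ a f)) (κ⁺ (∂ a H) G f) G w)) ⟨
      H (a ∷ w) * f [] + (κ⁺ H G f ⋆ G) (a ∷ w) ∎

  mutual
    κ-cong : ∀ G {f f′} → f ≋ f′ → κ G f ≋ κ G f′
    κ-cong G p []      = p []
    κ-cong G p (a ∷ w) = +-cong (*-congˡ (κ-cong G (λ v → p (a ∷ v)) w)) (κ⁺-cong (∂ a G) G p w)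

    κ⁺-cong : ∀ H G {f f′} → f ≋ f′ → κ⁺ H G f ≋ κ⁺ H G f′
    κ⁺-cong H G p []      = refl
    κ⁺-cong H G p (a ∷ w) = +-cong (*-congˡ (κ-cong G (λ v → p (a ∷ v)) w)) (κ⁺-cong (∂ a H) G p w)

  ⋆-cong-≤ : ∀ n {f g g′} → (∀ v → length v ℕ.≤ n → g v ≈ g′ v) → ∀ w → length w ℕ.≤ n → (f ⋆ g) w ≈ (f ⋆ g′) w
  ⋆-cong-≤ n       q []      l       = *-congˡ (q [] z≤n)
  ⋆-cong-≤ (suc n) q (a ∷ w) (s≤s l) =
    +-cong (*-congˡ (q (a ∷ w) (s≤s l))) (⋆-cong-≤ n (λ v l → q v (ℕₚ.m≤n⇒m≤1+n l)) w l)

  -- As `B [] = 0`, the value of `B ⋆ X` at a word involves `X` on shorter words only, so the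
  -- equation is a recursion.
  ⋆-fixpoint-unique : ∀ {B F X Y} → B [] ≈ 0# → X ≋ F ⊕ B ⋆ X → Y ≋ F ⊕ B ⋆ Y → X ≋ Y
  ⋆-fixpoint-unique {B} {F} {X} {Y} B₀ p q w = go _ w ℕₚ.≤-refl
    where
    go : ∀ n w → length w ℕ.< n → X w ≈ Y w
    step : ∀ n w → length w ℕ.≤ n → (B ⋆ X) w ≈ (B ⋆ Y) w
    go (suc n) w (s≤s l) = trans (p w) (trans (+-congˡ (step n w l)) (sym (q w)))
    vanish : ∀ {y z} → B [] * y ≈ B [] * z
    vanish = trans (trans (*-congʳ B₀) (zeroˡ _)) (sym (trans (*-congʳ B₀) (zeroˡ _)))
    step n       []      l       = vanish
    step (suc n) (a ∷ w) (s≤s l) = +-cong vanish (⋆-cong-≤ n (λ v l → go (suc n) v (s≤s l)) w l)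

-- The differential equation of the monotone moment series.

-- With g N u = t (h u) / N, the scan sums t^|π| h_π / τ(π)!.
module Monotone {c ℓ} (R : CommutativeRing c ℓ) (𝒟 : Differential R) {x} {X : Set x}
  (t : CommutativeRing.Carrier R) (rc : ℕ → CommutativeRing.Carrier R) (h : List X → CommutativeRing.Carrier R) where
  open CommutativeRing R
  open Differential 𝒟
  open Series R X
  open Primitive R X
  open Flow R 𝒟 X using (constant)
  open Automaton R (λ N u → rc N * (t * h u))
  open import Algebra.Solver.Ring.NaturalCoefficients.Default commutativeSemiring
    using (solve; _:+_; _:*_; _:=_; con)
  open import Relation.Binary.Reasoning.Setoid setoid

  infixr 8 t^_
  t^_ : ℕ → Carrier
  t^ zero  = 1#
  t^ suc j = t * t^ j

  κ-split : ∀ G f w → κ G f w ≈ ε w * f [] + split (λ v a z → G v * κ G (∂ a f) z) w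
  κ-split G f []      = sym (trans (+-identityʳ _) (*-identityˡ _))
  κ-split G f (a ∷ w) = sym (trans (+-congʳ (zeroˡ _)) (trans (+-identityˡ _) (+-congˡ (sym (κ⁺-split (∂ a G) w)))))
    where
    κ⁺-split : ∀ H w → κ⁺ H G f w ≈ split (λ v a z → H v * κ G (∂ a f) z) w
    κ⁺-split H []      = refl
    κ⁺-split H (a ∷ w) = +-congˡ (κ⁺-split (∂ a H) w)

  mutual
    -- After a letter the stack is nonempty; counting the hidden bottom block, the height is at
    -- least 2, where `irreducible` is 0.
    scan-empty : ∀ k st a w → scan (λ k l → irreducible k (suc l)) k st (a ∷ w) ≈ 0#
    scan-empty k st a []      = trans (+-cong (zeroˡ _) (scanOld-empty k st a [])) (+-identityˡ _)
    scan-empty k st a (b ∷ w) = trans (+-cong (scan-empty _ _ b w) (scanOld-empty k st a (b ∷ w))) (+-identityˡ _)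

    scanOld-empty : ∀ k st a w → scanOld (λ k l → irreducible k (suc l)) k st a w ≈ 0#
    scanOld-empty k []       a w       = refl
    scanOld-empty k (e ∷ st) a []      = trans (+-cong (zeroˡ _) (trans (*-congˡ (scanOld-empty k st a [])) (zeroʳ _))) (+-identityˡ _)
    scanOld-empty k (e ∷ st) a (b ∷ w) = trans (+-cong (scan-empty _ _ b w) (trans (*-congˡ (scanOld-empty k st a (b ∷ w))) (zeroʳ _))) (+-identityˡ _)

  scan-ε : ∀ k w → scan (λ k l → irreducible k (suc l)) k [] w ≈ ε w
  scan-ε k []      = *-identityˡ _
  scan-ε k (a ∷ w) = scan-empty k [] a w

  module _ (Dt : D t ≈ 1#) (zt : z t ≈ 0#) (Drc : ∀ n → D (rc n) ≈ 0#)
    (rc-inverse : ∀ n → fromℕ R (suc n) * rc (suc n) ≈ 1#) (Dh : ∀ w → D (h w) ≈ 0#) where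

    D-power : ∀ j → D (t^ suc j) ≈ fromℕ R (suc j) * t^ j
    D-power zero    = begin
      D (t * 1#)            ≈⟨ D-* t 1# ⟩
      t * D 1# + D t * 1#   ≈⟨ +-cong (*-congˡ D-1) (*-congʳ Dt) ⟩
      t * 0# + 1# * 1#      ≈⟨ solve 1 (λ t → t :* con 0 :+ con 1 :* con 1 := (con 1 :+ con 0) :* con 1) refl t ⟩
      (1# + 0#) * 1#        ∎
    D-power (suc j) = begin
      D (t * t^ suc j)                          ≈⟨ D-* t _ ⟩
      t * D (t^ suc j) + D t * t^ suc j         ≈⟨ +-cong (*-congˡ (D-power j)) (*-congʳ Dt) ⟩
      t * (fromℕ R (suc j) * t^ j) + 1# * (t * t^ j)
        ≈⟨ solve 3 (λ t n p → t :* (n :* p) :+ con 1 :* (t :* p) := (con 1 :+ n) :* (t :* p)) refl t (fromℕ R (suc j)) (t^ j) ⟩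
      (1# + fromℕ R (suc j)) * (t * t^ j)       ∎

    -- The cancellation of the factor 1/|π| that the outer block of an irreducible partition with
    -- `suc j` blocks contributes to 1/τ(π)!.
    D-divided-power : ∀ j → D (rc (suc j) * t^ suc j) ≈ t^ j
    D-divided-power j = begin
      D (rc (suc j) * t^ suc j)               ≈⟨ constant (Drc _) _ ⟩
      rc (suc j) * D (t^ suc j)               ≈⟨ *-congˡ (D-power j) ⟩
      rc (suc j) * (fromℕ R (suc j) * t^ j)   ≈⟨ solve 3 (λ r n p → r :* (n :* p) := n :* r :* p) refl (rc (suc j)) (fromℕ R (suc j)) (t^ j) ⟩
      fromℕ R (suc j) * rc (suc j) * t^ j     ≈⟨ *-congʳ (rc-inverse j) ⟩
      1# * t^ j                               ≈⟨ *-identityˡ _ ⟩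
      t^ j                                    ∎

    -- Each stack entry gives up one `t` to the power and otherwise consists of constants, so the
    -- assumption on the full power applies once the stack is exhausted.
    D-weights : ∀ {y ŷ} j st → D (t^ (j ℕ.+ length st) * y) ≈ t^ (j ℕ.+ length st) * ŷ →
      D (t^ j * (y * weights st)) ≈ t^ j * (ŷ * weights st)
    D-weights {y} {ŷ} j [] p = begin
      D (t^ j * (y * 1#))  ≈⟨ D-cong (*-congˡ (*-identityʳ y)) ⟩
      D (t^ j * y)         ≈⟨ ≡.subst (λ i → D (t^ i * y) ≈ t^ i * ŷ) (ℕₚ.+-identityʳ j) p ⟩
      t^ j * ŷ             ≈⟨ *-congˡ (*-identityʳ ŷ) ⟨
      t^ j * (ŷ * 1#)      ∎
    D-weights {y} {ŷ} j ((_ , N , u) ∷ st) p = begin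
      D (t^ j * (y * (rc N * (t * h u) * weights st)))      ≈⟨ D-cong (rearrange y) ⟩
      D (rc N * (h u * (t^ suc j * (y * weights st))))      ≈⟨ trans (constant (Drc N) _) (*-congˡ (constant (Dh u) _)) ⟩
      rc N * (h u * D (t^ suc j * (y * weights st)))
        ≈⟨ *-congˡ (*-congˡ (D-weights (suc j) st (≡.subst (λ i → D (t^ i * y) ≈ t^ i * ŷ) (ℕₚ.+-suc j (length st)) p))) ⟩
      rc N * (h u * (t^ suc j * (ŷ * weights st)))          ≈⟨ rearrange ŷ ⟨
      t^ j * (ŷ * (rc N * (t * h u) * weights st))          ∎
      where
      rearrange : ∀ y → t^ j * (y * (rc N * (t * h u) * weights st)) ≈ rc N * (h u * (t^ suc j * (y * weights st)))
      rearrange y = solve 6 (λ p y r t h s → p :* (y :* (r :* (t :* h) :* s)) := r :* (h :* (t :* p :* (y :* s)))) refl (t^ j) y (rc N) t (h u) (weights st)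

    -- t^ j stands for all closed blocks but one, so that t^ j * scan ω k st w is a combination
    -- of the t^ i * ω (suc i) l with coefficients killed by D.
    mutual
      D-scan : ∀ {ω ω̂} → (∀ i l → D (t^ i * ω (suc i) l) ≈ t^ i * ω̂ (suc i) l) →
        ∀ j k st → suc (j ℕ.+ length st) ≡ k → ∀ w → D (t^ j * scan ω k st w) ≈ t^ j * scan ω̂ k st w
      D-scan p j k st ≡.refl []      = D-weights j st (p (j ℕ.+ length st) (length st))
      D-scan p j k st eq     (a ∷ w) = D-sum
        (D-scan p j (suc k) (_ ∷ st) (≡.cong suc (≡.trans (ℕₚ.+-suc j (length st)) eq)) w)
        (D-scanOld p j k st eq a w)

      D-scanOld : ∀ {ω ω̂} → (∀ i l → D (t^ i * ω (suc i) l) ≈ t^ i * ω̂ (suc i) l) →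
        ∀ j k st → suc (j ℕ.+ length st) ≡ k → ∀ a w → D (t^ j * scanOld ω k st a w) ≈ t^ j * scanOld ω̂ k st a w
      D-scanOld p j k []       eq a w = trans (D-cong (zeroʳ _)) (trans D-0 (sym (zeroʳ _)))
      D-scanOld p j k (e@(_ , N , u) ∷ st) eq a w = D-sum (D-scan p j k (_ ∷ st) eq w) (begin
        D (t^ j * (rc N * (t * h u) * scanOld _ k st a w))     ≈⟨ D-cong (rearrange _) ⟩
        D (rc N * (h u * (t^ suc j * scanOld _ k st a w)))     ≈⟨ trans (constant (Drc N) _) (*-congˡ (constant (Dh u) _)) ⟩
        rc N * (h u * D (t^ suc j * scanOld _ k st a w))
          ≈⟨ *-congˡ (*-congˡ (D-scanOld p (suc j) k st (≡.trans (≡.cong suc (≡.sym (ℕₚ.+-suc j (length st)))) eq) a w)) ⟩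
        rc N * (h u * (t^ suc j * scanOld _ k st a w))         ≈⟨ rearrange _ ⟨
        t^ j * (rc N * (t * h u) * scanOld _ k st a w)         ∎)
        where
        rearrange : ∀ y → t^ j * (rc N * (t * h u) * y) ≈ rc N * (h u * (t^ suc j * y))
        rearrange y = solve 5 (λ p r t h y → p :* (r :* (t :* h) :* y) := r :* (h :* (t :* p :* y))) refl (t^ j) (rc N) t (h u) y

      D-sum : ∀ {i y y′ ŷ ŷ′} → D (i * y) ≈ i * ŷ → D (i * y′) ≈ i * ŷ′ → D (i * (y + y′)) ≈ i * (ŷ + ŷ′)
      D-sum p q = trans (D-cong (distribˡ _ _ _)) (trans (D-+ _ _) (trans (+-cong p q) (sym (distribˡ _ _ _))))

    D-split : ∀ {j K K̂} w → (∀ v a z → length z ℕ.< length w → D (t^ j * K v a z) ≈ t^ j * K̂ v a z) →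
      D (t^ j * split K w) ≈ t^ j * split K̂ w
    D-split {j} []      p = trans (D-cong (zeroʳ _)) (trans D-0 (sym (zeroʳ _)))
    D-split {j} (a ∷ w) p = D-sum (p [] a w ℕₚ.≤-refl) (D-split {j} w (λ v b z l → p (a ∷ v) b z (ℕₚ.m≤n⇒m≤1+n l)))

    -- The factor `t^ j` restores the times of the `j` blocks already closed inside the hull of
    -- block 0. The gaps met later raise this power in step with the hull count, so at the end `D`
    -- meets the divided power of block 0 and removes that block's `t` alone. The last letter is in
    -- block 0, so no gap follows it, hence `κ`.
    D-irreducible : ∀ n j u w → length w ℕ.≤ n →
      D (t^ j * scan irreducible (suc j) ((0 , suc j , u) ∷ []) w) ≈ t^ j * κ M (λ v → h (u ++ v)) w
    D-irreducible n j u w l = begin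
      D (t^ j * scan irreducible (suc j) ((0 , suc j , u) ∷ []) w)
        ≈⟨ D-cong (*-congˡ (first-return irreducible (suc j) [] (0 , suc j , u) w)) ⟩
      D (t^ j * (rc (suc j) * (t * h u) * scan (λ k l → irreducible k (suc l)) (suc j) [] w
        + split (λ v a z → scan (λ k _ → scan irreducible k ((0 , k , u ∷ʳ a) ∷ []) z) (suc j) [] v) w))
        ≈⟨ D-sum (trans (D-cong (*-congˡ (*-congˡ (scan-ε (suc j) w)))) (leading w)) (D-split {j} w (step n l)) ⟩
      t^ j * (ε w * h (u ++ []) + split (λ v a z → M v * κ M (λ y → h (u ++ a ∷ y)) z) w)
        ≈⟨ *-congˡ (κ-split M (λ v → h (u ++ v)) w) ⟨
      t^ j * κ M (λ v → h (u ++ v)) w ∎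
      where
      leading : ∀ w → D (t^ j * (rc (suc j) * (t * h u) * ε w)) ≈ t^ j * (ε w * h (u ++ []))
      leading [] = begin
        D (t^ j * (rc (suc j) * (t * h u) * 1#))
          ≈⟨ D-cong (solve 4 (λ p r t h → p :* (r :* (t :* h) :* con 1) := h :* (r :* (t :* p))) refl (t^ j) (rc (suc j)) t (h u)) ⟩
        D (h u * (rc (suc j) * t^ suc j))   ≈⟨ constant (Dh u) _ ⟩
        h u * D (rc (suc j) * t^ suc j)     ≈⟨ *-cong (reflexive (≡.cong h (≡.sym (++-identityʳ u)))) (D-divided-power j) ⟩
        h (u ++ []) * t^ j                  ≈⟨ trans (*-comm _ _) (*-congˡ (sym (*-identityˡ _))) ⟩
        t^ j * (1# * h (u ++ []))           ∎
      leading (a ∷ w) = trans (D-cong (trans (*-congˡ (zeroʳ _)) (zeroʳ _)))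
        (trans D-0 (sym (trans (*-congˡ (zeroˡ _)) (zeroʳ _))))
      step : ∀ n → length w ℕ.≤ n → ∀ v a z → length z ℕ.< length w →
        D (t^ j * scan (λ k _ → scan irreducible k ((0 , k , u ∷ʳ a) ∷ []) z) (suc j) [] v)
          ≈ t^ j * (M v * κ M (λ y → h (u ++ a ∷ y)) z)
      step zero    l v a z l′ with () ← ℕₚ.≤-trans l′ l
      step (suc n) l v a z l′ = begin
        D (t^ j * scan (λ k _ → scan irreducible k ((0 , k , u ∷ʳ a) ∷ []) z) (suc j) [] v)
          -- The induction hypothesis for every block count `i` is the condition on the final weight
          -- in `D-scan`. The derived weight no longer depends on the count, so `scan-constant`
          -- yields the factor `M`.
          ≈⟨ D-scan (λ i _ → D-irreducible n i (u ∷ʳ a) z (ℕₚ.≤-pred (ℕₚ.≤-trans l′ l))) j (suc j) [] (≡.cong suc (ℕₚ.+-identityʳ j)) v ⟩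
        t^ j * scan (λ _ _ → κ M (λ y → h ((u ∷ʳ a) ++ y)) z) (suc j) [] v
          ≈⟨ *-congˡ (trans (scan-constant _ (suc j) v) (*-comm _ _)) ⟩
        t^ j * (M v * κ M (λ y → h ((u ∷ʳ a) ++ y)) z)
          ≈⟨ *-congˡ (*-congˡ (κ-cong M (λ y → reflexive (≡.cong h (++-assoc u (a ∷ []) y))) z)) ⟩
        t^ j * (M v * κ M (λ y → h (u ++ a ∷ y)) z) ∎

    D-B : ∀ a w → D (B (a ∷ w)) ≈ κ M (∂ a h) w
    D-B a w = begin
      D (scan irreducible 1 ((0 , 1 , a ∷ []) ∷ []) w + 0#)   ≈⟨ D-cong (trans (+-identityʳ _) (sym (*-identityˡ _))) ⟩
      D (1# * scan irreducible 1 ((0 , 1 , a ∷ []) ∷ []) w)   ≈⟨ D-irreducible (length w) 0 (a ∷ []) w ℕₚ.≤-refl ⟩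
      1# * κ M (∂ a h) w                                      ≈⟨ *-identityˡ _ ⟩
      κ M (∂ a h) w                                           ∎

    B-[] : B [] ≈ 0#
    B-[] = zeroˡ _

    D-⋆ : ∀ f g w → D ((f ⋆ g) w) ≈ ((λ v → D (f v)) ⋆ g) w + (f ⋆ (λ v → D (g v))) w
    D-⋆ f g []      = trans (D-* _ _) (+-comm _ _)
    D-⋆ f g (a ∷ w) = begin
      D (f [] * g (a ∷ w) + (∂ a f ⋆ g) w)  ≈⟨ D-+ _ _ ⟩
      D (f [] * g (a ∷ w)) + D ((∂ a f ⋆ g) w)  ≈⟨ +-cong (D-* _ _) (D-⋆ (∂ a f) g w) ⟩
      f [] * D (g (a ∷ w)) + D (f []) * g (a ∷ w) + (((λ v → D (∂ a f v)) ⋆ g) w + (∂ a f ⋆ (λ v → D (g v))) w)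
        ≈⟨ solve 4 (λ p q r s → p :+ q :+ (r :+ s) := q :+ r :+ (p :+ s)) refl _ _ _ _ ⟩
      D (f []) * g (a ∷ w) + ((λ v → D (∂ a f v)) ⋆ g) w + (f [] * D (g (a ∷ w)) + (∂ a f ⋆ (λ v → D (g v))) w) ∎

    -- Differentiating M = 1 + B M gives X = (D B) M + B X for X = D M. As (D B) M is
    -- `σ M (reduced h)`, multiplying M = 1 + B M by it on the right shows that the composition
    -- solves the same equation.
    D-M : ∀ w → D (M w) ≈ compose M (reduced h) w
    D-M = ⋆-fixpoint-unique B-[] lhs rhs
      where
      DB⋆M : (λ v → D (B v)) ⋆ M ≋ σ M (reduced h)
      DB⋆M []      = trans (*-congʳ (trans (D-cong B-[]) D-0)) (zeroˡ _)
      DB⋆M (a ∷ w) = begin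
        D (B []) * M (a ∷ w) + ((λ v → D (B (a ∷ v))) ⋆ M) w  ≈⟨ +-cong (trans (*-congʳ (trans (D-cong B-[]) D-0)) (zeroˡ _)) (⋆-cong (D-B a) (λ _ → refl) w) ⟩
        0# + (κ M (∂ a h) ⋆ M) w                              ≈⟨ +-identityˡ _ ⟩
        (κ M (∂ a h) ⋆ M) w                                   ≈⟨ κ-⋆ M (∂ a h) w ⟨
        compose M (∂ a h) w                                         ∎
      Dε : ∀ w → D (ε w) ≈ 0#
      Dε []      = D-1
      Dε (_ ∷ _) = D-0
      lhs : (λ v → D (M v)) ≋ (λ v → D (B v)) ⋆ M ⊕ B ⋆ (λ v → D (M v))
      lhs w = begin
        D (M w)                     ≈⟨ D-cong (boolean-equation w) ⟩
        D (ε w + (B ⋆ M) w)         ≈⟨ D-+ _ _ ⟩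
        D (ε w) + D ((B ⋆ M) w)     ≈⟨ trans (+-congʳ (Dε w)) (+-identityˡ _) ⟩
        D ((B ⋆ M) w)               ≈⟨ D-⋆ B M w ⟩
        ((λ v → D (B v)) ⋆ M) w + (B ⋆ (λ v → D (M v))) w ∎
      rhs : compose M (reduced h) ≋ (λ v → D (B v)) ⋆ M ⊕ B ⋆ compose M (reduced h)
      rhs w = begin
        compose M (reduced h) w                                ≈⟨ mix≋⋆σ M M (reduced h) w ⟩
        (M ⋆ s) w                                        ≈⟨ ⋆-cong boolean-equation (λ _ → refl) w ⟩
        ((ε ⊕ B ⋆ M) ⋆ s) w                              ≈⟨ ⋆-addˡ ε (B ⋆ M) s w ⟩
        (ε ⋆ s) w + ((B ⋆ M) ⋆ s) w                      ≈⟨ +-cong (trans (⋆-identityˡ s w) (sym (DB⋆M w))) (⋆-assoc B M s w) ⟩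
        ((λ v → D (B v)) ⋆ M) w + (B ⋆ (M ⋆ s)) w        ≈⟨ +-congˡ (⋆-cong (λ _ → refl) (mix≋⋆σ M M (reduced h)) w) ⟨
        ((λ v → D (B v)) ⋆ M) w + (B ⋆ compose M (reduced h)) w ∎
        where s = σ M (reduced h)

    z-weight : ∀ N u → z (rc N * (t * h u)) ≈ 0#
    z-weight N u = trans (z-* _ _) (trans (*-congˡ (trans (z-* _ _) (trans (*-congʳ zt) (zeroˡ _)))) (zeroʳ _))

    mutual
      z-scan : ∀ ω k e st w → z (scan ω k (e ∷ st) w) ≈ 0#
      z-scan ω k (_ , N , u) st [] = trans (z-* _ _) (trans (*-congˡ (trans (z-* _ _) (trans (*-congʳ (z-weight N u)) (zeroˡ _)))) (zeroʳ _))
      z-scan ω k e st (a ∷ w) = trans (z-+ _ _) (trans (+-cong (z-scan ω _ _ _ w) (z-scanOld ω k (e ∷ st) a w)) (+-identityˡ _))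

      z-scanOld : ∀ ω k st a w → z (scanOld ω k st a w) ≈ 0#
      z-scanOld ω k [] a w = z-0
      z-scanOld ω k (e@(_ , N , u) ∷ st) a w = trans (z-+ _ _)
        (trans (+-cong (z-scan ω _ _ _ w) (trans (z-* _ _) (trans (*-congʳ (z-weight N u)) (zeroˡ _)))) (+-identityˡ _))

    -- Every block weight contains `t`, so at time 0 only the partition of the empty word survives.
    z-M : ∀ w → z (M w) ≈ ε w
    z-M []      = trans (z-cong (*-identityˡ 1#)) z-1
    z-M (a ∷ w) = trans (z-+ _ _) (trans (+-cong (z-scan unweighted 1 _ [] w) z-0) (+-identityˡ _))

-- Formal time: power series in t and their values at t = 1.

-- Power series in one variable are series over a one-letter alphabet.
module PowerSeries {c ℓ} (S : CommutativeRing c ℓ) where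
  open CommutativeRing S
  open Series S ⊤
  open import Algebra.Solver.Ring.NaturalCoefficients.Default commutativeSemiring
    using (solve; _:+_; _:*_; _:=_; con)
  open import Relation.Binary.Reasoning.Setoid setoid

  ∂-⋆ʳ : ∀ f g w → (f ⋆ g) (tt ∷ w) ≈ f (tt ∷ w) * g [] + (f ⋆ ∂ tt g) w
  ∂-⋆ʳ f g []       = +-comm _ _
  ∂-⋆ʳ f g (tt ∷ w) = trans (+-congˡ (∂-⋆ʳ (∂ tt f) g w))
    (solve 3 (λ x y z → x :+ (y :+ z) := y :+ (x :+ z)) refl _ _ _)

  ⋆-comm : ∀ f g → f ⋆ g ≋ g ⋆ f
  ⋆-comm f g []       = *-comm _ _
  ⋆-comm f g (tt ∷ w) = trans (+-cong (*-comm _ _) (⋆-comm (∂ tt f) g w)) (sym (∂-⋆ʳ g f w))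

  ⋆-addʳ : ∀ f g g′ → f ⋆ (g ⊕ g′) ≋ f ⋆ g ⊕ f ⋆ g′
  ⋆-addʳ f g g′ w = trans (⋆-comm f _ w) (trans (⋆-addˡ g g′ f w) (+-cong (⋆-comm g f w) (⋆-comm g′ f w)))

  powerSeries : CommutativeRing c ℓ
  powerSeries = record
    { Carrier = Ser ; _≈_ = _≋_ ; _+_ = _⊕_ ; _*_ = _⋆_ ; -_ = ⊖_ ; 0# = λ _ → 0# ; 1# = ε
    ; isCommutativeRing = record
      { isRing = record
        { +-isAbelianGroup = record
          { isGroup = record
            { isMonoid = record
              { isSemigroup = record
                { isMagma = record
                  { isEquivalence = record
                    { refl = λ _ → refl ; sym = λ p w → sym (p w) ; trans = λ p q w → trans (p w) (q w) }
                  ; ∙-cong = λ p q w → +-cong (p w) (q w) }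
                ; assoc = λ _ _ _ _ → +-assoc _ _ _ }
              ; identity = (λ _ _ → +-identityˡ _) , (λ _ _ → +-identityʳ _) }
            ; inverse = (λ _ _ → -‿inverseˡ _) , (λ _ _ → -‿inverseʳ _)
            ; ⁻¹-cong = λ p w → -‿cong (p w) }
          ; comm = λ _ _ _ → +-comm _ _ }
        ; *-cong = ⋆-cong
        ; *-assoc = ⋆-assoc
        ; *-identity = ⋆-identityˡ , ⋆-identityʳ
        ; distrib = ⋆-addʳ , λ f g g′ → ⋆-addˡ g g′ f }
      ; *-comm = ⋆-comm } }

  constantTerm derivative : Ser → Ser
  constantTerm f []      = f []
  constantTerm f (_ ∷ _) = 0#
  derivative f w = fromℕ S (suc (length w)) * f (tt ∷ w)

  const : Carrier → Ser
  const y []      = y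
  const y (_ ∷ _) = 0#

  t : Ser
  t []      = 0#
  t (_ ∷ w) = ε w

  const-⋆ : ∀ y f w → (const y ⋆ f) w ≈ y * f w
  const-⋆ y f []      = refl
  const-⋆ y f (_ ∷ w) = trans (+-congˡ (⋆-zeroˡ f (λ _ → refl) w)) (+-identityʳ _)

  t-⋆ : ∀ f w → (t ⋆ f) (tt ∷ w) ≈ f w
  t-⋆ f w = trans (+-cong (zeroˡ _) (⋆-identityˡ f w)) (+-identityˡ _)

  constantTerm-⋆ : ∀ f g → constantTerm (f ⋆ g) ≋ constantTerm f ⋆ constantTerm g
  constantTerm-⋆ f g []      = refl
  constantTerm-⋆ f g (_ ∷ w) = sym (trans (+-cong (zeroʳ _) (⋆-zeroˡ _ (λ _ → refl) w)) (+-identityˡ 0#))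

  fromℕ-+ : ∀ m n → fromℕ S (m ℕ.+ n) ≈ fromℕ S m + fromℕ S n
  fromℕ-+ zero    n = sym (+-identityˡ _)
  fromℕ-+ (suc m) n = trans (+-congˡ (fromℕ-+ m n)) (sym (+-assoc _ _ _))

  -- The operator k + t d/dt.
  euler : ℕ → Ser → Ser
  euler k f w = fromℕ S (k ℕ.+ length w) * f w

  -- Taking a letter off `f` lowers its degree by one, which the offset `j` compensates, so the
  -- induction needs all offsets. `derivative` is `euler 0` followed by `∂ tt`.
  euler-⋆ : ∀ j k f g → euler (j ℕ.+ k) (f ⋆ g) ≋ euler j f ⋆ g ⊕ f ⋆ euler k g
  euler-⋆ j k f g [] = begin
    fromℕ S (j ℕ.+ k ℕ.+ 0) * (f [] * g [])
      ≈⟨ *-congʳ (trans (reflexive (≡.cong (fromℕ S) (≡.trans (ℕₚ.+-assoc j k 0) (≡.cong (ℕ._+ (k ℕ.+ 0)) (≡.sym (ℕₚ.+-identityʳ j)))))) (fromℕ-+ (j ℕ.+ 0) (k ℕ.+ 0))) ⟩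
    (fromℕ S (j ℕ.+ 0) + fromℕ S (k ℕ.+ 0)) * (f [] * g [])
      ≈⟨ solve 4 (λ i k f g → (i :+ k) :* (f :* g) := i :* f :* g :+ f :* (k :* g)) refl _ _ _ _ ⟩
    fromℕ S (j ℕ.+ 0) * f [] * g [] + f [] * (fromℕ S (k ℕ.+ 0) * g []) ∎
  euler-⋆ j k f g (tt ∷ w) = begin
    fromℕ S (j ℕ.+ k ℕ.+ suc (length w)) * (f [] * g (tt ∷ w) + (∂ tt f ⋆ g) w)
      ≈⟨ distribˡ _ _ _ ⟩
    fromℕ S (j ℕ.+ k ℕ.+ suc (length w)) * (f [] * g (tt ∷ w)) + fromℕ S (j ℕ.+ k ℕ.+ suc (length w)) * (∂ tt f ⋆ g) w
      ≈⟨ +-cong (*-congʳ (trans (reflexive (≡.cong (fromℕ S) (ℕₚ.+-assoc j k _))) (fromℕ-+ j _)))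
                (trans (*-congʳ (reflexive (≡.cong (fromℕ S) (ℕₚ.+-suc (j ℕ.+ k) (length w))))) (euler-⋆ (suc j) k (∂ tt f) g w)) ⟩
    (fromℕ S j + fromℕ S (k ℕ.+ suc (length w))) * (f [] * g (tt ∷ w)) + ((euler (suc j) (∂ tt f) ⋆ g) w + (∂ tt f ⋆ euler k g) w)
      ≈⟨ solve 6 (λ i k f g x y → (i :+ k) :* (f :* g) :+ (x :+ y) := i :* f :* g :+ x :+ (f :* (k :* g) :+ y)) refl _ _ _ _ _ _ ⟩
    fromℕ S j * f [] * g (tt ∷ w) + (euler (suc j) (∂ tt f) ⋆ g) w + (f [] * euler k g (tt ∷ w) + (∂ tt f ⋆ euler k g) w)
      ≈⟨ +-congʳ (+-cong (*-congʳ (*-congʳ (reflexive (≡.cong (fromℕ S) (≡.sym (ℕₚ.+-identityʳ j))))))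
           (⋆-cong (λ v → *-congʳ (reflexive (≡.cong (fromℕ S) (≡.sym (ℕₚ.+-suc j (length v)))))) (λ _ → refl) w)) ⟩
    (euler j f ⋆ g) (tt ∷ w) + (f ⋆ euler k g) (tt ∷ w) ∎

  derivative-⋆ : ∀ f g → derivative (f ⋆ g) ≋ f ⋆ derivative g ⊕ derivative f ⋆ g
  derivative-⋆ f g w = begin
    euler 0 (f ⋆ g) (tt ∷ w)
      ≈⟨ euler-⋆ 0 0 f g (tt ∷ w) ⟩
    0# * f [] * g (tt ∷ w) + (derivative f ⋆ g) w + (f ⋆ euler 0 g) (tt ∷ w)
      ≈⟨ +-congˡ (∂-⋆ʳ f (euler 0 g) w) ⟩
    0# * f [] * g (tt ∷ w) + (derivative f ⋆ g) w + (f (tt ∷ w) * (0# * g []) + (f ⋆ derivative g) w)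
      ≈⟨ solve 6 (λ f g p f′ g′ q → con 0 :* f :* g :+ p :+ (f′ :* (con 0 :* g′) :+ q) := q :+ p) refl _ _ _ _ _ _ ⟩
    (f ⋆ derivative g) w + (derivative f ⋆ g) w ∎

  derivative-constant : ∀ y → derivative (const y) ≋ λ _ → 0#
  derivative-constant y w = zeroʳ _

  module _ (recip : ℕ → Carrier) (recip-inverse : ∀ n → fromℕ S (suc n) * recip (suc n) ≈ 1#) where

    cancel-fromℕ : ∀ n {p q} → fromℕ S (suc n) * p ≈ fromℕ S (suc n) * q → p ≈ q
    cancel-fromℕ n {p} {q} e = trans (sym (undo p)) (trans (*-congˡ e) (undo q))
      where
      undo : ∀ p → recip (suc n) * (fromℕ S (suc n) * p) ≈ p
      undo p = trans (solve 3 (λ r n p → r :* (n :* p) := n :* r :* p) refl _ _ _) (trans (*-congʳ (recip-inverse n)) (*-identityˡ p))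

    differential : Differential powerSeries
    differential = record
      { D = derivative ; z = constantTerm
      ; D-cong = λ p w → *-congˡ (p (tt ∷ w))
      ; D-+ = λ _ _ _ → distribˡ _ _ _
      ; D-* = derivative-⋆
      ; D-0 = λ _ → zeroʳ _
      ; D-1 = λ _ → zeroʳ _
      ; z-cong = z-cong
      ; z-+ = z-+
      ; z-* = constantTerm-⋆
      ; z-0 = z-0
      ; z-1 = z-1
      ; integrate = integrate }
      where
      z-cong : ∀ {p q} → p ≋ q → constantTerm p ≋ constantTerm q
      z-cong p []      = p []
      z-cong p (_ ∷ _) = refl
      z-+ : ∀ p q → constantTerm (p ⊕ q) ≋ constantTerm p ⊕ constantTerm q
      z-+ p q []      = refl
      z-+ p q (_ ∷ _) = sym (+-identityˡ _)
      z-0 : constantTerm (λ _ → 0#) ≋ λ _ → 0#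
      z-0 []      = refl
      z-0 (_ ∷ _) = refl
      z-1 : constantTerm ε ≋ ε
      z-1 []      = refl
      z-1 (_ ∷ _) = refl
      integrate : ∀ {p q} → derivative p ≋ derivative q → constantTerm p ≋ constantTerm q → p ≋ q
      integrate e e₀ []       = e₀ []
      integrate e e₀ (tt ∷ w) = cancel-fromℕ (length w) (e w)

  -- p is a polynomial with value s at t = 1.
  data _at1≈_ (p : Ser) (s : Carrier) : Set (c Level.⊔ ℓ) where
    none : (∀ w → p w ≈ 0#) → s ≈ 0# → p at1≈ s
    more : ∀ {s′} → ∂ tt p at1≈ s′ → s ≈ p [] + s′ → p at1≈ s

  at1-cong : ∀ {p q s s′} → p ≋ q → s ≈ s′ → p at1≈ s → q at1≈ s′
  at1-cong e e′ (none z y) = none (λ w → trans (sym (e w)) (z w)) (trans (sym e′) y)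
  at1-cong e e′ (more r y) = more (at1-cong (λ w → e (tt ∷ w)) refl r) (trans (sym e′) (trans y (+-congʳ (e []))))

  -- Two derivations may stop at different degrees; the excess coefficients of the longer one are
  -- zero.
  at1-unique : ∀ {p s s′} → p at1≈ s → p at1≈ s′ → s ≈ s′
  at1-unique (none z y) r = sym (trans (zero-value z r) (sym y))
    where
    zero-value : ∀ {p s} → (∀ w → p w ≈ 0#) → p at1≈ s → s ≈ 0#
    zero-value z (none _ y) = y
    zero-value z (more r y) = trans y (trans (+-cong (z []) (zero-value (λ w → z (tt ∷ w)) r)) (+-identityˡ 0#))
  at1-unique (more r y) (none z y′) = trans y (trans (+-cong (z []) (at1-unique r (none (λ w → z (tt ∷ w)) refl))) (trans (+-identityˡ 0#) (sym y′)))
  at1-unique (more r y) (more r′ y′) = trans y (trans (+-congˡ (at1-unique r r′)) (sym y′))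

  at1-+ : ∀ {p q s s′} → p at1≈ s → q at1≈ s′ → (p ⊕ q) at1≈ (s + s′)
  at1-+ (none z y) r = at1-cong (λ w → sym (trans (+-congʳ (z w)) (+-identityˡ _))) (sym (trans (+-congʳ y) (+-identityˡ _))) r
  at1-+ r@(more _ _) (none z y) = at1-cong (λ w → sym (trans (+-congˡ (z w)) (+-identityʳ _))) (sym (trans (+-congˡ y) (+-identityʳ _))) r
  at1-+ (more r y) (more r′ y′) = more (at1-+ r r′)
    (trans (+-cong y y′) (solve 4 (λ a b c d → a :+ b :+ (c :+ d) := a :+ c :+ (b :+ d)) refl _ _ _ _))

  at1-scale : ∀ y {p s} → p at1≈ s → (λ w → y * p w) at1≈ (y * s)
  at1-scale y (none z e) = none (λ w → trans (*-congˡ (z w)) (zeroʳ y)) (trans (*-congˡ e) (zeroʳ y))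
  at1-scale y (more r e) = more (at1-scale y r) (trans (*-congˡ e) (distribˡ y _ _))

  at1-shift : ∀ {p s} → p [] ≈ 0# → ∂ tt p at1≈ s → p at1≈ s
  at1-shift z r = more r (sym (trans (+-congʳ z) (+-identityˡ _)))

  -- Write p = p [] + t · ∂ p; multiplication by t does not change the value at 1.
  at1-⋆ : ∀ {p q s s′} → p at1≈ s → q at1≈ s′ → (p ⋆ q) at1≈ (s * s′)
  at1-⋆ (none z e) r = none (⋆-zeroˡ _ z) (trans (*-congʳ e) (zeroˡ _))
  at1-⋆ {p} {q} (more {s₁} r e) r′ = at1-cong regroup (sym (trans (*-congʳ e) (distribʳ _ _ _)))
    (at1-+ (at1-scale (p []) r′) (at1-shift {p = t ⋆ (∂ tt p ⋆ q)} (zeroˡ _) (at1-cong (λ w → sym (t-⋆ (∂ tt p ⋆ q) w)) refl (at1-⋆ r r′))))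
    where
    regroup : (λ w → p [] * q w + (t ⋆ (∂ tt p ⋆ q)) w) ≋ p ⋆ q
    regroup []       = trans (+-congˡ (zeroˡ _)) (+-identityʳ _)
    regroup (tt ∷ w) = +-congˡ (t-⋆ (∂ tt p ⋆ q) w)

  at1-0 : (λ _ → 0#) at1≈ 0#
  at1-0 = none (λ _ → refl) refl

  at1-const : ∀ y → const y at1≈ y
  at1-const y = more at1-0 (sym (+-identityʳ y))

  at1-ε : ε at1≈ 1#
  at1-ε = more at1-0 (sym (+-identityʳ 1#))

  at1-t : t at1≈ 1#
  at1-t = at1-shift refl at1-ε

-- Evaluation at t = 1 of substitutions and scans.

module Evaluation {c ℓ} (S : CommutativeRing c ℓ) {x} (X : Set x) where
  open CommutativeRing S
  open PowerSeries S
  private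
    module P = Series powerSeries X
    module Q = Series S X

  at1-mix : ∀ {H G f H′ G′ f′} → (∀ v → H v at1≈ H′ v) → (∀ v → G v at1≈ G′ v) → (∀ v → f v at1≈ f′ v) →
    ∀ w → P.mix H G f w at1≈ Q.mix H′ G′ f′ w
  at1-mix p q r []      = at1-⋆ (p []) (r [])
  at1-mix p q r (a ∷ w) = at1-+ (at1-⋆ (p []) (at1-mix q q (λ v → r (a ∷ v)) w)) (at1-mix (λ v → p (a ∷ v)) q r w)

  at1-series-ε : ∀ w → P.ε w at1≈ Q.ε w
  at1-series-ε []      = at1-ε
  at1-series-ε (_ ∷ _) = at1-0

  module _ {g : ℕ → List X → List ⊤ → Carrier} {g′ : ℕ → List X → Carrier} (at1-g : ∀ N u → g N u at1≈ g′ N u) where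
    private
      module AP = Automaton powerSeries {X = X} g
      module AQ = Automaton S {X = X} g′

    at1-weights : ∀ st → AP.weights st at1≈ AQ.weights st
    at1-weights []                = at1-ε
    at1-weights ((_ , N , u) ∷ st) = at1-⋆ (at1-g N u) (at1-weights st)

    mutual
      at1-scan : ∀ {ω ω′} → (∀ k l → ω k l at1≈ ω′ k l) → ∀ k st w → AP.scan ω k st w at1≈ AQ.scan ω′ k st w
      at1-scan p k st []      = at1-⋆ (p _ _) (at1-weights st)
      at1-scan p k st (a ∷ w) = at1-+ (at1-scan p _ _ w) (at1-scanOld p k st a w)

      at1-scanOld : ∀ {ω ω′} → (∀ k l → ω k l at1≈ ω′ k l) → ∀ k st a w → AP.scanOld ω k st a w at1≈ AQ.scanOld ω′ k st a w
      at1-scanOld p k []                    a w = at1-0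
      at1-scanOld p k (e@(_ , N , u) ∷ st) a w = at1-+ (at1-scan p _ _ w) (at1-⋆ (at1-g N u) (at1-scanOld p k st a w))

    at1-M : ∀ w → AP.M w at1≈ AQ.M w
    at1-M = at1-scan (λ _ _ → at1-ε) 0 []

-- Inverse of the monotone exponential.

module MonotoneInverse {c ℓ} (S : CommutativeRing c ℓ) {x} {X : Set x} (h : List X → CommutativeRing.Carrier S)
  (recip : ℕ → CommutativeRing.Carrier S) where
  open CommutativeRing S
  open PowerSeries S
  open Series S X
  open import Algebra.Properties.Ring ring using (-0#≈0#; -‿distribʳ-*; -‿+-comm)
  private
    module P = Series powerSeries X
    module PS = CommutativeRing powerSeries

  module _ (recip-inverse : ∀ n → fromℕ S (suc n) * recip (suc n) ≈ 1#) where
    private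
      𝒟 = differential recip recip-inverse
      c-recip : ℕ → PS.Carrier
      c-recip N = const (recip N)
      module Lift (k : List X → Carrier) where
        k̂ : List X → PS.Carrier
        k̂ u = const (k u)
        open Monotone powerSeries 𝒟 t c-recip k̂ public using (D-M; z-M)
        open Automaton powerSeries {X = X} (λ N u → c-recip N PS.* (t PS.* k̂ u)) public using (M)

    fromℕ-const : ∀ n → fromℕ powerSeries n PS.≈ const (fromℕ S n)
    fromℕ-const zero    []      = refl
    fromℕ-const zero    (_ ∷ _) = refl
    fromℕ-const (suc n) []      = +-congˡ (fromℕ-const n [])
    fromℕ-const (suc n) (a ∷ w) = trans (+-congˡ (fromℕ-const n (a ∷ w))) (+-identityˡ 0#)

    c-recip-inverse : ∀ n → fromℕ powerSeries (suc n) PS.* c-recip (suc n) PS.≈ PS.1#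
    c-recip-inverse n w = trans (PS.*-congʳ {c-recip (suc n)} (fromℕ-const (suc n)) w)
      (trans (const-⋆ (fromℕ S (suc n)) (c-recip (suc n)) w) (value w))
      where
      value : ∀ w → fromℕ S (suc n) * c-recip (suc n) w ≈ PS.1# w
      value []      = recip-inverse n
      value (_ ∷ _) = zeroʳ _

    D-t : derivative t PS.≈ PS.1#
    D-t []      = trans (*-identityʳ _) (+-identityʳ 1#)
    D-t (_ ∷ _) = zeroʳ _

    z-t : constantTerm t PS.≈ PS.0#
    z-t []      = refl
    z-t (_ ∷ _) = refl

    private
      module H = Lift h
      module K = Lift (λ u → - h u)
      module AH = Automaton S {X = X} (λ N u → recip N * h u)
      module AK = Automaton S {X = X} (λ N u → recip N * - h u)

      -- The value of `h` on the empty word is arbitrary, as no block is empty, while a flow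
      -- requires a generator without constant term.
      ĥ : P.Ser
      ĥ = P.reduced H.k̂

      Dĥ : ∀ w → derivative (ĥ w) PS.≈ PS.0#
      Dĥ []      _ = zeroʳ _
      Dĥ (_ ∷ _) _ = zeroʳ _

      zĥ : ∀ w → constantTerm (ĥ w) PS.≈ ĥ w
      zĥ []      []      = refl
      zĥ []      (_ ∷ _) = refl
      zĥ (_ ∷ _) []      = refl
      zĥ (_ ∷ _) (_ ∷ _) = refl

      D-H : ∀ w → derivative (H.M w) PS.≈ P.compose H.M ĥ w
      D-H = H.D-M D-t z-t (λ N → derivative-constant (recip N)) c-recip-inverse (λ w → derivative-constant (h w))

      D-K : ∀ w → derivative (K.M w) PS.≈ PS.- P.compose K.M ĥ w
      D-K w = PS.trans (K.D-M D-t z-t (λ N → derivative-constant (recip N)) c-recip-inverse (λ w → derivative-constant (- h w)) w)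
        (PS.trans (P.mix-cong {K.M} {K.M} {K.M} {K.M} (λ _ → PS.refl) (λ _ → PS.refl) negated w)
          (PS.sym (Naturality.mix-natural powerSeries powerSeries X PS.-_ neg-+ neg-* neg-* ĥ w)))
        where
        negated : P.reduced K.k̂ P.≋ λ v → PS.- ĥ v
        negated []      _       = sym -0#≈0#
        negated (_ ∷ _) []      = refl
        negated (_ ∷ _) (_ ∷ _) = sym -0#≈0#
        neg-+ : ∀ p q → PS.- (p PS.+ q) PS.≈ (PS.- p) PS.+ (PS.- q)
        neg-+ p q w = sym (-‿+-comm (p w) (q w))
        neg-* : ∀ v p → PS.- (K.M v PS.* p) PS.≈ K.M v PS.* (PS.- p)
        neg-* v p = -‿distribʳ-*ᴾ (K.M v) p
          where open import Algebra.Properties.Ring PS.ring using () renaming (-‿distribʳ-* to -‿distribʳ-*ᴾ)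

      inverse-series : P.compose K.M H.M P.≋ P.ε
      inverse-series = Flow.flow-inverse powerSeries 𝒟 X ĥ H.M K.M PS.refl Dĥ zĥ D-H D-K
        (H.z-M D-t z-t (λ N → derivative-constant (recip N)) c-recip-inverse (λ w → derivative-constant (h w)))
        (K.z-M D-t z-t (λ N → derivative-constant (recip N)) c-recip-inverse (λ w → derivative-constant (- h w)))

    open Evaluation S X

    -- The identity over power series in t has polynomials on both sides; their values at t = 1 are
    -- the two sides over `S`, and such values are unique.
    monotone-inverse : compose AK.M AH.M ≋ ε
    monotone-inverse w = at1-unique (at1-cong (inverse-series w) refl (at1-mix at1-K at1-K at1-H w)) (at1-series-ε w)
      where
      weight : ∀ y z → (const y PS.* (t PS.* const z)) at1≈ (y * z)
      weight y z = at1-cong (λ _ → refl) (*-congˡ (*-identityˡ z)) (at1-⋆ (at1-const y) (at1-⋆ at1-t (at1-const z)))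
      at1-H : ∀ v → H.M v at1≈ AH.M v
      at1-H = at1-M (λ N u → weight (recip N) (h u))
      at1-K : ∀ v → K.M v at1≈ AK.M v
      at1-K = at1-M (λ N u → weight (recip N) (- h u))

-- Combinatorics of restricted growth strings.

module Partitions where
  open import Data.Bool.ListAction using (any)
  open import Data.Bool.Properties using (T-∧; T-≡)
  open import Data.Empty using (⊥)
  open import Data.List using (applyUpTo; zip; drop)
  open import Data.List.Membership.Propositional using (find; lose)
  open import Data.List.Membership.Propositional.Properties using (∈-filter⁻; ∈-++⁻)
  open import Data.List.Properties using (filter-++; unfold-reverse; length-reverse; reverse-involutive)
  open import Data.List.Relation.Binary.Sublist.Propositional using (_⊆_; []; minimum; to∈)
  open import Data.List.Relation.Binary.Sublist.Propositional.Properties using (ʳ++⁺) renaming (reverse⁺ to ⊆-reverse⁺)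
  open import Data.List.Relation.Unary.Any.Properties using (any⁺; any⁻)
  open import Data.Nat hiding (suc; zero; _∸_; _≡ᵇ_; _≤_; _<_; z≤n; s≤s; ℕ)
  open import Data.Nat.Properties
  open import Data.Product using (∃-syntax)
  open import Function using (_$_; id)
  open import Function.Bundles using (Equivalence)
  open import Relation.Binary.Definitions using (tri<; tri≈; tri>)
  open import Relation.Binary.PropositionalEquality using (refl; sym; trans; cong; cong₂; subst; subst₂; module ≡-Reasoning)

  ∧⁻ : ∀ {x y} → T (x ∧ y) → T x × T y
  ∧⁻ = Equivalence.to T-∧

  ∧⁺ : ∀ {x y} → T x → T y → T (x ∧ y)
  ∧⁺ p q = Equivalence.from T-∧ (p , q)

  not⁻ : ∀ {b} → T (not b) → ¬ T b
  not⁻ {false} _ ()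

  not⁺ : ∀ {b} → ¬ T b → T (not b)
  not⁺ {false} _ = tt
  not⁺ {true}  p = p tt

  any-upTo⁻ : ∀ {p n} → T (any p (upTo n)) → ∃[ i ] i < n × T (p i)
  any-upTo⁻ {p} {n} h with i , i∈ , pi ← find (any⁻ p (upTo n) h) = i , ∈-upTo⁻ i∈ , pi

  any-upTo⁺ : ∀ {p n i} → i < n → T (p i) → T (any p (upTo n))
  any-upTo⁺ {p} i<n pi = any⁺ p (lose (∈-upTo⁺ i<n) pi)

  module _ {a b c : ℕ} {π : Partition} where

    crossing⁺ : ∀ {d} → a < b → b < c → c < d → d < length π → lab π a ≡ lab π c → lab π b ≡ lab π d → lab π a ≢ lab π b → T (crossing π)
    crossing⁺ {d} ab bc cd d< ac bd a≢b =
      any-upTo⁺ {i = a} (<-trans ab (<-trans bc (<-trans cd d<))) $ any-upTo⁺ {i = b} (<-trans bc (<-trans cd d<)) $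
      any-upTo⁺ {i = c} (<-trans cd d<) $ any-upTo⁺ {i = d} d< $
      ∧⁺ (<⇒<ᵇ ab) $ ∧⁺ (<⇒<ᵇ bc) $ ∧⁺ (<⇒<ᵇ cd) $ ∧⁺ (≡⇒≡ᵇ _ _ ac) $ ∧⁺ (≡⇒≡ᵇ _ _ bd) $ not⁺ (λ t → a≢b (≡ᵇ⇒≡ _ _ t))

    separated⁺ : a < b → b < c → c < length π → lab π a ≡ lab π c → lab π a ≢ lab π b → ¬ T (isInterval π)
    separated⁺ ab bc c< ac a≢b h = not⁻ h $
      any-upTo⁺ {i = a} (<-trans ab (<-trans bc c<)) $ any-upTo⁺ {i = b} (<-trans bc c<) $ any-upTo⁺ {i = c} c< $
      ∧⁺ (<⇒<ᵇ ab) $ ∧⁺ (<⇒<ᵇ bc) $ ∧⁺ (≡⇒≡ᵇ _ _ ac) $ not⁺ (λ t → a≢b (≡ᵇ⇒≡ _ _ t))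

  position-sublist : ∀ π {i j zs} → i < length π → j ≤ i → zs ⊆ drop (suc i) π → lab π i ∷ zs ⊆ drop j π
  position-sublist (x ∷ π) {zero}  {zero}  l       z≤n     s = refl ∷ s
  position-sublist (x ∷ π) {suc i} {zero}  (s≤s l) z≤n     s = skip x (position-sublist π l z≤n s)
  position-sublist (x ∷ π) {suc i} {suc j} (s≤s l) (s≤s m) s = position-sublist π l m s

  sublist-position : ∀ π j {y zs} → y ∷ zs ⊆ drop j π → ∃[ i ] j ≤ i × i < length π × lab π i ≡ y × zs ⊆ drop (suc i) π
  sublist-position (x ∷ π) zero    (refl ∷ s) = 0 , z≤n , s≤s z≤n , refl , s
  sublist-position (x ∷ π) zero    (skip _ s) with i , _ , l , e , s′ ← sublist-position π zero s = suc i , z≤n , s≤s l , e , s′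
  sublist-position (x ∷ π) (suc j) s          with i , m , l , e , s′ ← sublist-position π j s = suc i , s≤s m , s≤s l , e , s′

  -- A prefix of a restricted growth string is kept reversed, its last label first.
  NonCrossing Interval : List ℕ → Set
  NonCrossing q = ∀ {x y} → x ≢ y → ¬ (y ∷ x ∷ y ∷ x ∷ [] ⊆ q)
  Interval q = ∀ {x y} → x ≢ y → ¬ (x ∷ y ∷ x ∷ [] ⊆ q)

  -- A crossing in a prefix survives in every continuation `ρ`; this discards a whole branch of the
  -- enumeration at once.
  isNC⇒NonCrossing : ∀ q ρ → T (isNC (q ʳ++ ρ)) → NonCrossing q
  isNC⇒NonCrossing q ρ nc x≢y s
    with a , _ , _  , ea , s₁ ← sublist-position (q ʳ++ ρ) 0 (ʳ++⁺ s (minimum ρ))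
    with b , ab , _ , eb , s₂ ← sublist-position (q ʳ++ ρ) (suc a) s₁
    with c , bc , _ , ec , s₃ ← sublist-position (q ʳ++ ρ) (suc b) s₂
    with d , cd , d< , ed , _ ← sublist-position (q ʳ++ ρ) (suc c) s₃
    = not⁻ nc (crossing⁺ {π = q ʳ++ ρ} ab bc cd d< (trans ea (sym ec)) (trans eb (sym ed)) (λ e → x≢y (trans (sym ea) (trans e eb))))

  isInterval⇒Interval : ∀ q ρ → T (isInterval (q ʳ++ ρ)) → Interval q
  isInterval⇒Interval q ρ iv x≢y s
    with a , _ , _  , ea , s₁ ← sublist-position (q ʳ++ ρ) 0 (ʳ++⁺ s (minimum ρ))
    with b , ab , _ , eb , s₂ ← sublist-position (q ʳ++ ρ) (suc a) s₁
    with c , bc , c< , ec , _ ← sublist-position (q ʳ++ ρ) (suc b) s₂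
    = separated⁺ {π = q ʳ++ ρ} ab bc c< (trans ea (sym ec)) (λ e → x≢y (trans (sym ea) (trans e eb))) iv

  unreverse : ∀ {zs : List ℕ} q → zs ⊆ reverse q → reverse zs ⊆ q
  unreverse {zs} q s = subst (reverse zs ⊆_) (reverse-involutive q) (⊆-reverse⁺ s)

  NonCrossing⇒isNC : ∀ q → NonCrossing q → T (isNC (reverse q))
  NonCrossing⇒isNC q nc = not⁺ go
    where
    π = reverse q
    go : T (crossing π) → ⊥
    go h
      with a , a< , h ← any-upTo⁻ h
      with b , b< , h ← any-upTo⁻ h
      with c , c< , h ← any-upTo⁻ h
      with d , d< , h ← any-upTo⁻ h
      with ab , h ← ∧⁻ h
      with bc , h ← ∧⁻ {b <ᵇ c} h
      with cd , h ← ∧⁻ {c <ᵇ d} h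
      with ac , h ← ∧⁻ {lab π a ≡ᵇ lab π c} h
      with bd , h ← ∧⁻ {lab π b ≡ᵇ lab π d} h
      = nc (λ e → not⁻ h (≡⇒≡ᵇ _ _ e)) (unreverse q pattern-abab)
      where
      pattern-abab : lab π a ∷ lab π b ∷ lab π a ∷ lab π b ∷ [] ⊆ π
      pattern-abab = position-sublist π a< z≤n (position-sublist π b< (<ᵇ⇒< a b ab)
        (subst₂ (λ x y → x ∷ y ∷ [] ⊆ drop (suc b) π) (sym (≡ᵇ⇒≡ _ _ ac)) (sym (≡ᵇ⇒≡ _ _ bd))
          (position-sublist π c< (<ᵇ⇒< b c bc) (position-sublist π d< (<ᵇ⇒< c d cd) (minimum _)))))

  Interval⇒isInterval : ∀ q → Interval q → T (isInterval (reverse q))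
  Interval⇒isInterval q iv = not⁺ go
    where
    π = reverse q
    go : T (any _ (upTo (length π))) → ⊥
    go h
      with a , a< , h ← any-upTo⁻ h
      with b , b< , h ← any-upTo⁻ h
      with c , c< , h ← any-upTo⁻ h
      with ab , h ← ∧⁻ h
      with bc , h ← ∧⁻ {b <ᵇ c} h
      with ac , h ← ∧⁻ {lab π a ≡ᵇ lab π c} h
      = iv (λ e → not⁻ h (≡⇒≡ᵇ _ _ e)) (unreverse q pattern-aba)
      where
      pattern-aba : lab π a ∷ lab π b ∷ lab π a ∷ [] ⊆ π
      pattern-aba = position-sublist π a< z≤n (position-sublist π b< (<ᵇ⇒< a b ab)
        (subst (λ x → x ∷ [] ⊆ drop (suc b) π) (sym (≡ᵇ⇒≡ _ _ ac)) (position-sublist π c< (<ᵇ⇒< b c bc) (minimum _))))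

  data Growing : List ℕ → Set where
    []  : Growing []
    _∷_ : ∀ {c q} → (∀ {x} → x < c → x ∈ q) → Growing q → Growing (c ∷ q)

  growing-before : ∀ {q} → Growing q → ∀ {x y} → y ∈ q → x < y → y ∷ x ∷ [] ⊆ q
  growing-before (g ∷ gs) (here refl) x<y = refl ∷ from∈ (g x<y)
  growing-before (g ∷ gs) (there m)   x<y = skip _ (growing-before gs m x<y)

  growing-before₂ : ∀ {q} → Growing q → ∀ {x y z} → z ∷ y ∷ [] ⊆ q → x < y → z ∷ y ∷ x ∷ [] ⊆ q
  growing-before₂ (g ∷ gs) (refl ∷ s) x<y = refl ∷ growing-before gs (to∈ s) x<y
  growing-before₂ (g ∷ gs) (skip _ s) x<y = skip _ (growing-before₂ gs s x<y)

  ∈⇒<nBlocks : ∀ {x} q → x ∈ q → x < nBlocks q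
  ∈⇒<nBlocks (c ∷ q) (here refl) = m≤m⊔n (suc c) (nBlocks q)
  ∈⇒<nBlocks (c ∷ q) (there m)   = ≤-trans (∈⇒<nBlocks q m) (m≤n⊔m (suc c) (nBlocks q))

  nBlocks-≤ : ∀ {k} q → (∀ {x} → x ∈ q → x < k) → nBlocks q ≤ k
  nBlocks-≤ []      p = z≤n
  nBlocks-≤ (c ∷ q) p = ⊔-lub (p (here refl)) (nBlocks-≤ q (p ∘ there))

  nBlocks-unique : ∀ {k} q → (∀ {x} → x ∈ q → x < k) → (∀ {x} → x < k → x ∈ q) → nBlocks q ≡ k
  nBlocks-unique {zero}  q p o = n≤0⇒n≡0 (nBlocks-≤ q p)
  nBlocks-unique {suc k} q p o = ≤-antisym (nBlocks-≤ q p) (∈⇒<nBlocks q (o ≤-refl))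

  growing-<nBlocks : ∀ {q} → Growing q → ∀ {x} → x < nBlocks q → x ∈ q
  growing-<nBlocks {c ∷ q} (g ∷ gs) {x} l with <-cmp x c
  ... | tri< x<c _ _ = there (g x<c)
  ... | tri≈ _ refl _ = here refl
  ... | tri> _ _ c<x with ⊔-sel (suc c) (nBlocks q)
  ...   | inj₁ e = contradiction (s≤s⁻¹ (≤-trans l (≤-reflexive e))) (<⇒≱ c<x)
  ...   | inj₂ e = there (growing-<nBlocks gs (≤-trans l (≤-reflexive e)))

  -- At q i x: the label x stands at position i of reverse q.
  data At : List ℕ → ℕ → ℕ → Set where
    last    : ∀ {c q} → At (c ∷ q) (length q) c
    earlier : ∀ {c q i x} → At q i x → At (c ∷ q) i x

  At-< : ∀ {q i x} → At q i x → i < length q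
  At-< last        = ≤-refl
  At-< (earlier p) = m≤n⇒m≤1+n (At-< p)

  lab-∷ʳ-< : ∀ p {c i} → i < length p → lab (p ∷ʳ c) i ≡ lab p i
  lab-∷ʳ-< (x ∷ p) {i = zero}  l       = refl
  lab-∷ʳ-< (x ∷ p) {i = suc i} (s≤s l) = lab-∷ʳ-< p l

  lab-∷ʳ : ∀ p {c} → lab (p ∷ʳ c) (length p) ≡ c
  lab-∷ʳ []      = refl
  lab-∷ʳ (x ∷ p) = lab-∷ʳ p

  lab-last : ∀ c q → lab (reverse (c ∷ q)) (length q) ≡ c
  lab-last c q = trans (cong₂ lab (unfold-reverse c q) (sym (length-reverse q))) (lab-∷ʳ (reverse q))

  lab-earlier : ∀ c q {i} → i < length q → lab (reverse (c ∷ q)) i ≡ lab (reverse q) i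
  lab-earlier c q {i} l = trans (cong (λ π → lab π i) (unfold-reverse c q))
    (lab-∷ʳ-< (reverse q) (subst (i <_) (sym (length-reverse q)) l))

  At⇒lab : ∀ {q i x} → At q i x → lab (reverse q) i ≡ x
  At⇒lab {c ∷ q} last        = lab-last c q
  At⇒lab {c ∷ q} (earlier p) = trans (lab-earlier c q (At-< p)) (At⇒lab p)

  lab⇒At : ∀ q {i} → i < length q → At q i (lab (reverse q) i)
  lab⇒At (c ∷ q) {i} l with m<1+n⇒m<n∨m≡n l
  ... | inj₁ i<  = subst (At (c ∷ q) i) (sym (lab-earlier c q i<)) (earlier (lab⇒At q i<))
  ... | inj₂ refl = subst (At (c ∷ q) _) (sym (lab-last c q)) last

  At⇒∈ : ∀ {q i x} → At q i x → x ∈ q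
  At⇒∈ last        = here refl
  At⇒∈ (earlier p) = there (At⇒∈ p)

  ∈⇒At : ∀ {q x} → x ∈ q → ∃[ i ] At q i x
  ∈⇒At {c ∷ q} (here refl) = length q , last
  ∈⇒At (there m) with i , p ← ∈⇒At m = i , earlier p

  At-below : ∀ {q} → Growing q → ∀ {i x y} → At q i y → x < y → ∃[ i′ ] i′ < i × At q i′ x
  At-below (g ∷ gs) last        x<y with i′ , p ← ∈⇒At (g x<y) = i′ , At-< p , earlier p
  At-below (g ∷ gs) (earlier p) x<y with i′ , l , p′ ← At-below gs p x<y = i′ , l , earlier p′

  -- The number of blocks opened up to the last element of block j.
  blocksAt : List ℕ → ℕ → ℕ
  blocksAt []      j = 0
  blocksAt (c ∷ q) j = if c ≡ᵇ j then nBlocks (c ∷ q) else blocksAt q j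

  hullCount : List ℕ → ℕ → ℕ
  hullCount q j = blocksAt q j ∸ j

  ≡ᵇ-true : ∀ {m n} → (m ≡ᵇ n) ≡ true → m ≡ n
  ≡ᵇ-true {m} {n} e = ≡ᵇ⇒≡ m n (Equivalence.from T-≡ e)

  ≡ᵇ-refl : ∀ n → (n ≡ᵇ n) ≡ true
  ≡ᵇ-refl n = Equivalence.to T-≡ (≡⇒≡ᵇ n n refl)

  ≡ᵇ-false : ∀ {m n} → m ≢ n → (m ≡ᵇ n) ≡ false
  ≡ᵇ-false {m} {n} m≢n with m ≡ᵇ n in e
  ... | true  = contradiction (≡ᵇ-true e) m≢n
  ... | false = refl

  blocksAt⁻ : ∀ {q} → Growing q → ∀ {j x} → x < blocksAt q j → ∃[ i ] ∃[ i′ ] i ≤ i′ × At q i x × At q i′ j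
  blocksAt⁻ {c ∷ q} gs@(_ ∷ gs′) {j} l with c ≡ᵇ j in e
  ... | true with refl ← ≡ᵇ-true {c} e | i , p ← ∈⇒At (growing-<nBlocks gs l) = i , length q , s≤s⁻¹ (At-< p) , p , last
  ... | false with i , i′ , m , p , p′ ← blocksAt⁻ gs′ l = i , i′ , m , earlier p , earlier p′

  At-unique : ∀ {q i x y} → At q i x → At q i y → x ≡ y
  At-unique p p′ = trans (sym (At⇒lab p)) (At⇒lab p′)

  blocksAt⁺ : ∀ {q j x i i′} → i ≤ i′ → At q i x → At q i′ j → x < blocksAt q j
  blocksAt⁺ {c ∷ q} {j} m p p′ with c ≡ᵇ j in e
  ... | true = ∈⇒<nBlocks (c ∷ q) (At⇒∈ p)
  blocksAt⁺ {c ∷ q} m p           last         | false = contradiction (trans (sym e) (≡ᵇ-refl c)) λ ()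
  blocksAt⁺ {c ∷ q} m (earlier p) (earlier p′) | false = blocksAt⁺ m p p′
  blocksAt⁺ {c ∷ q} m last        (earlier p′) | false = contradiction (At-< p′) (≤⇒≯ m)

  blocksAt-≤ : ∀ {q k} j → (∀ {x} → x ∈ q → x < k) → blocksAt q j ≤ k
  blocksAt-≤ {[]}    j p = z≤n
  blocksAt-≤ {c ∷ q} j p with c ≡ᵇ j
  ... | true  = nBlocks-≤ (c ∷ q) p
  ... | false = blocksAt-≤ j (p ∘ there)

  minL-∈ : ∀ {d i} xs → i < d → minL d xs ≤ i → ∃[ y ] y ∈ xs × y ≤ i
  minL-∈ []       i<d m = contradiction m (<⇒≱ i<d)
  minL-∈ {d} (x ∷ xs) i<d m with ⊓-sel x (minL d xs)
  ... | inj₁ e = x , here refl , subst (_≤ _) e m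
  ... | inj₂ e with y , y∈ , l ← minL-∈ xs i<d (subst (_≤ _) e m) = y , there y∈ , l

  ∈-minL : ∀ {d y} xs → y ∈ xs → minL d xs ≤ y
  ∈-minL (x ∷ xs) (here refl) = m⊓n≤m x _
  ∈-minL (x ∷ xs) (there m)   = ≤-trans (m⊓n≤n x _) (∈-minL xs m)

  maxL-∈ : ∀ x xs → maxL (x ∷ xs) ∈ x ∷ xs
  maxL-∈ x []        = here (⊔-identityʳ x)
  maxL-∈ x (x′ ∷ xs) with ⊔-sel x (maxL (x′ ∷ xs))
  ... | inj₁ e = here e
  ... | inj₂ e = there (subst (_∈ x′ ∷ xs) (sym e) (maxL-∈ x′ xs))

  maxL-≥ : ∀ {i y} xs → y ∈ xs → i ≤ maxL xs → ∃[ z ] z ∈ xs × i ≤ z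
  maxL-≥ (x ∷ xs) _ m = maxL (x ∷ xs) , maxL-∈ x xs , m

  ∈-maxL : ∀ {y} xs → y ∈ xs → y ≤ maxL xs
  ∈-maxL (x ∷ xs) (here refl) = m≤m⊔n x _
  ∈-maxL (x ∷ xs) (there m)   = ≤-trans (∈-maxL xs m) (m≤n⊔m x _)

  ∈-block⁺ : ∀ π {i k} → i < length π → lab π i ≡ k → i ∈ block π k
  ∈-block⁺ π {i} {k} l e = ∈-filter⁺ (λ i → T? (lab π i ≡ᵇ k)) (∈-upTo⁺ l) (≡⇒≡ᵇ _ _ e)

  ∈-block⁻ : ∀ π {i k} → i ∈ block π k → i < length π × lab π i ≡ k
  ∈-block⁻ π {i} {k} m with m′ , e ← ∈-filter⁻ (λ i → T? (lab π i ≡ᵇ k)) {xs = positions π} m = ∈-upTo⁻ m′ , ≡ᵇ⇒≡ _ _ e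

  length-filterᵇ-∷ʳ : ∀ (p : ℕ → Bool) xs x → length (filterᵇ p (xs ∷ʳ x)) ≡ length (filterᵇ p xs) + (if p x then 1 else 0)
  length-filterᵇ-∷ʳ p xs x = trans (cong length (filter-++ (T? ∘ p) xs (x ∷ []))) (trans (length-++ (filterᵇ p xs)) (cong (length (filterᵇ p xs) +_) (single x)))
    where
    single : ∀ x → length (filterᵇ p (x ∷ [])) ≡ (if p x then 1 else 0)
    single x with p x
    ... | true  = refl
    ... | false = refl

  length-filterᵇ-interval : ∀ (p : ℕ → Bool) j K n →
    (∀ {i} → i < n → j ≤ i → i < K → T (p i)) → (∀ {i} → i < n → T (p i) → j ≤ i × i < K) →
    length (filterᵇ p (upTo n)) ≡ (n ⊓ K) ∸ j
  length-filterᵇ-interval p j K zero    p⁺ p⁻ = sym (0∸n≡0 j)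
  length-filterᵇ-interval p j K (suc n) p⁺ p⁻ = begin
    length (filterᵇ p (upTo (suc n)))                         ≡⟨ cong (λ xs → length (filterᵇ p xs)) (upTo-∷ʳ n) ⟨
    length (filterᵇ p (upTo n ∷ʳ n))                          ≡⟨ length-filterᵇ-∷ʳ p (upTo n) n ⟩
    length (filterᵇ p (upTo n)) + (if p n then 1 else 0)      ≡⟨ cong (_+ (if p n then 1 else 0)) (length-filterᵇ-interval p j K n (λ l → p⁺ (m≤n⇒m≤1+n l)) (λ l → p⁻ (m≤n⇒m≤1+n l))) ⟩
    (n ⊓ K) ∸ j + (if p n then 1 else 0)                      ≡⟨ step ⟩
    (suc n ⊓ K) ∸ j                                           ∎
    where
    open ≡-Reasoning
    step : (n ⊓ K) ∸ j + (if p n then 1 else 0) ≡ (suc n ⊓ K) ∸ j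
    step with p n in e
    ... | true with j≤n , n<K ← p⁻ ≤-refl (Equivalence.from T-≡ e)
      rewrite m≤n⇒m⊓n≡m (<⇒≤ n<K) | m≤n⇒m⊓n≡m n<K = trans (+-comm _ 1) (sym (+-∸-assoc 1 j≤n))
    ... | false with j ≤? n | n <? K
    ...   | yes j≤n | yes n<K = contradiction (trans (sym e) (Equivalence.to T-≡ (p⁺ ≤-refl j≤n n<K))) λ ()
    ...   | yes j≤n | no n≮K  rewrite m≥n⇒m⊓n≡n (≮⇒≥ n≮K) | m≥n⇒m⊓n≡n (m≤n⇒m≤1+n (≮⇒≥ n≮K)) = +-identityʳ _
    ...   | no j≰n  | _       = trans (+-identityʳ _) (trans (m≤n⇒m∸n≡0 (≤-trans (m⊓n≤m n K) (<⇒≤ (≰⇒> j≰n))))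
                                  (sym (m≤n⇒m∸n≡0 (≤-trans (m⊓n≤m (suc n) K) (≰⇒> j≰n)))))

  -- Blocks are numbered by minima, so those starting inside the hull of block `j` are the labels
  -- from `j` up to `blocksAt q j`. Such a block also ends inside the hull, since otherwise it would
  -- cross block `j`.
  Nblock-hullCount : ∀ {q k} → Growing q → (∀ {x} → x ∈ q → x < k) → (∀ {x} → x < k → x ∈ q) → T (isNC (reverse q)) →
    ∀ {j} → j < k → Nblock (reverse q) j ≡ hullCount q j
  Nblock-hullCount {q} {k} gs bound occ nc {j} j<k = trans
    (cong (λ n → length (filterᵇ inHull (upTo n))) (nBlocks-unique π (λ m → bound (reverse⁻ m)) (λ l → reverse⁺ (occ l))))
    (trans (length-filterᵇ-interval inHull j (blocksAt q j) k inHull⁺ inHull⁻)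
      (cong (_∸ j) (m≥n⇒m⊓n≡n (blocksAt-≤ j bound))))
    where
    π = reverse q
    lo = minL (length π) (block π j)
    hi = maxL (block π j)
    inHull : ℕ → Bool
    inHull i′ = all (λ i → (lo ≤ᵇ i) ∧ (i ≤ᵇ hi)) (block π i′)
    at : ∀ {i} → i < length π → At q i (lab π i)
    at {i} l = lab⇒At q (subst (i <_) (length-reverse q) l)
    <π : ∀ {i x} → At q i x → i < length π
    <π {i} p = subst (i <_) (sym (length-reverse q)) (At-< p)
    block⁺ : ∀ {i x} → At q i x → i ∈ block π x
    block⁺ p = ∈-block⁺ π (<π p) (At⇒lab p)
    block⁻ : ∀ {i x} → i ∈ block π x → At q i x
    block⁻ {i} m with l , e ← ∈-block⁻ π m = subst (At q i) e (at l)
    crossing-free : ∀ {a b c d x y} → a < b → b < c → c < d → At q a x → At q b y → At q c x → At q d y → x ≡ y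
    crossing-free {a} {b} {c} {d} {x} {y} ab bc cd pa pb pc pd with x ≟ y
    ... | yes e = e
    ... | no x≢y = contradiction (crossing⁺ {π = π} ab bc cd (<π pd) (trans (At⇒lab pa) (sym (At⇒lab pc))) (trans (At⇒lab pb) (sym (At⇒lab pd)))
          (λ e → x≢y (trans (sym (At⇒lab pa)) (trans e (At⇒lab pb))))) (not⁻ nc)
    within : ∀ {i i′} → T (inHull i′) → At q i i′ → ∃[ l ] ∃[ u ] At q l j × l ≤ i × At q u j × i ≤ u
    within {i} {i′} h p
      with lo≤ , ≤hi ← ∧⁻ {lo ≤ᵇ i} (All.lookup (Allₚ.all⁺ _ (block π i′) h) (block⁺ p))
      with l , l∈ , l≤ ← minL-∈ (block π j) (<π p) (≤ᵇ⇒≤ _ _ lo≤)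
      with u , u∈ , ≤u ← maxL-≥ (block π j) l∈ (≤ᵇ⇒≤ _ _ ≤hi)
      = l , u , block⁻ l∈ , l≤ , block⁻ u∈ , ≤u
    inHull⁻ : ∀ {i′} → i′ < k → T (inHull i′) → j ≤ i′ × i′ < blocksAt q j
    inHull⁻ {i′} i′<k h with i , p ← ∈⇒At (occ i′<k) with l , u , pl , l≤ , pu , ≤u ← within h p = j≤i′ , blocksAt⁺ ≤u p pu
      where
      -- Were i′ < j, each element of block i′ would be preceded by one of block j, hence by an earlier one of block i′.
      descent : ∀ n {i} → i < n → i′ < j → ¬ At q i i′
      descent (suc n) {i} (s≤s i≤n) i′<j p
        with l , _ , pl , l≤ , _ ← within h p
        with i₁ , i₁< , p₁ ← At-below gs pl i′<j = descent n (<-≤-trans i₁< (≤-trans l≤ i≤n)) i′<j p₁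
      j≤i′ : j ≤ i′
      j≤i′ = ≮⇒≥ λ i′<j → descent (suc i) ≤-refl i′<j p
    inHull⁺ : ∀ {i′} → i′ < k → j ≤ i′ → i′ < blocksAt q j → T (inHull i′)
    inHull⁺ {i′} i′<k j≤i′ l = Allₚ.all⁻ _ (All.tabulate λ {i} i∈ → ∧⁺ (≤⇒≤ᵇ (below i∈)) (≤⇒≤ᵇ (above i∈)))
      where
      below : ∀ {i} → i ∈ block π i′ → lo ≤ i
      below {i} i∈ with m≤n⇒m<n∨m≡n j≤i′
      ... | inj₂ refl = ∈-minL (block π j) i∈
      ... | inj₁ j<i′ with i₀ , i₀< , p₀ ← At-below gs (block⁻ i∈) j<i′ = ≤-trans (∈-minL (block π j) (block⁺ p₀)) (<⇒≤ i₀<)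
      above : ∀ {i} → i ∈ block π i′ → i ≤ hi
      above {i} i∈ with m≤n⇒m<n∨m≡n j≤i′
      ... | inj₂ refl = ∈-maxL (block π j) i∈
      ... | inj₁ j<i′ with i₃ , i₄ , i₃≤i₄ , p₃ , p₄ ← blocksAt⁻ gs l with i ≤? i₄
      ...   | yes i≤ = ≤-trans i≤ (∈-maxL (block π j) (block⁺ p₄))
      -- The positions i₀ < i₃ < i₄ < i carry the labels j, i′, j, i′.
      ...   | no i≰ with i₀ , i₀< , p₀ ← At-below gs p₃ j<i′ =
                contradiction (crossing-free i₀< i₃<i₄ (≰⇒> i≰) p₀ p₃ p₄ (block⁻ i∈)) (<⇒≢ j<i′)
        where
        i₃<i₄ : i₃ < i₄
        i₃<i₄ = ≤∧≢⇒< i₃≤i₄ λ { refl → <⇒≢ j<i′ (At-unique p₄ p₃) }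

  module _ {x} {X : Set x} where

    -- Labels and letters are reversed prefixes, so the newest letter is met first and has to be
    -- appended.
    word : List ℕ → List X → ℕ → List X
    word (c ∷ q) (a ∷ v) j = if c ≡ᵇ j then word q v j ∷ʳ a else word q v j
    word _       _       j = []

    pick : List ℕ → List X → ℕ → List X
    pick (c ∷ π) (a ∷ w) j = if c ≡ᵇ j then a ∷ pick π w j else pick π w j
    pick _       _       j = []

    restrict≡pick : ∀ π k w → length π ≡ length w → restrict π k w ≡ pick π w k
    restrict≡pick π k w e = go (λ i → lab π i ≡ᵇ k) id π w (λ i → refl) e
      where
      go : ∀ (p : ℕ → Bool) f π w → (∀ i → p (f i) ≡ (lab π i ≡ᵇ k)) → length π ≡ length w →
        map proj₂ (filterᵇ (p ∘ proj₁) (zip (applyUpTo f (length w)) w)) ≡ pick π w k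
      go p f []      []      h e = refl
      go p f (c ∷ π) (a ∷ w) h e with p (f 0) | c ≡ᵇ k | h 0
      ... | true  | true  | refl = cong (a ∷_) (go p (f ∘ suc) π w (h ∘ suc) (suc-injective e))
      ... | false | false | refl = go p (f ∘ suc) π w (h ∘ suc) (suc-injective e)

    pick-ʳ++ : ∀ q v j ρ w → length q ≡ length v → pick (q ʳ++ ρ) (v ʳ++ w) j ≡ word q v j ++ pick ρ w j
    pick-ʳ++ []      []      j ρ w e = refl
    pick-ʳ++ (c ∷ q) (a ∷ v) j ρ w e = trans (pick-ʳ++ q v j (c ∷ ρ) (a ∷ w) (suc-injective e)) step
      where
      step : word q v j ++ pick (c ∷ ρ) (a ∷ w) j ≡ word (c ∷ q) (a ∷ v) j ++ pick ρ w j
      step with c ≡ᵇ j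
      ... | true  = sym (++-assoc (word q v j) (a ∷ []) (pick ρ w j))
      ... | false = refl

    restrict-reverse : ∀ q v j → length q ≡ length v → restrict (reverse q) j (reverse v) ≡ word q v j
    restrict-reverse q v j e = trans
      (restrict≡pick (reverse q) j (reverse v) (trans (length-reverse q) (trans e (sym (length-reverse v)))))
      (trans (pick-ʳ++ q v j [] [] e) (++-identityʳ _))

    word-∉ : ∀ {q v j} → ¬ j ∈ q → word q v j ≡ []
    word-∉ {[]}                _  = refl
    word-∉ {c ∷ q} {[]}        _  = refl
    word-∉ {c ∷ q} {a ∷ v} {j} j∉ rewrite ≡ᵇ-false {c} {j} (λ { refl → j∉ (here refl) }) = word-∉ {q} {v} (j∉ ∘ there)

    word-same : ∀ c q a v → word (c ∷ q) (a ∷ v) c ≡ word q v c ∷ʳ a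
    word-same c q a v rewrite ≡ᵇ-refl c = refl

    word-other : ∀ {c j} q a v → c ≢ j → word (c ∷ q) (a ∷ v) j ≡ word q v j
    word-other {c} {j} q a v c≢j rewrite ≡ᵇ-false c≢j = refl

  hullCount-same : ∀ c q → hullCount (c ∷ q) c ≡ nBlocks (c ∷ q) ∸ c
  hullCount-same c q rewrite ≡ᵇ-refl c = refl

  hullCount-other : ∀ {c j} q → c ≢ j → hullCount (c ∷ q) j ≡ hullCount q j
  hullCount-other {c} {j} q c≢j rewrite ≡ᵇ-false c≢j = refl

  isIrr-reverse : ∀ {c q} → Growing (c ∷ q) → isIrr (reverse (c ∷ q)) ≡ (0 ≡ᵇ c)
  isIrr-reverse {c} {q} gs = cong₂ _≡ᵇ_ first (trans (cong (lab (reverse (c ∷ q)) ∘ pred) (length-reverse (c ∷ q))) (lab-last c q))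
    where
    first : lab (reverse (c ∷ q)) 0 ≡ 0
    first with lab (reverse (c ∷ q)) 0 in e
    ... | zero  = refl
    ... | suc _ with _ , () , _ ← At-below gs (lab⇒At (c ∷ q) z<s) (subst (0 <_) (sym e) z<s)

  -- The labels of the extendable blocks, youngest first; block 0 is always among them.
  data Stack : List ℕ → Set where
    bottom : Stack (0 ∷ [])
    push   : ∀ {c st} → All (_< suc c) st → Stack st → Stack (suc c ∷ st)

  Stack-height : ∀ {c st} → Stack (c ∷ st) → (0 ≡ᵇ c) ≡ (length (c ∷ st) ≡ᵇ 1)
  Stack-height bottom              = refl
  Stack-height (push _ bottom)     = refl
  Stack-height (push _ (push _ _)) = refl

  Stack-decreasing : ∀ {c st} → Stack (c ∷ st) → ∀ {x} → x ∈ st → x < c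
  Stack-decreasing (push p _) = All.lookup p

  Stack-suffix : ∀ {c st} st₁ → Stack (st₁ ++ c ∷ st) → Stack (c ∷ st)
  Stack-suffix []                 s          = s
  Stack-suffix (_ ∷ [])           (push _ s) = s
  Stack-suffix (_ ∷ st₁@(_ ∷ _))  (push _ s) = Stack-suffix st₁ s

  Stack-prefix-> : ∀ {c st} st₁ → Stack (st₁ ++ c ∷ st) → ∀ {x} → x ∈ st₁ → c < x
  Stack-prefix-> (_ ∷ st₁)              s          (here refl) = Stack-decreasing s (∈-++⁺ʳ st₁ (here refl))
  Stack-prefix-> (suc _ ∷ st₁@(_ ∷ _)) (push _ s) (there m)   = Stack-prefix-> st₁ s m

  -- The invariant of the scan: by `extendable` and `blocked`, the stack lists exactly the labels in
  -- use that can be appended without a crossing.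
  record State (q : List ℕ) (k : ℕ) (st : List ℕ) : Set where
    field
      growing     : Growing q
      bounded     : ∀ {x} → x ∈ q → x < k
      complete    : ∀ {x} → x < k → x ∈ q
      stack       : Stack st
      stacked     : ∀ {c} → c ∈ st → c < k
      nonCrossing : NonCrossing q
      extendable  : ∀ {c} → c ∈ st → NonCrossing (c ∷ q)
      blocked     : ∀ {c} → c < k → NonCrossing (c ∷ q) → c ∈ st

  open State

  initial : State (0 ∷ []) 1 (0 ∷ [])
  initial = record
    { growing     = (λ ()) ∷ []
    ; bounded     = λ { (here refl) → s≤s z≤n }
    ; complete    = λ { (s≤s z≤n) → here refl }
    ; stack       = bottom
    ; stacked     = λ { (here refl) → s≤s z≤n }
    ; nonCrossing = λ { _ (_ ∷ ()) ; _ (skip _ ()) }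
    ; extendable  = λ { (here refl) _ (_ ∷ _ ∷ ()) ; (here refl) _ (_ ∷ skip _ ()) ; (here refl) _ (skip _ (_ ∷ ())) ; (here refl) _ (skip _ (skip _ ())) }
    ; blocked     = λ { (s≤s z≤n) _ → here refl } }

  stacked-all : ∀ {k st} → (∀ {c} → c ∈ st → c < k) → Stack st → Stack (k ∷ st)
  stacked-all {zero}  p bottom     with () ← p (here refl)
  stacked-all {zero}  p (push _ _) with () ← p (here refl)
  stacked-all {suc k} p s = push (All.tabulate p) s

  open-block : ∀ {q k st} → State q k st → State (k ∷ q) (suc k) (k ∷ st)
  open-block {q} {k} {st} s = record
    { growing     = s .complete ∷ s .growing
    ; bounded     = λ { (here refl) → ≤-refl ; (there m) → m<n⇒m<1+n (s .bounded m) }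
    ; complete    = complete′
    ; stack       = stacked-all (s .stacked) (s .stack)
    ; stacked     = λ { (here refl) → ≤-refl ; (there m) → m<n⇒m<1+n (s .stacked m) }
    ; nonCrossing = fresh (s .nonCrossing)
    ; extendable  = λ { (here refl) → again ; (there m) → swap (s .extendable m) }
    ; blocked     = blocked′ }
    where
    k∉ : ¬ k ∈ q
    k∉ m = <-irrefl refl (s .bounded m)
    complete′ : ∀ {x} → x < suc k → x ∈ k ∷ q
    complete′ l with m<1+n⇒m<n∨m≡n l
    ... | inj₁ x<k  = there (s .complete x<k)
    ... | inj₂ refl = here refl
    fresh : NonCrossing q → NonCrossing (k ∷ q)
    fresh nc x≢y (refl ∷ t)   = k∉ (⊆-lookup t (there (here refl)))
    fresh nc x≢y (skip _ t) = nc x≢y t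
    again : NonCrossing (k ∷ k ∷ q)
    again x≢y (refl ∷ refl ∷ t) = x≢y refl
    again x≢y (refl ∷ skip _ t) = k∉ (⊆-lookup t (there (here refl)))
    again x≢y (skip _ t)        = fresh (s .nonCrossing) x≢y t
    swap : ∀ {c} → NonCrossing (c ∷ q) → NonCrossing (c ∷ k ∷ q)
    swap nc x≢y (refl ∷ refl ∷ t) = k∉ (⊆-lookup t (there (here refl)))
    swap nc x≢y (refl ∷ skip _ t) = nc x≢y (refl ∷ t)
    swap nc x≢y (skip _ t)        = fresh (s .nonCrossing) x≢y t
    blocked′ : ∀ {c} → c < suc k → NonCrossing (c ∷ k ∷ q) → c ∈ k ∷ st
    blocked′ l nc with m<1+n⇒m<n∨m≡n l
    ... | inj₂ refl = here refl
    ... | inj₁ c<k  = there (s .blocked c<k λ { x≢y (refl ∷ t) → nc x≢y (refl ∷ skip _ t) ; x≢y (skip _ t) → s .nonCrossing x≢y t })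

  extend-block : ∀ {q k} st₁ {c st₂} → State q k (st₁ ++ c ∷ st₂) → State (c ∷ q) k (c ∷ st₂)
  extend-block {q} {k} st₁ {c} {st₂} s = record
    { growing     = (λ x<c → s .complete (<-trans x<c c<k)) ∷ s .growing
    ; bounded     = λ { (here refl) → c<k ; (there m) → s .bounded m }
    ; complete    = there ∘ s .complete
    ; stack       = Stack-suffix st₁ (s .stack)
    ; stacked     = λ m → s .stacked (∈-++⁺ʳ st₁ m)
    ; nonCrossing = nc
    ; extendable  = λ { (here refl) → extendable′ (≤-refl) (s .extendable c∈) ; (there m) → extendable′ (<⇒≤ (Stack-decreasing (Stack-suffix st₁ (s .stack)) m)) (s .extendable (∈-++⁺ʳ st₁ (there m))) }
    ; blocked     = blocked′ }
    where
    c∈ : c ∈ st₁ ++ c ∷ st₂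
    c∈ = ∈-++⁺ʳ st₁ (here refl)
    c<k = s .stacked c∈
    nc : NonCrossing (c ∷ q)
    nc = s .extendable c∈
    extendable′ : ∀ {c′} → c′ ≤ c → NonCrossing (c′ ∷ q) → NonCrossing (c′ ∷ c ∷ q)
    extendable′ c′≤c nc′ x≢y (refl ∷ skip _ t) = nc′ x≢y (refl ∷ t)
    extendable′ c′≤c nc′ x≢y (skip _ t)        = nc x≢y t
    -- A crossing c, c′, c, c′ would show up earlier: the older block c′ already has a letter before
    -- the first of these c, so c′, c, c′, c crosses in `c ∷ q`.
    extendable′ c′≤c nc′ x≢y (refl ∷ refl ∷ t) =
      nc (x≢y ∘ sym) (refl ∷ growing-before₂ (s .growing) t (≤∧≢⇒< c′≤c (x≢y ∘ sym)))
    blocked′ : ∀ {c′} → c′ < k → NonCrossing (c′ ∷ c ∷ q) → c′ ∈ c ∷ st₂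
    blocked′ {c′} c′<k nc′ with ∈-++⁻ st₁ (s .blocked c′<k λ { x≢y (refl ∷ t) → nc′ x≢y (refl ∷ skip _ t) ; x≢y (skip _ t) → s .nonCrossing x≢y t })
    ... | inj₂ m = m
    -- A younger block c′ above c is lost: its first letter comes after that of c, so extending it
    -- would give c, c′, c, c′.
    ... | inj₁ m = contradiction (refl ∷ refl ∷ growing-before (s .growing) (s .complete c′<k) c<c′) (nc′ (<⇒≢ c<c′))
      where c<c′ = Stack-prefix-> st₁ (s .stack) m

open Partitions

unique-upTo : ∀ k {j xs} → j ∷ xs ↭ upTo k → ¬ j ∈ xs
unique-upTo k p m with j∉ ∷ _ ← Unique-resp-↭ (↭⇒↭ₛ (↭-sym p)) (upTo⁺ k) = All.lookup j∉ m ≡.refl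

-- Finite sums and products, and the enumeration of growth strings.

module Sums {c ℓ} (S : CommutativeRing c ℓ) where
  open CommutativeRing S
  open import Algebra.Solver.Ring.NaturalCoefficients.Default commutativeSemiring
    using (solve; _:+_; _:*_; _:=_)
  open import Relation.Binary.Reasoning.Setoid setoid

  ∑ ∏ : ∀ {a} {A : Set a} → List A → (A → Carrier) → Carrier
  ∑ = Σ[_]_ S
  ∏ = Π[_]_ S

  indicator : Bool → Carrier
  indicator true  = 1#
  indicator false = 0#

  module _ {a} {A : Set a} where

    ∑-cong : ∀ (xs : List A) {f g} → (∀ {y} → y ∈ xs → f y ≈ g y) → ∑ xs f ≈ ∑ xs g
    ∑-cong []       p = refl
    ∑-cong (y ∷ xs) p = +-cong (p (here ≡.refl)) (∑-cong xs (p ∘ there))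

    ∏-cong : ∀ (xs : List A) {f g} → (∀ {y} → y ∈ xs → f y ≈ g y) → ∏ xs f ≈ ∏ xs g
    ∏-cong []       p = refl
    ∏-cong (y ∷ xs) p = *-cong (p (here ≡.refl)) (∏-cong xs (p ∘ there))

    ∑-++ : ∀ (xs : List A) ys f → ∑ (xs ++ ys) f ≈ ∑ xs f + ∑ ys f
    ∑-++ []       ys f = sym (+-identityˡ _)
    ∑-++ (y ∷ xs) ys f = trans (+-congˡ (∑-++ xs ys f)) (sym (+-assoc _ _ _))

    ∏-++ : ∀ (xs : List A) ys f → ∏ (xs ++ ys) f ≈ ∏ xs f * ∏ ys f
    ∏-++ []       ys f = sym (*-identityˡ _)
    ∏-++ (y ∷ xs) ys f = trans (*-congˡ (∏-++ xs ys f)) (sym (*-assoc _ _ _))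

    ∏-↭ : ∀ {xs ys : List A} f → xs ↭ ys → ∏ xs f ≈ ∏ ys f
    ∏-↭ f Perm.refl          = refl
    ∏-↭ f (Perm.prep y p)    = *-congˡ (∏-↭ f p)
    ∏-↭ f (Perm.swap y z p)  = trans (*-congˡ (*-congˡ (∏-↭ f p))) (solve 3 (λ y z u → y :* (z :* u) := z :* (y :* u)) refl _ _ _)
    ∏-↭ f (Perm.trans p q)   = trans (∏-↭ f p) (∏-↭ f q)

    ∑-zero : ∀ (xs : List A) {f} → (∀ {y} → y ∈ xs → f y ≈ 0#) → ∑ xs f ≈ 0#
    ∑-zero []       p = refl
    ∑-zero (y ∷ xs) p = trans (+-cong (p (here ≡.refl)) (∑-zero xs (p ∘ there))) (+-identityˡ 0#)

    ∑-filter : ∀ (p : A → Bool) xs f → ∑ (filterᵇ p xs) f ≈ ∑ xs (λ y → indicator (p y) * f y)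
    ∑-filter p []       f = refl
    ∑-filter p (y ∷ xs) f with p y
    ... | true  = +-cong (sym (*-identityˡ _)) (∑-filter p xs f)
    ... | false = trans (∑-filter p xs f) (sym (trans (+-congʳ (zeroˡ _)) (+-identityˡ _)))

    ∏-* : ∀ (xs : List A) f g → ∏ xs (λ y → f y * g y) ≈ ∏ xs f * ∏ xs g
    ∏-* []       f g = sym (*-identityˡ _)
    ∏-* (y ∷ xs) f g = trans (*-congˡ (∏-* xs f g)) (solve 4 (λ a b p q → a :* b :* (p :* q) := a :* p :* (b :* q)) refl _ _ _ _)

  ∑-map : ∀ {a b} {A : Set a} {B : Set b} (h : A → B) xs f → ∑ (map h xs) f ≡ ∑ xs (f ∘ h)
  ∑-map h []       f = ≡.refl
  ∑-map h (y ∷ xs) f = ≡.cong (f (h y) +_) (∑-map h xs f)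

  ∑-concatMap : ∀ {a b} {A : Set a} {B : Set b} (h : A → List B) xs f → ∑ (concatMap h xs) f ≈ ∑ xs (λ y → ∑ (h y) f)
  ∑-concatMap h []       f = refl
  ∑-concatMap h (y ∷ xs) f = trans (∑-++ (h y) (concatMap h xs) f) (+-congˡ (∑-concatMap h xs f))

  ∑-upTo-suc : ∀ n f → ∑ (upTo (suc n)) f ≈ ∑ (upTo n) f + f n
  ∑-upTo-suc n f = trans (reflexive (≡.cong (λ xs → ∑ xs f) (≡.sym (upTo-∷ʳ n)))) (trans (∑-++ (upTo n) (n ∷ []) f) (+-congˡ (+-identityʳ _)))

  ∏-upTo-suc : ∀ n f → ∏ (upTo (suc n)) f ≈ ∏ (upTo n) f * f n
  ∏-upTo-suc n f = trans (reflexive (≡.cong (λ xs → ∏ xs f) (≡.sym (upTo-∷ʳ n)))) (trans (∏-++ (upTo n) (n ∷ []) f) (*-congˡ (*-identityʳ _)))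

  ∑-ext : ∀ k m f → ∑ (ext k (suc m)) f ≈ ∑ (upTo k) (λ c → ∑ (ext k m) (f ∘ (c ∷_))) + ∑ (ext (suc k) m) (f ∘ (k ∷_))
  ∑-ext k m f = begin
    ∑ (ext k (suc m)) f
      ≈⟨ ∑-concatMap h (upTo (suc k)) f ⟩
    ∑ (upTo (suc k)) (λ c → ∑ (h c) f)
      ≈⟨ ∑-cong (upTo (suc k)) (λ {c} _ → reflexive (∑-map (c ∷_) (ext (if c ≡ᵇ k then suc k else k) m) f)) ⟩
    ∑ (upTo (suc k)) (λ c → ∑ (ext (if c ≡ᵇ k then suc k else k) m) (f ∘ (c ∷_)))
      ≈⟨ ∑-upTo-suc k _ ⟩
    ∑ (upTo k) (λ c → ∑ (ext (if c ≡ᵇ k then suc k else k) m) (f ∘ (c ∷_))) + ∑ (ext (if k ≡ᵇ k then suc k else k) m) (f ∘ (k ∷_))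
      ≈⟨ +-cong (∑-cong (upTo k) (λ {c} m∈ → reflexive (≡.cong (λ b → ∑ (ext (if b then suc k else k) m) (f ∘ (c ∷_))) (≡ᵇ-false (ℕₚ.<⇒≢ (∈-upTo⁻ m∈))))))
                (reflexive (≡.cong (λ b → ∑ (ext (if b then suc k else k) m) (f ∘ (k ∷_))) (≡ᵇ-refl k))) ⟩
    ∑ (upTo k) (λ c → ∑ (ext k m) (f ∘ (c ∷_))) + ∑ (ext (suc k) m) (f ∘ (k ∷_)) ∎
    where h = λ c → map (c ∷_) (ext (if c ≡ᵇ k then suc k else k) m)

  indicator-T : ∀ {b} y → T b → indicator b * y ≈ y
  indicator-T {true} y _ = *-identityˡ y

  indicator-¬T : ∀ {b} y → ¬ T b → indicator b * y ≈ 0#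
  indicator-¬T {true}  y p = ⊥-elim (p tt)
  indicator-¬T {false} y p = zeroˡ y

-- Agreement of the scan with the sum over non-crossing partitions.

module Scanning {c ℓ} (S : CommutativeRing c ℓ) {x} {X : Set x} (g : ℕ → List X → CommutativeRing.Carrier S)
  (e : Bool → CommutativeRing.Carrier S) where
  open CommutativeRing S
  open Sums S
  open Automaton S g
  open State
  open import Algebra.Solver.Ring.NaturalCoefficients.Default commutativeSemiring
    using (solve; _:+_; _:*_; _:=_)
  open import Relation.Binary.Reasoning.Setoid setoid

  partitionWeight : Partition → List X → Carrier
  partitionWeight π w = ∏ (blockLabels π) (λ k → g (Nblock π k) (restrict π k w))

  -- The weight `e` of the irreducibility test lets one induction serve both `NC`, with `e`
  -- constantly 1, and `NCirr`, with `e` the indicator.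
  summand : Partition → List X → Carrier
  summand π w = indicator (isNC π) * (e (isIrr π) * partitionWeight π w)

  entry : List ℕ → List X → ℕ → Entry
  entry q v j = j , hullCount q j , word q v j

  value : List ℕ → List X → ℕ → Carrier
  value q v j = weight (entry q v j)

  weights-entries : ∀ q v st → weights (map (entry q v) st) ≈ ∏ st (value q v)
  weights-entries q v []       = refl
  weights-entries q v (j ∷ st) = *-congˡ (weights-entries q v st)

  ω : ℕ → ℕ → Carrier
  ω _ l = e (l ≡ᵇ 1)

  entry-other : ∀ {c j} q v a → c ≢ j → entry (c ∷ q) (a ∷ v) j ≡ entry q v j
  entry-other {j = j} q v a c≢j = ≡.cong₂ (λ N u → j , N , u) (hullCount-other q c≢j) (word-other q a v c≢j)

  entries-other : ∀ {c} q v a st → (∀ {j} → j ∈ st → c ≢ j) → map (entry (c ∷ q) (a ∷ v)) st ≡ map (entry q v) st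
  entries-other q v a []       p = ≡.refl
  entries-other q v a (j ∷ st) p = ≡.cong₂ _∷_ (entry-other q v a (p (here ≡.refl))) (entries-other q v a st (p ∘ there))

  scan-end : ∀ {c₀ q k c₁ st v cl} → State (c₀ ∷ q) k (c₁ ∷ st) → c₀ ≡ c₁ → cl ++ c₁ ∷ st ↭ upTo k → length (c₀ ∷ q) ≡ length v →
    summand (reverse (c₀ ∷ q)) (reverse v) ≈ ∏ cl (value (c₀ ∷ q) v) * scan ω k (map (entry (c₀ ∷ q) v) (c₁ ∷ st)) []
  scan-end {c₀} {q} {k} {_} {st} {v} {cl} s ≡.refl perm len = begin
    indicator (isNC π) * (e (isIrr π) * partitionWeight π (reverse v))
      ≈⟨ indicator-T _ nc ⟩
    e (isIrr π) * partitionWeight π (reverse v)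
      ≈⟨ *-cong (reflexive (≡.cong e irr)) blocks ⟩
    ω k (length (c₀ ∷ st)) * ∏ (cl ++ c₀ ∷ st) (value q′ v)
      ≈⟨ *-cong (reflexive (≡.cong (ω k) (≡.sym (length-map (entry q′ v) (c₀ ∷ st))))) (trans (∏-++ cl (c₀ ∷ st) _) (*-congˡ (sym (weights-entries q′ v (c₀ ∷ st))))) ⟩
    ω k (length (map (entry q′ v) (c₀ ∷ st))) * (∏ cl (value q′ v) * weights (map (entry q′ v) (c₀ ∷ st)))
      ≈⟨ solve 3 (λ o p r → o :* (p :* r) := p :* (o :* r)) refl _ _ _ ⟩
    ∏ cl (value q′ v) * scan ω k (map (entry q′ v) (c₀ ∷ st)) [] ∎
    where
    q′ = c₀ ∷ q
    π  = reverse q′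
    nc : T (isNC π)
    nc = NonCrossing⇒isNC q′ (s .nonCrossing)
    irr : isIrr π ≡ (length (c₀ ∷ st) ≡ᵇ 1)
    irr = ≡.trans (isIrr-reverse (s .growing)) (Stack-height (s .stack))
    nBlocks-π : nBlocks π ≡ k
    nBlocks-π = nBlocks-unique π (λ m → s .bounded (reverse⁻ m)) (λ l → reverse⁺ (s .complete l))
    blocks : partitionWeight π (reverse v) ≈ ∏ (cl ++ c₀ ∷ st) (value q′ v)
    blocks = begin
      ∏ (upTo (nBlocks π)) (λ j → g (Nblock π j) (restrict π j (reverse v)))
        ≈⟨ reflexive (≡.cong (λ n → ∏ (upTo n) (λ j → g (Nblock π j) (restrict π j (reverse v)))) nBlocks-π) ⟩
      ∏ (upTo k) (λ j → g (Nblock π j) (restrict π j (reverse v)))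
        ≈⟨ ∏-cong (upTo k) (λ {j} m → reflexive (≡.cong₂ g (Nblock-hullCount (s .growing) (s .bounded) (s .complete) nc (∈-upTo⁻ m)) (restrict-reverse q′ v j len))) ⟩
      ∏ (upTo k) (value q′ v)
        ≈⟨ ∏-↭ _ (↭-sym perm) ⟩
      ∏ (cl ++ c₀ ∷ st) (value q′ v) ∎

  mutual
    -- `cl` lists the closed blocks. They receive no further letters and their hulls no longer grow,
    -- so their weights factor out of the sum over all continuations.
    scan-sum : ∀ {c₀ q k st v cl} → State (c₀ ∷ q) k (c₀ ∷ st) → cl ++ c₀ ∷ st ↭ upTo k → length (c₀ ∷ q) ≡ length v → ∀ w →
      ∑ (ext k (length w)) (λ ρ → summand ((c₀ ∷ q) ʳ++ ρ) (v ʳ++ w))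
        ≈ ∏ cl (value (c₀ ∷ q) v) * scan ω k (map (entry (c₀ ∷ q) v) (c₀ ∷ st)) w
    scan-sum {v = v} {cl} s perm len [] = trans (+-identityʳ _) (scan-end {v = v} {cl} s ≡.refl perm len)
    scan-sum {c₀} {q} {k} {st} {v} {cl} s perm len (a ∷ w) = begin
      ∑ (ext k (suc (length w))) (λ ρ → summand (q′ ʳ++ ρ) (v ʳ++ a ∷ w))
        ≈⟨ ∑-ext k (length w) _ ⟩
      ∑ (upTo k) (λ c → ∑ (ext k (length w)) (λ ρ → summand ((c ∷ q′) ʳ++ ρ) ((a ∷ v) ʳ++ w)))
        + ∑ (ext (suc k) (length w)) (λ ρ → summand ((k ∷ q′) ʳ++ ρ) ((a ∷ v) ʳ++ w))
        ≈⟨ +-cong (scan-old {v = v} k [] (c₀ ∷ st) cl s perm len ℕₚ.≤-refl (s .stacked) (λ _ m → m) a w) new ⟩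
      ∏ cl (value q′ v) * scanOld ω k es a w + ∏ cl (value q′ v) * scan ω (suc k) ((k , 1 , a ∷ []) ∷ es) w
        ≈⟨ solve 3 (λ p r t → p :* r :+ p :* t := p :* (t :+ r)) refl _ _ _ ⟩
      ∏ cl (value q′ v) * scan ω k es (a ∷ w) ∎
      where
      q′ = c₀ ∷ q
      es = map (entry q′ v) (c₀ ∷ st)
      <k : ∀ {j} → j ∈ cl ++ c₀ ∷ st → j < k
      <k m = ∈-upTo⁻ (Permₚ.∈-resp-↭ perm m)
      opened : entry (k ∷ q′) (a ∷ v) k ≡ (k , 1 , a ∷ [])
      opened = ≡.cong₂ (λ N u → k , N , u)
        (≡.trans (hullCount-same k q′) (≡.trans (≡.cong (_∸ k) (nBlocks-unique (k ∷ q′) (open-block s .bounded) (open-block s .complete))) (ℕₚ.m+n∸n≡m 1 k)))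
        (≡.trans (word-same k q′ a v) (≡.cong (_∷ʳ a) (word-∉ {q = q′} {v} (λ m → ℕₚ.<-irrefl ≡.refl (s .bounded m)))))
      new : ∑ (ext (suc k) (length w)) (λ ρ → summand ((k ∷ q′) ʳ++ ρ) ((a ∷ v) ʳ++ w)) ≈ ∏ cl (value q′ v) * scan ω (suc k) ((k , 1 , a ∷ []) ∷ es) w
      new = begin
        ∑ (ext (suc k) (length w)) (λ ρ → summand ((k ∷ q′) ʳ++ ρ) ((a ∷ v) ʳ++ w))
          ≈⟨ scan-sum {v = a ∷ v} {cl} (open-block s) perm′ (≡.cong suc len) w ⟩
        ∏ cl (value (k ∷ q′) (a ∷ v)) * scan ω (suc k) (map (entry (k ∷ q′) (a ∷ v)) (k ∷ c₀ ∷ st)) w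
          ≈⟨ *-cong (∏-cong cl (λ m → reflexive (≡.cong weight (entry-other q′ v a (ℕₚ.>⇒≢ (<k (Permₚ.∈-resp-↭ (Permₚ.++-comm (c₀ ∷ st) cl) (∈-++⁺ʳ (c₀ ∷ st) m))))))))
                    (reflexive (≡.cong (λ es → scan ω (suc k) es w) (≡.cong₂ _∷_ opened (entries-other q′ v a (c₀ ∷ st) (λ m → ℕₚ.>⇒≢ (<k (∈-++⁺ʳ cl m))))))) ⟩
        ∏ cl (value q′ v) * scan ω (suc k) ((k , 1 , a ∷ []) ∷ es) w ∎
        where
        perm′ : cl ++ k ∷ c₀ ∷ st ↭ upTo (suc k)
        perm′ = ↭-trans (Permₚ.shift k cl (c₀ ∷ st)) (↭-trans (Perm.prep k perm)
          (↭-trans (Permₚ.∷↭∷ʳ k (upTo k)) (↭-reflexive (upTo-∷ʳ k))))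

    -- The bound `b` descends over the possible labels of the next letter, and `st₂` is the part of
    -- the stack below it. A label off the stack contributes 0; a label on it contributes its
    -- extension and counts as closed for all smaller labels, just as `scanOld` walks down the
    -- stack.
    scan-old : ∀ {c₀ q k v} b st₁ st₂ cl → State (c₀ ∷ q) k (st₁ ++ st₂) → cl ++ st₂ ↭ upTo k → length (c₀ ∷ q) ≡ length v → b ≤ k →
      (∀ {j} → j ∈ st₂ → j < b) → (∀ {j} → j < b → j ∈ st₁ ++ st₂ → j ∈ st₂) → ∀ a w →
      ∑ (upTo b) (λ c → ∑ (ext k (length w)) (λ ρ → summand ((c ∷ c₀ ∷ q) ʳ++ ρ) ((a ∷ v) ʳ++ w)))
        ≈ ∏ cl (value (c₀ ∷ q) v) * scanOld ω k (map (entry (c₀ ∷ q) v) st₂) a w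
    scan-old zero st₁ []        cl s perm len b≤k st₂<b only a w = sym (zeroʳ _)
    scan-old zero st₁ (j ∷ st₂) cl s perm len b≤k st₂<b only a w with () ← st₂<b (here ≡.refl)
    scan-old {c₀} {q} {k} {v} (suc b) st₁ [] cl s perm len b≤k st₂<b only a w = begin
      ∑ (upTo (suc b)) _  ≈⟨ ∑-upTo-suc b _ ⟩
      ∑ (upTo b) _ + ∑ (ext k (length w)) _
        ≈⟨ +-cong (scan-old {v = v} b st₁ [] cl s perm len (ℕₚ.<⇒≤ b≤k) (λ ()) (λ l → only (ℕₚ.m<n⇒m<1+n l)) a w)
                  (scan-blocked {v = v} s b≤k (λ m → contradiction (only ℕₚ.≤-refl m) λ ()) a w) ⟩
      _ + 0#              ≈⟨ +-identityʳ _ ⟩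
      ∏ cl (value (c₀ ∷ q) v) * 0# ∎
    scan-old {c₀} {q} {k} {v} (suc b) st₁ (j ∷ st₂) cl s perm len b≤k st₂<b only a w with b ℕ.≟ j
    ... | no b≢j = begin
      ∑ (upTo (suc b)) _  ≈⟨ ∑-upTo-suc b _ ⟩
      ∑ (upTo b) _ + ∑ (ext k (length w)) _
        ≈⟨ +-cong (scan-old {v = v} b st₁ (j ∷ st₂) cl s perm len (ℕₚ.<⇒≤ b≤k) st₂<b′ (λ l → only (ℕₚ.m<n⇒m<1+n l)) a w)
                  (scan-blocked {v = v} s b≤k (b∉ ∘ only ℕₚ.≤-refl) a w) ⟩
      _ + 0#              ≈⟨ +-identityʳ _ ⟩
      ∏ cl (value (c₀ ∷ q) v) * scanOld ω k (map (entry (c₀ ∷ q) v) (j ∷ st₂)) a w ∎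
      where
      decreasing : ∀ {i} → i ∈ st₂ → i < j
      decreasing = Stack-decreasing (Stack-suffix st₁ (s .stack))
      j<b : j < b
      j<b = ℕₚ.≤∧≢⇒< (ℕₚ.≤-pred (st₂<b (here ≡.refl))) (b≢j ∘ ≡.sym)
      st₂<b′ : ∀ {i} → i ∈ j ∷ st₂ → i < b
      st₂<b′ (here ≡.refl) = j<b
      st₂<b′ (there m)     = ℕₚ.<-trans (decreasing m) j<b
      b∉ : ¬ b ∈ j ∷ st₂
      b∉ m = ℕₚ.<-irrefl ≡.refl (st₂<b′ m)
    ... | yes ≡.refl = begin
      ∑ (upTo (suc j)) _  ≈⟨ ∑-upTo-suc j _ ⟩
      ∑ (upTo j) _ + ∑ (ext k (length w)) _
        ≈⟨ +-cong (scan-old {v = v} j (st₁ ∷ʳ j) st₂ (j ∷ cl) (≡.subst (State (c₀ ∷ q) k) (≡.sym (++-assoc st₁ (j ∷ []) st₂)) s)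
                     (↭-trans (↭-sym (Permₚ.shift j cl st₂)) perm) len (ℕₚ.<⇒≤ b≤k) decreasing only′ a w)
                  old ⟩
      ∏ (j ∷ cl) (value q′ v) * scanOld ω k es a w + ∏ cl (value q′ v) * scan ω k (extend k a (entry q′ v j) ∷ es) w
        ≈⟨ solve 4 (λ e p r t → e :* p :* r :+ p :* t := p :* (t :+ e :* r)) refl (value q′ v j) _ _ _ ⟩
      ∏ cl (value q′ v) * scanOld ω k (map (entry q′ v) (j ∷ st₂)) a w ∎
      where
      q′ = c₀ ∷ q
      es = map (entry q′ v) st₂
      decreasing : ∀ {i} → i ∈ st₂ → i < j
      decreasing = Stack-decreasing (Stack-suffix st₁ (s .stack))
      only′ : ∀ {i} → i < j → i ∈ (st₁ ∷ʳ j) ++ st₂ → i ∈ st₂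
      only′ l m with only (ℕₚ.m<n⇒m<1+n l) (≡.subst (_ ∈_) (++-assoc st₁ (j ∷ []) st₂) m)
      ... | here ≡.refl = contradiction l (ℕₚ.<-irrefl ≡.refl)
      ... | there m′    = m′
      cl≢j : ∀ {i} → i ∈ cl → j ≢ i
      cl≢j i∈ ≡.refl = unique-upTo k (↭-trans (↭-sym (Permₚ.shift j cl st₂)) perm) (Permₚ.∈-resp-↭ (Permₚ.++-comm st₂ cl) (∈-++⁺ʳ st₂ i∈))
      s′ = extend-block st₁ s
      extended : entry (j ∷ q′) (a ∷ v) j ≡ extend k a (entry q′ v j)
      extended = ≡.cong₂ (λ N u → j , N , u)
        (≡.trans (hullCount-same j q′) (≡.cong (_∸ j) (nBlocks-unique (j ∷ q′) (s′ .bounded) (s′ .complete))))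
        (word-same j q′ a v)
      old : ∑ (ext k (length w)) (λ ρ → summand ((j ∷ q′) ʳ++ ρ) ((a ∷ v) ʳ++ w)) ≈ ∏ cl (value q′ v) * scan ω k (extend k a (entry q′ v j) ∷ es) w
      old = begin
        ∑ (ext k (length w)) (λ ρ → summand ((j ∷ q′) ʳ++ ρ) ((a ∷ v) ʳ++ w))
          ≈⟨ scan-sum {v = a ∷ v} {cl} s′ perm (≡.cong suc len) w ⟩
        ∏ cl (value (j ∷ q′) (a ∷ v)) * scan ω k (map (entry (j ∷ q′) (a ∷ v)) (j ∷ st₂)) w
          ≈⟨ *-cong (∏-cong cl (λ m → reflexive (≡.cong weight (entry-other q′ v a (cl≢j m)))))
                    (reflexive (≡.cong (λ es → scan ω k es w) (≡.cong₂ _∷_ extended (entries-other q′ v a st₂ (λ m → ℕₚ.>⇒≢ (decreasing m)))))) ⟩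
        ∏ cl (value q′ v) * scan ω k (extend k a (entry q′ v j) ∷ es) w ∎

    scan-blocked : ∀ {q k st v j} → State q k st → j < k → ¬ j ∈ st → ∀ a w →
      ∑ (ext k (length w)) (λ ρ → summand ((j ∷ q) ʳ++ ρ) ((a ∷ v) ʳ++ w)) ≈ 0#
    scan-blocked {q} {k} {j = j} s j<k j∉ a w = ∑-zero (ext k (length w)) λ {ρ} _ →
      indicator-¬T _ (λ nc → j∉ (s .blocked j<k (isNC⇒NonCrossing (j ∷ q) ρ nc)))

  scan-NC : ∀ a w → ∑ (allPartitions (suc (length w))) (λ π → summand π (a ∷ w)) ≈ scan ω 0 [] (a ∷ w)
  scan-NC a w = begin
    ∑ (allPartitions (suc (length w))) (λ π → summand π (a ∷ w))
      ≈⟨ trans (∑-ext 0 (length w) _) (+-identityˡ _) ⟩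
    ∑ (ext 1 (length w)) (λ ρ → summand ((0 ∷ []) ʳ++ ρ) ((a ∷ []) ʳ++ w))
      ≈⟨ scan-sum {v = a ∷ []} {[]} initial Perm.refl ≡.refl w ⟩
    1# * scan ω 1 ((0 , 1 , a ∷ []) ∷ []) w
      ≈⟨ trans (*-identityˡ _) (sym (+-identityʳ _)) ⟩
    scan ω 0 [] (a ∷ w) ∎

-- Interval partitions and the Boolean equation.

record IntervalState (j : ℕ) (q : List ℕ) : Set where
  field
    growing  : Growing (j ∷ q)
    bounded  : ∀ {x} → x ∈ j ∷ q → x < suc j
    complete : ∀ {x} → x < suc j → x ∈ j ∷ q
    interval : Interval (j ∷ q)

module IntervalScanning {c ℓ} (S : CommutativeRing c ℓ) {x} {X : Set x} (b : List X → CommutativeRing.Carrier S) where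
  open CommutativeRing S
  open Sums S
  open Series S X
  open IntervalState
  open import Algebra.Solver.Ring.NaturalCoefficients.Default commutativeSemiring
    using (solve; _:+_; _:*_; _:=_)
  open import Relation.Binary.Reasoning.Setoid setoid

  -- The scan for interval partitions: only the last block can be extended, and `u` holds its
  -- letters so far.
  runs : List X → Ser
  runs u []      = b u
  runs u (a ∷ w) = b u * runs (a ∷ []) w + runs (u ∷ʳ a) w

  summand : Partition → List X → Carrier
  summand π w = indicator (isInterval π) * fπ S b π w

  single : IntervalState 0 []
  single = record
    { growing = (λ ()) ∷ [] ; bounded = λ { (here ≡.refl) → s≤s z≤n } ; complete = λ { (s≤s z≤n) → here ≡.refl }
    ; interval = λ { _ (_ ∷ ()) ; _ (skip _ ()) } }

  next : ∀ {j q} → IntervalState j q → IntervalState (suc j) (j ∷ q)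
  next {j} {q} s = record
    { growing  = s .complete ∷ s .growing
    ; bounded  = λ { (here ≡.refl) → ℕₚ.≤-refl ; (there m) → ℕₚ.m<n⇒m<1+n (s .bounded m) }
    ; complete = complete′
    ; interval = interval′ }
    where
    complete′ : ∀ {x} → x < suc (suc j) → x ∈ suc j ∷ j ∷ q
    complete′ l with ℕₚ.m<1+n⇒m<n∨m≡n l
    ... | inj₁ l′     = there (s .complete l′)
    ... | inj₂ ≡.refl = here ≡.refl
    interval′ : Interval (suc j ∷ j ∷ q)
    interval′ x≢y (≡.refl ∷ t) = ℕₚ.<-irrefl ≡.refl (s .bounded (⊆-lookup t (there (here ≡.refl))))
    interval′ x≢y (skip _ t)   = s .interval x≢y t

  stay : ∀ {j q} → IntervalState j q → IntervalState j (j ∷ q)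
  stay {j} {q} s = record
    { growing  = (λ l → s .complete (ℕₚ.m<n⇒m<1+n l)) ∷ s .growing
    ; bounded  = λ { (here ≡.refl) → ℕₚ.≤-refl ; (there m) → s .bounded m }
    ; complete = there ∘ s .complete
    ; interval = interval′ }
    where
    interval′ : Interval (j ∷ j ∷ q)
    interval′ x≢y (≡.refl ∷ ≡.refl ∷ t) = x≢y ≡.refl
    interval′ x≢y (≡.refl ∷ skip _ t)   = s .interval x≢y (≡.refl ∷ t)
    interval′ x≢y (skip _ t)            = s .interval x≢y t

  runs-sum : ∀ {j q v} → IntervalState j q → length (j ∷ q) ≡ length v → ∀ w →
    ∑ (ext (suc j) (length w)) (λ ρ → summand ((j ∷ q) ʳ++ ρ) (v ʳ++ w)) ≈ ∏ (upTo j) (b ∘ word (j ∷ q) v) * runs (word (j ∷ q) v j) w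
  runs-sum {j} {q} {v} s len [] = begin
    summand π (reverse v) + 0#  ≈⟨ trans (+-identityʳ _) (indicator-T _ (Interval⇒isInterval (j ∷ q) (s .interval))) ⟩
    ∏ (upTo (nBlocks π)) (λ i → b (restrict π i (reverse v)))
      ≈⟨ reflexive (≡.cong (λ n → ∏ (upTo n) (λ i → b (restrict π i (reverse v)))) (nBlocks-unique π (λ m → s .bounded (reverse⁻ m)) (λ l → reverse⁺ (s .complete l)))) ⟩
    ∏ (upTo (suc j)) (λ i → b (restrict π i (reverse v)))
      ≈⟨ ∏-cong (upTo (suc j)) (λ {i} _ → reflexive (≡.cong b (restrict-reverse (j ∷ q) v i len))) ⟩
    ∏ (upTo (suc j)) (b ∘ word (j ∷ q) v)
      ≈⟨ ∏-upTo-suc j _ ⟩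
    ∏ (upTo j) (b ∘ word (j ∷ q) v) * b (word (j ∷ q) v j) ∎
    where π = reverse (j ∷ q)
  runs-sum {j} {q} {v} s len (a ∷ w) = begin
    ∑ (ext (suc j) (suc (length w))) (λ ρ → summand (q′ ʳ++ ρ) (v ʳ++ a ∷ w))
      ≈⟨ ∑-ext (suc j) (length w) _ ⟩
    ∑ (upTo (suc j)) (λ c → ∑ (ext (suc j) (length w)) (λ ρ → summand ((c ∷ q′) ʳ++ ρ) ((a ∷ v) ʳ++ w)))
      + ∑ (ext (suc (suc j)) (length w)) (λ ρ → summand ((suc j ∷ q′) ʳ++ ρ) ((a ∷ v) ʳ++ w))
      ≈⟨ +-cong (trans (∑-upTo-suc j _) (+-congʳ (∑-zero (upTo j) (λ m → ∑-zero (ext (suc j) (length w)) (λ {ρ} _ → indicator-¬T _ (returns (∈-upTo⁻ m) ρ))))))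
                (runs-sum {v = a ∷ v} (next s) (≡.cong suc len) w) ⟩
    0# + ∑ (ext (suc j) (length w)) (λ ρ → summand ((j ∷ q′) ʳ++ ρ) ((a ∷ v) ʳ++ w))
      + ∏ (upTo (suc j)) (b ∘ word (suc j ∷ q′) (a ∷ v)) * runs (word (suc j ∷ q′) (a ∷ v) (suc j)) w
      ≈⟨ +-cong (trans (+-identityˡ _) (runs-sum {v = a ∷ v} (stay s) (≡.cong suc len) w)) (*-cong fresh (reflexive (≡.cong (λ u → runs u w) opened))) ⟩
    ∏ (upTo j) (b ∘ word (j ∷ q′) (a ∷ v)) * runs (word (j ∷ q′) (a ∷ v) j) w
      + ∏ (upTo j) (b ∘ word q′ v) * b (word q′ v j) * runs (a ∷ []) w
      ≈⟨ +-congʳ (*-cong (∏-cong (upTo j) (λ m → reflexive (≡.cong b (word-other q′ a v (ℕₚ.>⇒≢ (∈-upTo⁻ m)))))) (reflexive (≡.cong (λ u → runs u w) (word-same j q′ a v)))) ⟩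
    ∏ (upTo j) (b ∘ word q′ v) * runs (word q′ v j ∷ʳ a) w
      + ∏ (upTo j) (b ∘ word q′ v) * b (word q′ v j) * runs (a ∷ []) w
      ≈⟨ solve 4 (λ p r y z → p :* r :+ p :* y :* z := p :* (y :* z :+ r)) refl _ _ _ _ ⟩
    ∏ (upTo j) (b ∘ word q′ v) * runs (word q′ v j) (a ∷ w) ∎
    where
    q′ = j ∷ q
    opened : word (suc j ∷ q′) (a ∷ v) (suc j) ≡ a ∷ []
    opened = ≡.trans (word-same (suc j) q′ a v) (≡.cong (_∷ʳ a) (word-∉ {q = q′} {v} (λ m → ℕₚ.<-irrefl ≡.refl (s .bounded m))))
    fresh : ∏ (upTo (suc j)) (b ∘ word (suc j ∷ q′) (a ∷ v)) ≈ ∏ (upTo j) (b ∘ word q′ v) * b (word q′ v j)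
    fresh = trans (∏-cong (upTo (suc j)) (λ m → reflexive (≡.cong b (word-other q′ a v (ℕₚ.>⇒≢ (∈-upTo⁻ m)))))) (∏-upTo-suc j _)
    returns : ∀ {i} → i < j → ∀ ρ → ¬ T (isInterval ((i ∷ q′) ʳ++ ρ))
    returns {i} i<j ρ h with s .complete (ℕₚ.m<n⇒m<1+n i<j)
    ... | here ≡.refl = ℕₚ.<-irrefl ≡.refl i<j
    ... | there m     = isInterval⇒Interval (i ∷ q′) ρ h (ℕₚ.<⇒≢ i<j) (≡.refl ∷ ≡.refl ∷ from∈ m)

  runs-Int : ∀ a w → ∑ (Int (suc (length w))) (λ π → fπ S b π (a ∷ w)) ≈ runs (a ∷ []) w
  runs-Int a w = begin
    ∑ (Int (suc (length w))) (λ π → fπ S b π (a ∷ w))                    ≈⟨ ∑-filter isInterval (allPartitions (suc (length w))) _ ⟩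
    ∑ (allPartitions (suc (length w))) (λ π → summand π (a ∷ w))         ≈⟨ trans (∑-ext 0 (length w) _) (+-identityˡ _) ⟩
    ∑ (ext 1 (length w)) (λ ρ → summand ((0 ∷ []) ʳ++ ρ) ((a ∷ []) ʳ++ w)) ≈⟨ runs-sum {v = a ∷ []} single ≡.refl w ⟩
    1# * runs (a ∷ []) w                                                 ≈⟨ *-identityˡ _ ⟩
    runs (a ∷ []) w                                                      ∎

  -- The first block is an initial segment, and what follows it is again an arbitrary interval
  -- partition; the sum over the end of that segment is the product with `m`.
  interval-equation : ∀ (m : Ser) → m [] ≈ 1# → (∀ a w → m (a ∷ w) ≈ runs (a ∷ []) w) → m ≋ ε ⊕ reduced b ⋆ m
  interval-equation m m₁ p []      = trans m₁ (sym (trans (+-congˡ (zeroˡ _)) (+-identityʳ _)))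
  interval-equation m m₁ p (a ∷ w) = trans (p a w) (trans (runs-⋆ (a ∷ []) w) (sym (trans (+-identityˡ _) (trans (+-congʳ (zeroˡ _)) (+-identityˡ _)))))
    where
    runs-⋆ : ∀ u w → runs u w ≈ ((λ v → b (u ++ v)) ⋆ m) w
    runs-⋆ u []      = sym (trans (*-congˡ m₁) (trans (*-identityʳ _) (reflexive (≡.cong b (++-identityʳ u)))))
    runs-⋆ u (a ∷ w) = +-cong (*-cong (reflexive (≡.cong b (≡.sym (++-identityʳ u)))) (sym (p a w)))
      (trans (runs-⋆ (u ∷ʳ a) w) (⋆-cong (λ v → reflexive (≡.cong b (++-assoc u (a ∷ []) v))) (λ _ → refl) w))

Nblock-positive : ∀ π {k} → k ∈ blockLabels π → 0 < Nblock π k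
Nblock-positive π {k} k∈ = ∈-length (∈-filter⁺ (λ j → T? (all (λ i → (lo ℕ.≤ᵇ i) ∧ (i ℕ.≤ᵇ hi)) (block π j))) k∈
  (Allₚ.all⁻ _ (All.tabulate λ i∈ → ∧⁺ (ℕₚ.≤⇒≤ᵇ (∈-minL (block π k) i∈)) (ℕₚ.≤⇒≤ᵇ (∈-maxL (block π k) i∈)))))
  where
  lo = minL (length π) (block π k)
  hi = maxL (block π k)

-- Relations between the cumulants over a commutative ring.

module Cumulants {c ℓ} (S : CommutativeRing c ℓ) {x} {X : Set x} where
  open CommutativeRing S
  open Sums S
  open Series S X
  open PowerSeries S using (fromℕ-+)
  open import Algebra.Properties.Ring ring using (-0#≈0#; -‿distribˡ-*; -‿+-comm; -‿involutive)
  open import Algebra.Solver.Ring.NaturalCoefficients.Default commutativeSemiring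
    using (solve; _:+_; _:*_; _:=_; con)
  open import Relation.Binary.Reasoning.Setoid setoid

  module NC-sums (g : ℕ → List X → Carrier) where
    open Automaton S g public using (M; B; M-[]; boolean-equation; module Free)
    open Automaton S g using (scan; scan-cong; unweighted; irreducible)

    open Scanning S g (λ _ → 1#) public using (partitionWeight)

    sum-NC : ∀ a w → ∑ (NC (suc (length w))) (λ π → partitionWeight π (a ∷ w)) ≈ M (a ∷ w)
    sum-NC a w = begin
      ∑ (NC (suc (length w))) (λ π → partitionWeight π (a ∷ w))   ≈⟨ ∑-filter isNC (allPartitions (suc (length w))) _ ⟩
      ∑ (allPartitions (suc (length w))) (λ π → indicator (isNC π) * partitionWeight π (a ∷ w))
        ≈⟨ ∑-cong (allPartitions (suc (length w))) (λ _ → *-congˡ (sym (*-identityˡ _))) ⟩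
      ∑ (allPartitions (suc (length w))) (λ π → summand π (a ∷ w)) ≈⟨ scan-NC a w ⟩
      M (a ∷ w)                                                    ∎
      where open Scanning S g (λ _ → 1#) using (summand; scan-NC)

    sum-NCirr : ∀ a w → ∑ (NCirr (suc (length w))) (λ π → partitionWeight π (a ∷ w)) ≈ B (a ∷ w)
    sum-NCirr a w = begin
      ∑ (NCirr (suc (length w))) (λ π → partitionWeight π (a ∷ w))  ≈⟨ ∑-filter _ (allPartitions (suc (length w))) _ ⟩
      ∑ (allPartitions (suc (length w))) (λ π → indicator (isNC π ∧ isIrr π) * partitionWeight π (a ∷ w))
        ≈⟨ ∑-cong (allPartitions (suc (length w))) (λ {π} _ → split-∧ (isNC π) (isIrr π) _) ⟩
      ∑ (allPartitions (suc (length w))) (λ π → summand π (a ∷ w))  ≈⟨ scan-NC a w ⟩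
      scan ω 0 [] (a ∷ w)                                           ≈⟨ scan-cong (λ _ → ω≈irreducible) 0 [] (a ∷ w) ⟩
      B (a ∷ w)                                                     ∎
      where
      open Scanning S g indicator using (summand; scan-NC; ω)
      split-∧ : ∀ p q y → indicator (p ∧ q) * y ≈ indicator p * (indicator q * y)
      split-∧ true  q y = sym (*-identityˡ _)
      split-∧ false q y = trans (zeroˡ _) (sym (zeroˡ _))
      ω≈irreducible : ∀ l → ω 0 l ≈ irreducible 0 l
      ω≈irreducible 0             = refl
      ω≈irreducible 1             = refl
      ω≈irreducible (suc (suc l)) = refl

  -- A nonempty growth string begins with 0. Recording this provides a block, so that the truncated
  -- `nBlocks π ∸ 1` is the true exponent |π| - 1.
  ∑-NCirr-cong : ∀ n {f f′} → (∀ ρ → f (0 ∷ ρ) ≈ f′ (0 ∷ ρ)) → ∑ (NCirr (suc n)) f ≈ ∑ (NCirr (suc n)) f′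
  ∑-NCirr-cong n {f} {f′} p = begin
    ∑ (NCirr (suc n)) f   ≈⟨ first f ⟩
    ∑ (ext 1 n) (λ ρ → member (0 ∷ ρ) * f (0 ∷ ρ))   ≈⟨ ∑-cong (ext 1 n) (λ _ → *-congˡ (p _)) ⟩
    ∑ (ext 1 n) (λ ρ → member (0 ∷ ρ) * f′ (0 ∷ ρ))  ≈⟨ first f′ ⟨
    ∑ (NCirr (suc n)) f′  ∎
    where
    member : Partition → Carrier
    member π = indicator (isNC π ∧ isIrr π)
    first : ∀ f → ∑ (NCirr (suc n)) f ≈ ∑ (ext 1 n) (λ ρ → member (0 ∷ ρ) * f (0 ∷ ρ))
    first f = trans (∑-filter _ (allPartitions (suc n)) f) (trans (∑-ext 0 n _) (+-identityˡ _))

  neg-∑ : ∀ {a} {A : Set a} (xs : List A) f → - ∑ xs f ≈ ∑ xs (λ y → - f y)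
  neg-∑ []       f = -0#≈0#
  neg-∑ (y ∷ xs) f = trans (sym (-‿+-comm _ _)) (+-congˡ (neg-∑ xs f))

  ∏-neg : ∀ {a} {A : Set a} (xs : List A) {f f′} → (∀ y → f′ y ≈ - f y) → ∏ xs f′ ≈ signPow S (length xs) * ∏ xs f
  ∏-neg []       p = sym (*-identityˡ _)
  ∏-neg (y ∷ xs) {f} {f′} p = begin
    f′ y * ∏ xs f′                                   ≈⟨ *-cong (p y) (∏-neg xs p) ⟩
    - f y * (signPow S (length xs) * ∏ xs f)         ≈⟨ sym (-‿distribˡ-* _ _) ⟩
    - (f y * (signPow S (length xs) * ∏ xs f))       ≈⟨ -‿cong (solve 3 (λ f s p → f :* (s :* p) := s :* (f :* p)) refl _ _ _) ⟩
    - (signPow S (length xs) * (f y * ∏ xs f))       ≈⟨ -‿distribˡ-* _ _ ⟩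
    - signPow S (length xs) * (f y * ∏ xs f)         ∎

  -- Negating every block weight produces (-1)^|π|, and the outer minus sign lowers the exponent by
  -- one.
  neg-B : ∀ (g g′ : ℕ → List X → Carrier) → (∀ N u → g′ N u ≈ - g N u) → ∀ a w →
    - NC-sums.B g′ (a ∷ w) ≈ ∑ (NCirr (suc (length w))) (λ π → signPow S (nBlocks π ∸ 1) * NC-sums.partitionWeight g π (a ∷ w))
  neg-B g g′ p a w = begin
    - NC-sums.B g′ (a ∷ w)   ≈⟨ -‿cong (sym (NC-sums.sum-NCirr g′ a w)) ⟩
    - ∑ (NCirr (suc (length w))) (λ π → NC-sums.partitionWeight g′ π (a ∷ w))   ≈⟨ neg-∑ (NCirr (suc (length w))) _ ⟩
    ∑ (NCirr (suc (length w))) (λ π → - NC-sums.partitionWeight g′ π (a ∷ w))   ≈⟨ ∑-NCirr-cong (length w) term ⟩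
    ∑ (NCirr (suc (length w))) (λ π → signPow S (nBlocks π ∸ 1) * NC-sums.partitionWeight g π (a ∷ w)) ∎
    where
    sign : ∀ n → 0 < n → - signPow S n ≈ signPow S (n ∸ 1)
    sign (suc n) _ = -‿involutive _
    term : ∀ ρ → - NC-sums.partitionWeight g′ (0 ∷ ρ) (a ∷ w) ≈ signPow S (nBlocks (0 ∷ ρ) ∸ 1) * NC-sums.partitionWeight g (0 ∷ ρ) (a ∷ w)
    term ρ = begin
      - NC-sums.partitionWeight g′ π (a ∷ w)                                   ≈⟨ -‿cong (∏-neg (blockLabels π) (λ k → p _ _)) ⟩
      - (signPow S (length (blockLabels π)) * NC-sums.partitionWeight g π (a ∷ w))   ≈⟨ -‿distribˡ-* _ _ ⟩
      - signPow S (length (blockLabels π)) * NC-sums.partitionWeight g π (a ∷ w)     ≈⟨ *-congʳ (-‿cong (reflexive (≡.cong (signPow S) (length-upTo (nBlocks π))))) ⟩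
      - signPow S (nBlocks π) * NC-sums.partitionWeight g π (a ∷ w)                  ≈⟨ *-congʳ (sign (nBlocks π) (∈⇒<nBlocks π (here ≡.refl))) ⟩
      signPow S (nBlocks π ∸ 1) * NC-sums.partitionWeight g π (a ∷ w)                ∎
      where π = 0 ∷ ρ

  module Reciprocals (recip : ℕ → Carrier) (recip-inverse : ∀ n → fromℕ S (suc n) * recip (suc n) ≈ 1#) where

    fromℕ-* : ∀ m n → fromℕ S (m ℕ.* n) ≈ fromℕ S m * fromℕ S n
    fromℕ-* zero    n = sym (zeroˡ _)
    fromℕ-* (suc m) n = trans (fromℕ-+ n (m ℕ.* n)) (trans (+-congˡ (fromℕ-* m n))
      (solve 2 (λ m n → n :+ m :* n := (con 1 :+ m) :* n) refl _ _))

    recip-unique : ∀ {n y} → 0 < n → fromℕ S n * y ≈ 1# → recip n ≈ y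
    recip-unique {suc n} {y} _ p = begin
      recip (suc n)                            ≈⟨ trans (sym (*-identityʳ _)) (*-congˡ (sym p)) ⟩
      recip (suc n) * (fromℕ S (suc n) * y)    ≈⟨ solve 3 (λ r n y → r :* (n :* y) := n :* r :* y) refl _ _ _ ⟩
      fromℕ S (suc n) * recip (suc n) * y      ≈⟨ trans (*-congʳ (recip-inverse n)) (*-identityˡ y) ⟩
      y                                        ∎

    inverse : ∀ {n} → 0 < n → fromℕ S n * recip n ≈ 1#
    inverse {suc n} _ = recip-inverse n

    product : (ℕ → ℕ) → List ℕ → ℕ
    product n = foldr (λ k acc → n k ℕ.* acc) 1

    product-positive : ∀ n ks → (∀ {k} → k ∈ ks → 0 < n k) → 0 < product n ks
    product-positive n []       p = s≤s z≤n
    product-positive n (k ∷ ks) p = ℕₚ.*-mono-≤ (p (here ≡.refl)) (product-positive n ks (p ∘ there))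

    -- Multiplicativity of `recip` comes from uniqueness of inverses, which is why every factor has
    -- to be positive.
    recip-product : ∀ n ks → (∀ {k} → k ∈ ks → 0 < n k) → recip (product n ks) ≈ ∏ ks (recip ∘ n)
    recip-product n []       p = recip-unique (s≤s z≤n) (trans (*-identityʳ _) (+-identityʳ 1#))
    recip-product n (k ∷ ks) p = trans (recip-unique (product-positive n (k ∷ ks) p) (begin
      fromℕ S (n k ℕ.* product n ks) * (recip (n k) * recip (product n ks))      ≈⟨ *-congʳ (fromℕ-* (n k) _) ⟩
      fromℕ S (n k) * fromℕ S (product n ks) * (recip (n k) * recip (product n ks))
        ≈⟨ solve 4 (λ a b r s → a :* b :* (r :* s) := a :* r :* (b :* s)) refl _ _ _ _ ⟩
      fromℕ S (n k) * recip (n k) * (fromℕ S (product n ks) * recip (product n ks))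
        ≈⟨ *-cong (inverse (p (here ≡.refl))) (inverse (product-positive n ks (p ∘ there))) ⟩
      1# * 1#   ≈⟨ *-identityˡ 1# ⟩
      1#        ∎)) (*-congˡ (recip-product n ks (p ∘ there)))

    -- The tree factorial is a product over blocks, so its reciprocal can be distributed to the
    -- block weights that the scan uses.
    recip-tauFact : ∀ h π w → NC-sums.partitionWeight (λ N u → recip N * h u) π w ≈ recip (tauFact π) * fπ S h π w
    recip-tauFact h π w = trans (∏-* (blockLabels π) _ _) (*-congʳ (sym (recip-product (Nblock π) (blockLabels π) (Nblock-positive π))))

    module Relations (m r b h : Ser)
      (free : ∀ a w → m (a ∷ w) ≈ ∑ (NC (suc (length w))) (λ π → fπ S r π (a ∷ w)))
      (boolean : ∀ a w → m (a ∷ w) ≈ ∑ (Int (suc (length w))) (λ π → fπ S b π (a ∷ w)))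
      (monotone : ∀ a w → m (a ∷ w) ≈ ∑ (NC (suc (length w))) (λ π → recip (tauFact π) * fπ S h π (a ∷ w))) where

      private
        module F = NC-sums (λ _ → r)
        module N = NC-sums (λ _ u → - b u)
        module H = NC-sums (λ N u → recip N * h u)
        module K = NC-sums (λ N u → recip N * - h u)

      -- The moment-cumulant relations concern nonempty words; `unital`, and `reduced` in the case
      -- of `b`, supply the constant terms that the series equations require.
      F-moments : F.M ≋ unital m
      F-moments []      = F.M-[]
      F-moments (a ∷ w) = sym (trans (free a w) (F.sum-NC a w))

      H-moments : H.M ≋ unital m
      H-moments []      = H.M-[]
      H-moments (a ∷ w) = sym (trans (monotone a w)
        (trans (∑-cong (NC (suc (length w))) (λ {π} _ → sym (recip-tauFact h π (a ∷ w)))) (H.sum-NC a w)))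

      b-equation : unital m ≋ ε ⊕ reduced b ⋆ unital m
      b-equation = interval-equation (unital m) refl (λ a w → trans (boolean a w) (runs-Int a w))
        where open IntervalScanning S b

      b-equation-for : ∀ {M} → M ≋ unital m → M ≋ ε ⊕ reduced b ⋆ M
      b-equation-for p w = trans (p w) (trans (b-equation w) (+-congˡ (⋆-cong (λ _ → refl) (λ v → sym (p v)) w)))

      r-equation-for : ∀ {M} → M ≋ unital m → M ≋ σ M (unital r)
      r-equation-for {M} p w = begin
        M w                    ≈⟨ trans (p w) (sym (F-moments w)) ⟩
        F.M w                  ≈⟨ F.Free.free-equation r (λ _ _ → refl) w ⟩
        σ F.M (unital r) w     ≈⟨ σ-cong (λ v → trans (F-moments v) (sym (p v))) (λ _ → refl) w ⟩
        σ M (unital r) w       ∎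

      b-of-r : ∀ a w → b (a ∷ w) ≈ ∑ (NCirr (suc (length w))) (λ π → fπ S r π (a ∷ w))
      b-of-r a w = trans (boolean-unique F.M-[] (b-equation-for F-moments) F.boolean-equation (a ∷ w)) (sym (F.sum-NCirr a w))

      b-of-h : ∀ a w → b (a ∷ w) ≈ ∑ (NCirr (suc (length w))) (λ π → recip (tauFact π) * fπ S h π (a ∷ w))
      b-of-h a w = trans (boolean-unique H.M-[] (b-equation-for H-moments) H.boolean-equation (a ∷ w))
        (trans (sym (H.sum-NCirr a w)) (∑-cong (NCirr (suc (length w))) (λ {π} _ → recip-tauFact h π (a ∷ w))))

      -- `N` has free cumulants - b, so its Boolean cumulants `N.B` are the irreducible sums of - b;
      -- as `N` inverts the moments, `free-of-inverse` gives r = - `N.B` on nonempty words.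
      r-of-b : ∀ a w → r (a ∷ w) ≈ ∑ (NCirr (suc (length w))) (λ π → signPow S (nBlocks π ∸ 1) * fπ S b π (a ∷ w))
      r-of-b a w = trans (sym (trans (sym (+-identityˡ _)) (free-of-inverse inv (r-equation-for F-moments) N.boolean-equation (a ∷ w))))
        (neg-B (λ _ → b) (λ _ u → - b u) (λ _ _ → refl) a w)
        where
        unital-neg : unital (λ u → - b u) ≋ ε ⊕ ⊖ reduced b
        unital-neg []      = sym (trans (+-congˡ -0#≈0#) (+-identityʳ 1#))
        unital-neg (a ∷ w) = sym (+-identityˡ _)
        inv : compose N.M F.M ≋ ε
        inv = free-of-neg-boolean (b-equation-for F-moments)
          (λ w → trans (N.Free.free-equation (λ u → - b u) (λ _ _ → refl) w) (σ-cong (λ _ → refl) unital-neg w))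

      r-of-h : ∀ a w → r (a ∷ w) ≈ ∑ (NCirr (suc (length w))) (λ π → signPow S (nBlocks π ∸ 1) * (recip (tauFact π) * fπ S h π (a ∷ w)))
      r-of-h a w = trans (sym (trans (sym (+-identityˡ _)) (free-of-inverse inv (r-equation-for H-moments) K.boolean-equation (a ∷ w))))
        (trans (neg-B (λ N u → recip N * h u) (λ N u → recip N * - h u) (λ N u → trans (*-comm _ _) (trans (sym (-‿distribˡ-* _ _)) (-‿cong (*-comm _ _)))) a w)
          (∑-cong (NCirr (suc (length w))) (λ {π} _ → *-congˡ (recip-tauFact h π (a ∷ w)))))
        where
        inv : compose K.M H.M ≋ ε
        inv = MonotoneInverse.monotone-inverse S h recip recip-inverse

-- Splitting 𝔾-valued relations into scalar and infinitesimal parts.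

module Infinitesimal {c ℓ} (R : CommutativeRing c ℓ) where
  open CommutativeRing R
  open Sums R
  open import Algebra.Properties.Ring ring using (-0#≈0#)
  open import Algebra.Solver.Ring.NaturalCoefficients.Default commutativeSemiring
    using (solve; _:+_; _:*_; _:=_)
  open import Relation.Binary.Reasoning.Setoid setoid
  private module 𝔾R = CommutativeRing (dual R)
  private module S𝔾 = Sums (dual R)

  ∑-dual : ∀ {a} {A : Set a} (xs : List A) f → S𝔾.∑ xs f 𝔾R.≈ (∑ xs (proj₁ ∘ f) , ∑ xs (proj₂ ∘ f))
  ∑-dual []       f = 𝔾R.refl
  ∑-dual (y ∷ xs) f = 𝔾R.+-cong {f y} {f y} 𝔾R.refl (∑-dual xs f)

  others : List ℕ → ℕ → List ℕ
  others ks k = filterᵇ (λ j → not (j ≡ᵇ k)) ks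

  -- The Leibniz rule. `others` deletes by label, so distinct labels guarantee that exactly one
  -- factor is removed.
  ∏-dual : ∀ {ks} (f f′ : ℕ → Carrier) → Unique ks →
    S𝔾.∏ ks (λ k → f k , f′ k) 𝔾R.≈ (∏ ks f , ∑ ks (λ k → f′ k * ∏ (others ks k) f))
  ∏-dual f f′ [] = 𝔾R.refl
  ∏-dual {k ∷ ks} f f′ (k∉ ∷ u) with p , q ← ∏-dual f f′ u = *-congˡ p , (begin
    f k * proj₂ (S𝔾.∏ ks (λ k → f k , f′ k)) + f′ k * proj₁ (S𝔾.∏ ks (λ k → f k , f′ k))
      ≈⟨ +-cong (*-congˡ q) (*-congˡ p) ⟩
    f k * ∑ ks (λ j → f′ j * ∏ (others ks j) f) + f′ k * ∏ ks f
      ≈⟨ trans (+-comm _ _) (+-cong (*-congˡ (reflexive (≡.cong (λ xs → ∏ xs f) (≡.sym own)))) (∑-scale ks)) ⟩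
    f′ k * ∏ (others (k ∷ ks) k) f + ∑ ks (λ j → f k * (f′ j * ∏ (others ks j) f))
      ≈⟨ +-congˡ (∑-cong ks (λ m → trans (solve 3 (λ x y z → x :* (y :* z) := y :* (x :* z)) refl _ _ _) (*-congˡ (reflexive (≡.cong (λ xs → ∏ xs f) (≡.sym (other (All.lookup k∉ m)))))))) ⟩
    ∑ (k ∷ ks) (λ j → f′ j * ∏ (others (k ∷ ks) j) f) ∎)
    where
    ∑-scale : ∀ ks {g : ℕ → Carrier} → f k * ∑ ks g ≈ ∑ ks (λ j → f k * g j)
    ∑-scale []       = zeroʳ _
    ∑-scale (j ∷ ks) = trans (distribˡ _ _ _) (+-congˡ (∑-scale ks))
    keep : ∀ {xs} → All (k ≢_) xs → others xs k ≡ xs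
    keep []                   = ≡.refl
    keep {j ∷ xs} (k≢j ∷ p) rewrite ≡ᵇ-false (k≢j ∘ ≡.sym) = ≡.cong (j ∷_) (keep p)
    own : others (k ∷ ks) k ≡ ks
    own rewrite ≡ᵇ-refl k = keep k∉
    other : ∀ {j} → k ≢ j → others (k ∷ ks) j ≡ k ∷ others ks j
    other k≢j rewrite ≡ᵇ-false k≢j = ≡.refl

  fπ-dual : ∀ {a} {A : Set a} (f f′ : List A → Carrier) π w → f̃π R (tilde R f f′) π w 𝔾R.≈ (fπ R f π w , ∂fπ R f f′ π w)
  fπ-dual f f′ π w = ∏-dual _ _ (upTo⁺ (nBlocks π))

  ι-* : ∀ y p → (ι R y 𝔾R.* p) 𝔾R.≈ (y * proj₁ p , y * proj₂ p)
  ι-* y p = refl , trans (+-congˡ (zeroˡ _)) (+-identityʳ _)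

  ι-fromℕ : ∀ n → fromℕ (dual R) n 𝔾R.≈ ι R (fromℕ R n)
  ι-fromℕ zero    = 𝔾R.refl
  ι-fromℕ (suc n) = +-congˡ (proj₁ (ι-fromℕ n)) , trans (+-identityˡ _) (proj₂ (ι-fromℕ n))

  ι-signPow : ∀ n → signPow (dual R) n 𝔾R.≈ ι R (signPow R n)
  ι-signPow zero    = 𝔾R.refl
  ι-signPow (suc n) = -‿cong (proj₁ (ι-signPow n)) , trans (-‿cong (proj₂ (ι-signPow n))) -0#≈0#

  ι-recip : ∀ {recip : ℕ → Carrier} → (∀ n → fromℕ R (suc n) * recip (suc n) ≈ 1#) →
    ∀ n → (fromℕ (dual R) (suc n) 𝔾R.* ι R (recip (suc n))) 𝔾R.≈ 𝔾R.1#
  ι-recip p n = 𝔾R.trans (𝔾R.*-congʳ (ι-fromℕ (suc n))) (𝔾R.trans (ι-* _ _) (p n , zeroʳ _))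

  ∑-fπ : ∀ {a} {A : Set a} (xs : List Partition) (f f′ : List A → Carrier) w {y y′} →
    y ≈ ∑ xs (λ π → fπ R f π w) → y′ ≈ ∑ xs (λ π → ∂fπ R f f′ π w) →
    (y , y′) 𝔾R.≈ S𝔾.∑ xs (λ π → f̃π R (tilde R f f′) π w)
  ∑-fπ xs f f′ w p q = 𝔾R.trans (p , q)
    (𝔾R.sym (𝔾R.trans (S𝔾.∑-cong xs (λ {π} _ → fπ-dual f f′ π w)) (∑-dual xs _)))

  ∑-weighted-fπ : ∀ {a} {A : Set a} (xs : List Partition) (s : Partition → Carrier) (f f′ : List A → Carrier) w {y y′} →
    y ≈ ∑ xs (λ π → s π * fπ R f π w) → y′ ≈ ∑ xs (λ π → s π * ∂fπ R f f′ π w) →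
    (y , y′) 𝔾R.≈ S𝔾.∑ xs (λ π → ι R (s π) 𝔾R.* f̃π R (tilde R f f′) π w)
  ∑-weighted-fπ xs s f f′ w p q = 𝔾R.trans (p , q)
    (𝔾R.sym (𝔾R.trans (S𝔾.∑-cong xs (λ {π} _ → 𝔾R.trans (𝔾R.*-congˡ {ι R (s π)} (fπ-dual f f′ π w)) (ι-* (s π) _))) (∑-dual xs _)))

  ι-sign-recip : ∀ n (y : Carrier) p → (signPow (dual R) n 𝔾R.* (ι R y 𝔾R.* p)) 𝔾R.≈ (ι R (signPow R n * y) 𝔾R.* p)
  ι-sign-recip n y p = 𝔾R.trans (𝔾R.sym (𝔾R.*-assoc (signPow (dual R) n) (ι R y) p))
    (𝔾R.*-congʳ {p} (𝔾R.trans (𝔾R.*-congʳ {ι R y} (ι-signPow n)) (𝔾R.trans (ι-* _ (ι R y)) (refl , zeroʳ _))))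

-- The four formulas, from the cumulant relations over 𝔾.

theorem5p1 : ∀ {c ℓ m ℓm : Level} (R : CommutativeRing c ℓ) →
    let open CommutativeRing R in
    (recip : ℕ → Carrier) → (∀ n → (fromℕ R (suc n) * recip (suc n)) ≈ 1#) →
    (P : InfNCPS R m ℓm) →
    (r r′ b b′ h h′ : List (𝒜 P) → Carrier) →
    IsFreeCumulants R P r r′ →
    IsBooleanCumulants R P b b′ →
    IsMonotoneCumulants R P recip h h′ →
    (as : List (𝒜 P)) → 1 ≤ length as →
    _≈𝔾_ R (tilde R b b′ as)
    (Σ𝔾[_]_ R (NCirr (length as)) (λ π → f̃π R (tilde R r r′) π as))
    × _≈𝔾_ R (tilde R r r′ as)
    (Σ𝔾[_]_ R (NCirr (length as))
    (λ π → _*𝔾_ R (ι R (signPow R (nBlocks π ∸ 1))) (f̃π R (tilde R b b′) π as)))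
    × _≈𝔾_ R (tilde R b b′ as)
    (Σ𝔾[_]_ R (NCirr (length as))
    (λ π → _*𝔾_ R (ι R (recip (tauFact π))) (f̃π R (tilde R h h′) π as)))
    × _≈𝔾_ R (tilde R r r′ as)
    (Σ𝔾[_]_ R (NCirr (length as))
    (λ π → _*𝔾_ R (ι R (signPow R (nBlocks π ∸ 1) * recip (tauFact π))) (f̃π R (tilde R h h′) π as)))
theorem5p1 R recip recip-inverse P r r′ b b′ h h′ free boolean monotone (a ∷ w) _ =
    b-of-r a w
  , 𝔾R.trans (r-of-b a w) (S𝔾.∑-cong irr (λ {π} _ → 𝔾R.*-congʳ {f̃π R (tilde R b b′) π (a ∷ w)} (ι-signPow (nBlocks π ∸ 1))))
  , b-of-h a w
  , 𝔾R.trans (r-of-h a w) (S𝔾.∑-cong irr (λ {π} _ → ι-sign-recip (nBlocks π ∸ 1) (recip (tauFact π)) (f̃π R (tilde R h h′) π (a ∷ w))))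
  where
  open Infinitesimal R
  module 𝔾R = CommutativeRing (dual R)
  module S𝔾 = Sums (dual R)
  irr = NCirr (suc (length w))
  -- The relations for φ and φ′ are the two components of a single relation over 𝔾, here and in the
  -- two companions below.
  free𝔾 : ∀ a w → tilde R (φₙ P) (φ′ₙ P) (a ∷ w) 𝔾R.≈ S𝔾.∑ (NC (suc (length w))) (λ π → f̃π R (tilde R r r′) π (a ∷ w))
  free𝔾 a w = let p , q = free (a ∷ w) (s≤s z≤n) in ∑-fπ (NC (suc (length w))) r r′ (a ∷ w) p q
  boolean𝔾 : ∀ a w → tilde R (φₙ P) (φ′ₙ P) (a ∷ w) 𝔾R.≈ S𝔾.∑ (Int (suc (length w))) (λ π → f̃π R (tilde R b b′) π (a ∷ w))
  boolean𝔾 a w = let p , q = boolean (a ∷ w) (s≤s z≤n) in ∑-fπ (Int (suc (length w))) b b′ (a ∷ w) p q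
  monotone𝔾 : ∀ a w → tilde R (φₙ P) (φ′ₙ P) (a ∷ w) 𝔾R.≈
    S𝔾.∑ (NC (suc (length w))) (λ π → ι R (recip (tauFact π)) 𝔾R.* f̃π R (tilde R h h′) π (a ∷ w))
  monotone𝔾 a w = let p , q = monotone (a ∷ w) (s≤s z≤n) in
    ∑-weighted-fπ (NC (suc (length w))) (λ π → recip (tauFact π)) h h′ (a ∷ w) p q
  open Cumulants (dual R) {X = 𝒜 P}
  open Reciprocals (λ n → ι R (recip n)) (ι-recip {recip} recip-inverse)
  open Relations (tilde R (φₙ P) (φ′ₙ P)) (tilde R r r′) (tilde R b b′) (tilde R h h′) free𝔾 boolean𝔾 monotone𝔾
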